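{- Let $W$ be an irreducible complex reflection group acting on $V$, and let $T$ be the set of all reflections in $W$. The Cayley graph $\Gamma(W,T)$ is adjacency integral (every eigenvalue of its adjacency matrix is an integer), and the codimension spectrum of $W$ is integral (every eigenvalue of the matrix $(\operatorname{codim}(vw^{ -1}))_{v,w\in W}$ is an integer).
   Context: Let $V$ be a finite-dimensional complex vector space of dimension $n$. A reflection on $V$ is a linear transformation of $V$ of finite order whose eigenspace for eigenvalue $1$ has dimension $n-1$. A complex reflection group $W$ on $V$ is a finite subgroup of $\mathrm{GL}(V)$ generated by reflections (and $V$ carries a $W$-invariant hermitian form). It is irreducible if it acts irreducibly on the orthogonal complement of its fixed point space (the fixed point space may be zero). The (left) Cayley graph $\Gamma(W,T)$ is the undirected graph with vertex set $W$ and an edge joining $g$ and $tg$ for each $g\in W$, $t\in T$. Its adjacency matrix has $(g,h)$-entry equal to the number of edges joining $g$ and $h$ (so $1$ if $gh^{ -1}\in T$ and $0$ otherwise). For $w\in W$, $\operatorname{codim}(w)$ denotes the codimension in $V$ of the fixed point space $V^w=\{v\in V\mid wv=v\}$. The codimension matrix of $W$ has rows and columns indexed by $W$ with $(v,w)$-entry $\operatorname{codim}(vw^{ -1})$, and the codimension spectrum is its set of eigenvalues. -}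

module Defs where

open import Level using (Level; 0ℓ; _⊔_) renaming (suc to lsuc)
open import Algebra.Bundles using (CommutativeRing; Group; Ring)
open import Algebra.Module.Bundles using (LeftModule)
open import Algebra.Module.Morphism.Structures
  using (module LeftModuleMorphisms)
import Algebra.Module.Morphism.Construct.Composition as Composition
import Algebra.Module.Morphism.Construct.Identity as Identity
import Algebra.Definitions.RawMonoid as MonoidDefinitions
import Algebra.Properties.Ring as RingProperties
import Algebra.Solver.Ring.NaturalCoefficients.Default as SemiringSolver
open import Data.Fin.Base using (Fin)
open import Data.Integer.Base using (ℤ; +_; 0ℤ; 1ℤ)
open import Data.Nat.Base as ℕ using (ℕ; zero; suc)
import Data.Nat.Properties as ℕ
open import Data.Product.Base using (Σ; ∃; ∃-syntax; _×_; _,_; proj₁; proj₂)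
open import Data.Rational.Base as ℚ using (ℚ; 0ℚ; 1ℚ; ½; Positive; ∣_∣)
import Data.Rational.Properties as ℚ
open import Data.Rational.Solver using (module +-*-Solver)
open import Data.Sum.Base using (inj₁; inj₂)
open import Relation.Binary.Construct.Closure.Symmetric using (SymClosure)
open import Relation.Binary.Core using (Rel)
open import Relation.Binary.PropositionalEquality
  using (_≡_; refl; sym; trans; cong; cong₂; subst)
open import Relation.Binary.Structures using (IsEquivalence)
open import Relation.Nullary.Negation.Core using (¬_)
open import Relation.Unary using (Pred; _∈_; _⊆_; U)

------------------------------------------------------------------------
-- Real numbers: Cauchy sequences of rationals modulo null sequences

IsCauchy : (ℕ → ℚ) → Set
IsCauchy x = ∀ ε .{{_ : Positive ε}} →
  ∃[ N ] (∀ m n → N ℕ.≤ m → N ℕ.≤ n → ∣ x m ℚ.- x n ∣ ℚ.≤ ε)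

IsNull : (ℕ → ℚ) → Set
IsNull x = ∀ ε .{{_ : Positive ε}} →
  ∃[ N ] (∀ n → N ℕ.≤ n → ∣ x n ∣ ℚ.≤ ε)

record ℝ : Set where
  constructor mkℝ
  field
    seq    : ℕ → ℚ
    cauchy : IsCauchy seq

open ℝ public

infix 4 _≈ʳ_ _≤ʳ_ _<ʳ_

_≈ʳ_ : Rel ℝ 0ℓ
x ≈ʳ y = IsNull (λ n → seq x n ℚ.- seq y n)

_≤ʳ_ : Rel ℝ 0ℓ
x ≤ʳ y = ∀ ε .{{_ : Positive ε}} →
  ∃[ N ] (∀ n → N ℕ.≤ n → seq x n ℚ.≤ seq y n ℚ.+ ε)

_<ʳ_ : Rel ℝ 0ℓ
x <ʳ y = ∃[ ε ] (Positive ε ×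
  ∃[ N ] (∀ n → N ℕ.≤ n → seq x n ℚ.+ ε ℚ.≤ seq y n))

private

  half : ℚ → ℚ
  half ε = ε ℚ.* ½

  half-pos : ∀ ε .{{_ : Positive ε}} → Positive (half ε)
  half-pos ε = ℚ.pos*pos⇒pos ε ½

  half+half : ∀ ε → half ε ℚ.+ half ε ≡ ε
  half+half ε =
    trans (sym (ℚ.*-distribˡ-+ ε ½ ½)) (ℚ.*-identityʳ ε)

  scale : ∀ (ε B : ℚ) .{{_ : Positive B}} → ℚ
  scale ε B = half ε ℚ.* (ℚ.1/ B) {{ℚ.pos⇒nonZero B}}

  scale-pos : ∀ ε B .{{_ : Positive ε}} .{{_ : Positive B}} →
              Positive (scale ε B)
  scale-pos ε B =
    ℚ.pos*pos⇒pos (half ε) {{half-pos ε}}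
      ((ℚ.1/ B) {{ℚ.pos⇒nonZero B}}) {{ℚ.1/pos⇒pos B}}

  scale-* : ∀ ε B .{{_ : Positive B}} → scale ε B ℚ.* B ≡ half ε
  scale-* ε B = trans (ℚ.*-assoc (half ε) ((ℚ.1/ B) {{ℚ.pos⇒nonZero B}}) B)
    (trans (cong (half ε ℚ.*_) (ℚ.*-inverseˡ B {{ℚ.pos⇒nonZero B}}))
      (ℚ.*-identityʳ (half ε)))

  ∣+∣-bound : ∀ {p q a b} → ∣ p ∣ ℚ.≤ a → ∣ q ∣ ℚ.≤ b →
              ∣ p ℚ.+ q ∣ ℚ.≤ a ℚ.+ b
  ∣+∣-bound {p} {q} p≤a q≤b =
    ℚ.≤-trans (ℚ.∣p+q∣≤∣p∣+∣q∣ p q) (ℚ.+-mono-≤ p≤a q≤b)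

  ∣*∣-bound : ∀ {p q δ B} .{{_ : Positive δ}} → ∣ p ∣ ℚ.≤ δ → ∣ q ∣ ℚ.≤ B →
              ∣ p ℚ.* q ∣ ℚ.≤ δ ℚ.* B
  ∣*∣-bound {p} {q} {δ} p≤δ q≤B =
    subst (ℚ._≤ _) (sym (ℚ.∣p*q∣≡∣p∣*∣q∣ p q))
      (ℚ.≤-trans
        (ℚ.*-monoʳ-≤-nonNeg ∣ q ∣ {{ℚ.∣-∣-nonNeg q}} p≤δ)
        (ℚ.*-monoˡ-≤-nonNeg δ {{ℚ.pos⇒nonNeg δ}} q≤B))

  zero-bound : ∀ {p ε} .{{_ : Positive ε}} → p ≡ 0ℚ → ∣ p ∣ ℚ.≤ ε
  zero-bound {ε = ε} refl = ℚ.<⇒≤ (ℚ.positive⁻¹ ε)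

  ⊔-split : ∀ {k m n} → m ℕ.⊔ n ℕ.≤ k → m ℕ.≤ k × n ℕ.≤ k
  ⊔-split {k} {m} {n} p = ℕ.m⊔n≤o⇒m≤o m n p , ℕ.m⊔n≤o⇒n≤o m n p

  null-cong : ∀ x y → (∀ n → x n ≡ y n) → IsNull x → IsNull y
  null-cong x y eq nx ε with nx ε
  ... | N , f = N , λ n N≤n → subst (λ t → ∣ t ∣ ℚ.≤ ε) (eq n) (f n N≤n)

  null-0 : ∀ {x} → (∀ n → x n ≡ 0ℚ) → IsNull x
  null-0 eq ε = 0 , λ n _ → zero-bound (eq n)

  null-+ : ∀ x y → IsNull x → IsNull y → IsNull (λ n → x n ℚ.+ y n)
  null-+ x y nx ny ε
    with nx (half ε) {{half-pos ε}} | ny (half ε) {{half-pos ε}}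
  ... | M , f | N , g = M ℕ.⊔ N , λ n p →
    subst (_ ℚ.≤_) (half+half ε)
      (∣+∣-bound (f n (proj₁ (⊔-split p))) (g n (proj₂ (⊔-split {m = M} p))))

  null-neg : ∀ x → IsNull x → IsNull (λ n → ℚ.- x n)
  null-neg x nx ε with nx ε
  ... | N , f = N , λ n p → subst (ℚ._≤ ε) (sym (ℚ.∣-p∣≡∣p∣ (x n))) (f n p)

  Bounded : (ℕ → ℚ) → Set
  Bounded x = Σ ℚ λ B → Positive B × (∀ n → ∣ x n ∣ ℚ.≤ B)

  absSum : (ℕ → ℚ) → ℕ → ℚ
  absSum x zero    = ∣ x 0 ∣
  absSum x (suc n) = absSum x n ℚ.+ ∣ x (suc n) ∣

  ≤-+-nonNeg : ∀ p q → 0ℚ ℚ.≤ q → p ℚ.≤ p ℚ.+ q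
  ≤-+-nonNeg p q 0≤q =
    subst (ℚ._≤ p ℚ.+ q) (ℚ.+-identityʳ p) (ℚ.+-mono-≤ (ℚ.≤-refl {p}) 0≤q)

  absSum-nonNeg : ∀ x n → 0ℚ ℚ.≤ absSum x n
  absSum-nonNeg x zero    = ℚ.0≤∣p∣ (x 0)
  absSum-nonNeg x (suc n) = ℚ.≤-trans (absSum-nonNeg x n)
    (≤-+-nonNeg (absSum x n) ∣ x (suc n) ∣ (ℚ.0≤∣p∣ (x (suc n))))

  absSum-upper′ : ∀ x N {k} → k ℕ.≤′ N → ∣ x k ∣ ℚ.≤ absSum x N
  absSum-upper′ x zero    ℕ.≤′-refl     = ℚ.≤-refl
  absSum-upper′ x (suc N) ℕ.≤′-refl     =
    subst (ℚ._≤ absSum x N ℚ.+ ∣ x (suc N) ∣) (ℚ.+-identityˡ ∣ x (suc N) ∣)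
      (ℚ.+-mono-≤ (absSum-nonNeg x N) (ℚ.≤-refl {∣ x (suc N) ∣}))
  absSum-upper′ x (suc N) (ℕ.≤′-step p) = ℚ.≤-trans (absSum-upper′ x N p)
    (≤-+-nonNeg (absSum x N) ∣ x (suc N) ∣ (ℚ.0≤∣p∣ (x (suc N))))

  cauchy⇒bounded : ∀ {x} → IsCauchy x → Bounded x
  cauchy⇒bounded {x} cx with cx 1ℚ
  ... | N , f = absSum x N ℚ.+ 1ℚ , B-pos , bound
    where
    B-pos : Positive (absSum x N ℚ.+ 1ℚ)
    B-pos = ℚ.nonNeg+pos⇒pos (absSum x N)
      {{ℚ.nonNegative (absSum-nonNeg x N)}} 1ℚ

    early : ∀ {n} → n ℕ.≤ N → ∣ x n ∣ ℚ.≤ absSum x N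
    early p = absSum-upper′ x N (ℕ.≤⇒≤′ p)

    split : ∀ p q → q ℚ.+ (p ℚ.- q) ≡ p
    split = solve 2 (λ p q → q :+ (p :- q) := p) refl
      where open +-*-Solver

    bound : ∀ n → ∣ x n ∣ ℚ.≤ absSum x N ℚ.+ 1ℚ
    bound n with ℕ.≤-total n N
    ... | inj₁ n≤N = ℚ.≤-trans (early n≤N)
      (≤-+-nonNeg (absSum x N) 1ℚ (ℚ.<⇒≤ (ℚ.positive⁻¹ 1ℚ)))
    ... | inj₂ N≤n = subst (λ t → ∣ t ∣ ℚ.≤ absSum x N ℚ.+ 1ℚ)
      (split (x n) (x N))
      (∣+∣-bound (early ℕ.≤-refl) (f n N N≤n ℕ.≤-refl))

  null-*-bounded : ∀ x y → IsNull x → Bounded y →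
                   IsNull (λ n → x n ℚ.* y n)
  null-*-bounded x y nx (B , B-pos , y≤B) ε = go
    where
    instance
      _ : Positive B
      _ = B-pos
      _ : Positive (scale ε B)
      _ = scale-pos ε B

    half≤ : half ε ℚ.≤ ε
    half≤ = subst (half ε ℚ.≤_) (half+half ε)
      (≤-+-nonNeg (half ε) (half ε)
        (ℚ.<⇒≤ (ℚ.positive⁻¹ (half ε) {{half-pos ε}})))

    go : ∃[ N ] (∀ n → N ℕ.≤ n → ∣ x n ℚ.* y n ∣ ℚ.≤ ε)
    go with nx (scale ε B)
    ... | N , f = N , λ n p → ℚ.≤-trans
      (subst (∣ x n ℚ.* y n ∣ ℚ.≤_) (scale-* ε B)
        (∣*∣-bound {p = x n} (f n p) (y≤B n))) half≤

  +-cauchy : ∀ x y → IsCauchy x → IsCauchy y →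
             IsCauchy (λ n → x n ℚ.+ y n)
  +-cauchy x y cx cy ε
    with cx (half ε) {{half-pos ε}} | cy (half ε) {{half-pos ε}}
  ... | M , f | N , g = M ℕ.⊔ N , λ m n p q →
    subst (λ t → ∣ t ∣ ℚ.≤ ε) (rearrange (x m) (x n) (y m) (y n))
      (subst (_ ℚ.≤_) (half+half ε)
        (∣+∣-bound
          (f m n (proj₁ (⊔-split p)) (proj₁ (⊔-split q)))
          (g m n (proj₂ (⊔-split {m = M} p)) (proj₂ (⊔-split {m = M} q)))))
    where
    rearrange : ∀ a b c d → (a ℚ.- b) ℚ.+ (c ℚ.- d) ≡ (a ℚ.+ c) ℚ.- (b ℚ.+ d)
    rearrange = solve 4 (λ a b c d →
      (a :- b) :+ (c :- d) := (a :+ c) :- (b :+ d)) refl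
      where open +-*-Solver

  neg-cauchy : ∀ x → IsCauchy x → IsCauchy (λ n → ℚ.- x n)
  neg-cauchy x cx ε with cx ε
  ... | N , f = N , λ m n p q →
    subst (ℚ._≤ ε)
      (trans (sym (ℚ.∣-p∣≡∣p∣ (x m ℚ.- x n))) (cong ∣_∣ (flip (x m) (x n))))
      (f m n p q)
    where
    flip : ∀ a b → ℚ.- (a ℚ.- b) ≡ (ℚ.- a) ℚ.- (ℚ.- b)
    flip = solve 2 (λ a b → :- (a :- b) := (:- a) :- (:- b)) refl
      where open +-*-Solver

  const-cauchy : ∀ q → IsCauchy (λ _ → q)
  const-cauchy q ε = 0 , λ _ _ _ _ → zero-bound (ℚ.+-inverseʳ q)

  *-cauchy : ∀ x y → IsCauchy x → IsCauchy y →
             IsCauchy (λ n → x n ℚ.* y n)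
  *-cauchy x y cx cy ε
    with cauchy⇒bounded cx | cauchy⇒bounded cy
  ... | A , A-pos , x≤A | B , B-pos , y≤B = go
    where
    instance
      _ : Positive A
      _ = A-pos
      _ : Positive B
      _ = B-pos
      _ : Positive (scale ε A)
      _ = scale-pos ε A
      _ : Positive (scale ε B)
      _ = scale-pos ε B

    rearrange : ∀ a b c d →
      (a ℚ.- b) ℚ.* c ℚ.+ (c ℚ.- d) ℚ.* b ≡ a ℚ.* c ℚ.- b ℚ.* d
    rearrange = solve 4 (λ a b c d →
      (a :- b) :* c :+ (c :- d) :* b := a :* c :- b :* d) refl
      where open +-*-Solver

    go : ∃[ N ] (∀ m n → N ℕ.≤ m → N ℕ.≤ n →
           ∣ x m ℚ.* y m ℚ.- x n ℚ.* y n ∣ ℚ.≤ ε)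
    go with cx (scale ε B) | cy (scale ε A)
    ... | M , f | N , g = M ℕ.⊔ N , λ m n p q →
      subst (λ t → ∣ t ∣ ℚ.≤ ε) (rearrange (x m) (x n) (y m) (y n))
        (subst (_ ℚ.≤_)
          (trans (cong₂ ℚ._+_ (scale-* ε B) (scale-* ε A)) (half+half ε))
          (∣+∣-bound
            (∣*∣-bound {p = x m ℚ.- x n}
              (f m n (proj₁ (⊔-split p)) (proj₁ (⊔-split q))) (y≤B m))
            (∣*∣-bound {p = y m ℚ.- y n}
              (g m n (proj₂ (⊔-split {m = M} p)) (proj₂ (⊔-split {m = M} q)))
              (x≤A n))))

fromℚ : ℚ → ℝ
fromℚ q = mkℝ (λ _ → q) (const-cauchy q)

infixl 6 _+ʳ_
infixl 7 _*ʳ_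
infix  8 -ʳ_

_+ʳ_ : ℝ → ℝ → ℝ
x +ʳ y = mkℝ (λ n → seq x n ℚ.+ seq y n) (+-cauchy (seq x) (seq y) (cauchy x) (cauchy y))

_*ʳ_ : ℝ → ℝ → ℝ
x *ʳ y = mkℝ (λ n → seq x n ℚ.* seq y n) (*-cauchy (seq x) (seq y) (cauchy x) (cauchy y))

-ʳ_ : ℝ → ℝ
-ʳ x = mkℝ (λ n → ℚ.- seq x n) (neg-cauchy (seq x) (cauchy x))

0ʳ 1ʳ : ℝ
0ʳ = fromℚ 0ℚ
1ʳ = fromℚ 1ℚ

private

  pointwise : ∀ {x y} → (∀ n → seq x n ≡ seq y n) → x ≈ʳ y
  pointwise {x} {y} eq = null-0 λ n →
    trans (cong (ℚ._- seq y n) (eq n)) (ℚ.+-inverseʳ (seq y n))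

  ≈ʳ-sym : ∀ {x y} → x ≈ʳ y → y ≈ʳ x
  ≈ʳ-sym {x} {y} p = null-cong _ _ (λ n → eq (seq x n) (seq y n))
      (null-neg (λ n → seq x n ℚ.- seq y n) p)
    where
    eq : ∀ a b → ℚ.- (a ℚ.- b) ≡ b ℚ.- a
    eq = solve 2 (λ a b → :- (a :- b) := b :- a) refl
      where open +-*-Solver

  ≈ʳ-trans : ∀ {x y z} → x ≈ʳ y → y ≈ʳ z → x ≈ʳ z
  ≈ʳ-trans {x} {y} {z} p q =
    null-cong _ _ (λ n → eq (seq x n) (seq y n) (seq z n)) (null-+ (λ n → seq x n ℚ.- seq y n) (λ n → seq y n ℚ.- seq z n) p q)
    where
    eq : ∀ a b c → (a ℚ.- b) ℚ.+ (b ℚ.- c) ≡ a ℚ.- c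
    eq = solve 3 (λ a b c → (a :- b) :+ (b :- c) := a :- c) refl
      where open +-*-Solver

  +ʳ-cong : ∀ {x y u v} → x ≈ʳ y → u ≈ʳ v → (x +ʳ u) ≈ʳ (y +ʳ v)
  +ʳ-cong {x} {y} {u} {v} p q =
    null-cong _ _ (λ n → eq (seq x n) (seq y n) (seq u n) (seq v n)) 
      (null-+ (λ n → seq x n ℚ.- seq y n) (λ n → seq u n ℚ.- seq v n) p q)
    where
    eq : ∀ a b c d → (a ℚ.- b) ℚ.+ (c ℚ.- d) ≡ (a ℚ.+ c) ℚ.- (b ℚ.+ d)
    eq = solve 4 (λ a b c d →
      (a :- b) :+ (c :- d) := (a :+ c) :- (b :+ d)) refl
      where open +-*-Solver

  -ʳ-cong : ∀ {x y} → x ≈ʳ y → (-ʳ x) ≈ʳ (-ʳ y)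
  -ʳ-cong {x} {y} p = null-cong _ _ (λ n → eq (seq x n) (seq y n))
      (null-neg (λ n → seq x n ℚ.- seq y n) p)
    where
    eq : ∀ a b → ℚ.- (a ℚ.- b) ≡ (ℚ.- a) ℚ.- (ℚ.- b)
    eq = solve 2 (λ a b → :- (a :- b) := (:- a) :- (:- b)) refl
      where open +-*-Solver

  *ʳ-cong : ∀ {x y u v} → x ≈ʳ y → u ≈ʳ v → (x *ʳ u) ≈ʳ (y *ʳ v)
  *ʳ-cong {x} {y} {u} {v} p q =
    null-cong _ _ (λ n → eq (seq x n) (seq y n) (seq u n) (seq v n))
      (null-+ _ _ (null-*-bounded (λ n → seq x n ℚ.- seq y n) (seq u) p (cauchy⇒bounded (cauchy u)))
              (null-*-bounded (λ n → seq u n ℚ.- seq v n) (seq y) q (cauchy⇒bounded (cauchy y))))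
    where
    eq : ∀ a b c d →
      (a ℚ.- b) ℚ.* c ℚ.+ (c ℚ.- d) ℚ.* b ≡ a ℚ.* c ℚ.- b ℚ.* d
    eq = solve 4 (λ a b c d →
      (a :- b) :* c :+ (c :- d) :* b := a :* c :- b :* d) refl
      where open +-*-Solver

ℝ-commutativeRing : CommutativeRing 0ℓ 0ℓ
ℝ-commutativeRing = record
  { Carrier = ℝ
  ; _≈_ = _≈ʳ_
  ; _+_ = _+ʳ_
  ; _*_ = _*ʳ_
  ; -_ = -ʳ_
  ; 0# = 0ʳ
  ; 1# = 1ʳ
  ; isCommutativeRing = record
    { isRing = record
      { +-isAbelianGroup = record
        { isGroup = record
          { isMonoid = record
            { isSemigroup = record
              { isMagma = record
                { isEquivalence = record
                  { refl = λ {x} → pointwise {x} {x} λ _ → refl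
                  ; sym = λ {x} {y} → ≈ʳ-sym {x} {y}
                  ; trans = λ {x} {y} {z} → ≈ʳ-trans {x} {y} {z}
                  }
                ; ∙-cong = λ {x} {y} {u} {v} → +ʳ-cong {x} {y} {u} {v}
                }
              ; assoc = λ x y z → pointwise {x +ʳ y +ʳ z} {x +ʳ (y +ʳ z)}
                  λ n → ℚ.+-assoc (seq x n) (seq y n) (seq z n)
              }
            ; identity =
                (λ x → pointwise {0ʳ +ʳ x} {x} λ n → ℚ.+-identityˡ (seq x n))
              , (λ x → pointwise {x +ʳ 0ʳ} {x} λ n → ℚ.+-identityʳ (seq x n))
            }
          ; inverse =
              (λ x → pointwise {(-ʳ x) +ʳ x} {0ʳ} λ n → ℚ.+-inverseˡ (seq x n))
            , (λ x → pointwise {x +ʳ (-ʳ x)} {0ʳ} λ n → ℚ.+-inverseʳ (seq x n))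
          ; ⁻¹-cong = λ {x} {y} → -ʳ-cong {x} {y}
          }
        ; comm = λ x y → pointwise {x +ʳ y} {y +ʳ x}
            λ n → ℚ.+-comm (seq x n) (seq y n)
        }
      ; *-cong = λ {x} {y} {u} {v} → *ʳ-cong {x} {y} {u} {v}
      ; *-assoc = λ x y z → pointwise {x *ʳ y *ʳ z} {x *ʳ (y *ʳ z)}
          λ n → ℚ.*-assoc (seq x n) (seq y n) (seq z n)
      ; *-identity =
          (λ x → pointwise {1ʳ *ʳ x} {x} λ n → ℚ.*-identityˡ (seq x n))
        , (λ x → pointwise {x *ʳ 1ʳ} {x} λ n → ℚ.*-identityʳ (seq x n))
      ; distrib =
          (λ x y z → pointwise {x *ʳ (y +ʳ z)} {x *ʳ y +ʳ x *ʳ z}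
            λ n → ℚ.*-distribˡ-+ (seq x n) (seq y n) (seq z n))
        , (λ x y z → pointwise {(y +ʳ z) *ʳ x} {y *ʳ x +ʳ z *ʳ x}
            λ n → ℚ.*-distribʳ-+ (seq x n) (seq y n) (seq z n))
      }
    ; *-comm = λ x y → pointwise {x *ʳ y} {y *ʳ x}
        λ n → ℚ.*-comm (seq x n) (seq y n)
    }
  }

------------------------------------------------------------------------
-- Adjoining a square root of -1 to a commutative ring

module Complexify {c ℓ} (R : CommutativeRing c ℓ) where

  open CommutativeRing R hiding (refl; sym; trans)
  private module R = CommutativeRing R
  open RingProperties ring
    using (-‿distribˡ-*; -‿distribʳ-*; -‿+-comm; -0#≈0#)
  open SemiringSolver commutativeSemiring using (solve; _:=_; _:+_; _:*_)

  infix 5 _+i_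

  record Complex : Set c where
    constructor _+i_
    field
      re : Carrier
      im : Carrier

  open Complex public

  conj : Complex → Complex
  conj (a +i b) = a +i (- b)

  infix  4 _≈ᶜ_
  infixl 6 _+ᶜ_
  infixl 7 _*ᶜ_
  infix  8 -ᶜ_

  _≈ᶜ_ : Rel Complex ℓ
  z ≈ᶜ w = re z ≈ re w × im z ≈ im w

  _+ᶜ_ _*ᶜ_ : Complex → Complex → Complex
  z +ᶜ w = (re z + re w) +i (im z + im w)
  z *ᶜ w = (re z * re w - im z * im w) +i (re z * im w + im z * re w)

  -ᶜ_ : Complex → Complex
  -ᶜ z = (- re z) +i (- im z)

  0ᶜ 1ᶜ : Complex
  0ᶜ = 0# +i 0#
  1ᶜ = 1# +i 0#

  private

    *ᶜ-cong : ∀ {z w u v} → z ≈ᶜ w → u ≈ᶜ v → (z *ᶜ u) ≈ᶜ (w *ᶜ v)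
    *ᶜ-cong (p , q) (r , s) =
      +-cong (*-cong p r) (-‿cong (*-cong q s)) ,
      +-cong (*-cong p s) (*-cong q r)

    *ᶜ-comm : ∀ z w → (z *ᶜ w) ≈ᶜ (w *ᶜ z)
    *ᶜ-comm (a +i b) (c +i d) =
      +-cong (*-comm a c) (-‿cong (*-comm b d)) ,
      solve 4 (λ a b c d → a :* d :+ b :* c := c :* b :+ d :* a)
        R.refl a b c d

    *ᶜ-identityˡ : ∀ z → (1ᶜ *ᶜ z) ≈ᶜ z
    *ᶜ-identityˡ (a +i b) =
      R.trans
        (+-cong (*-identityˡ a) (R.trans (-‿cong (zeroˡ b)) -0#≈0#))
        (+-identityʳ a) ,
      R.trans (+-cong (*-identityˡ b) (zeroˡ a)) (+-identityʳ b)

    *ᶜ-identityʳ : ∀ z → (z *ᶜ 1ᶜ) ≈ᶜ z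
    *ᶜ-identityʳ z with *ᶜ-comm z 1ᶜ | *ᶜ-identityˡ z
    ... | p , q | r , s = R.trans p r , R.trans q s

    *ᶜ-distribˡ : ∀ z w u → (z *ᶜ (w +ᶜ u)) ≈ᶜ (z *ᶜ w +ᶜ z *ᶜ u)
    *ᶜ-distribˡ (a +i b) (c +i d) (e +i f) =
      R.trans (+-congˡ (-‿distribˡ-* b (d + f)))
        (R.trans
          (solve 6 (λ a c e -b d f →
              a :* (c :+ e) :+ -b :* (d :+ f) :=
              (a :* c :+ -b :* d) :+ (a :* e :+ -b :* f))
            R.refl a c e (- b) d f)
          (R.sym (+-cong (+-congˡ (-‿distribˡ-* b d))
                         (+-congˡ (-‿distribˡ-* b f))))) ,
      solve 6 (λ a b c d e f →
          a :* (d :+ f) :+ b :* (c :+ e) :=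
          (a :* d :+ b :* c) :+ (a :* f :+ b :* e))
        R.refl a b c d e f

    *ᶜ-distribʳ : ∀ z w u → ((w +ᶜ u) *ᶜ z) ≈ᶜ (w *ᶜ z +ᶜ u *ᶜ z)
    *ᶜ-distribʳ z w u
      with *ᶜ-comm (w +ᶜ u) z | *ᶜ-distribˡ z w u | *ᶜ-comm z w | *ᶜ-comm z u
    ... | p , p′ | q , q′ | r , r′ | s , s′ =
      R.trans p (R.trans q (+-cong r s)) ,
      R.trans p′ (R.trans q′ (+-cong r′ s′))

    *ᶜ-assoc : ∀ z w u → ((z *ᶜ w) *ᶜ u) ≈ᶜ (z *ᶜ (w *ᶜ u))
    *ᶜ-assoc (a +i b) (c +i d) (e +i f) =
      R.trans
        (+-cong (*-congʳ (+-congˡ (-‿distribˡ-* b d)))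
          (R.trans (-‿distribˡ-* (a * d + b * c) f)
            (*-congʳ (R.trans (R.sym (-‿+-comm (a * d) (b * c)))
              (+-cong (-‿distribʳ-* a d) (-‿distribˡ-* b c))))))
        (R.trans
          (solve 7 (λ a -b c d -d e f →
              (a :* c :+ -b :* d) :* e :+ (a :* -d :+ -b :* c) :* f :=
              a :* (c :* e :+ -d :* f) :+ -b :* (c :* f :+ d :* e))
            R.refl a (- b) c d (- d) e f)
          (R.sym (+-cong (*-congˡ (+-congˡ (-‿distribˡ-* d f)))
                         (-‿distribˡ-* b (c * f + d * e))))) ,
      R.trans
        (+-congʳ (*-congʳ (+-congˡ (-‿distribˡ-* b d))))
        (R.trans
          (solve 7 (λ a b -b c d e f →
              (a :* c :+ -b :* d) :* f :+ (a :* d :+ b :* c) :* e :=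
              a :* (c :* f :+ d :* e) :+ (b :* (c :* e) :+ -b :* (d :* f)))
            R.refl a b (- b) c d e f)
          (+-congˡ
            (R.trans
              (+-congˡ
                (R.trans (R.sym (-‿distribˡ-* b (d * f)))
                         (-‿distribʳ-* b (d * f))))
              (R.sym (distribˡ b (c * e) (- (d * f)))))))

  complexRing : CommutativeRing c ℓ
  complexRing = record
    { Carrier = Complex
    ; _≈_ = _≈ᶜ_
    ; _+_ = _+ᶜ_
    ; _*_ = _*ᶜ_
    ; -_ = -ᶜ_
    ; 0# = 0ᶜ
    ; 1# = 1ᶜ
    ; isCommutativeRing = record
      { isRing = record
        { +-isAbelianGroup = record
          { isGroup = record
            { isMonoid = record
              { isSemigroup = record
                { isMagma = record
                  { isEquivalence = record
                    { refl = R.refl , R.refl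
                    ; sym = λ (p , q) → R.sym p , R.sym q
                    ; trans = λ (p , q) (r , s) → R.trans p r , R.trans q s
                    }
                  ; ∙-cong = λ (p , q) (r , s) → +-cong p r , +-cong q s
                  }
                ; assoc = λ z w u →
                    +-assoc (re z) (re w) (re u) , +-assoc (im z) (im w) (im u)
                }
              ; identity =
                  (λ z → +-identityˡ (re z) , +-identityˡ (im z))
                , (λ z → +-identityʳ (re z) , +-identityʳ (im z))
              }
            ; inverse =
                (λ z → -‿inverseˡ (re z) , -‿inverseˡ (im z))
              , (λ z → -‿inverseʳ (re z) , -‿inverseʳ (im z))
            ; ⁻¹-cong = λ (p , q) → -‿cong p , -‿cong q
            }
          ; comm = λ z w → +-comm (re z) (re w) , +-comm (im z) (im w)
          }
        ; *-cong = *ᶜ-cong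
        ; *-assoc = *ᶜ-assoc
        ; *-identity = *ᶜ-identityˡ , *ᶜ-identityʳ
        ; distrib = *ᶜ-distribˡ , *ᶜ-distribʳ
        }
      ; *-comm = *ᶜ-comm
      }
    }

open Complexify ℝ-commutativeRing public
  renaming (Complex to ℂ; complexRing to ℂ-commutativeRing)

ℂ-ring : Ring 0ℓ 0ℓ
ℂ-ring = CommutativeRing.ring ℂ-commutativeRing

fromℤ : ℤ → ℂ
fromℤ z = fromℚ (z ℚ./ 1) +i 0ʳ

sumᶜ : ∀ {n} → (Fin n → ℂ) → ℂ
sumᶜ = MonoidDefinitions.sum (CommutativeRing.+-rawMonoid ℂ-commutativeRing)

------------------------------------------------------------------------
-- Eigenvalues of integer matrices

Matrix : ℕ → Set
Matrix N = Fin N → Fin N → ℤ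

IsEigenvalue : ∀ {N} → Matrix N → ℂ → Set
IsEigenvalue {N} A z = Σ (Fin N → ℂ) λ x →
  (¬ (∀ i → x i ≈ᶜ 0ᶜ)) ×
  (∀ i → sumᶜ (λ j → fromℤ (A i j) *ᶜ x j) ≈ᶜ z *ᶜ x i)

HasIntegralSpectrum : ∀ {N} → Matrix N → Set
HasIntegralSpectrum A = ∀ z → IsEigenvalue A z → ∃[ k ] (z ≈ᶜ fromℤ k)

-- A relation rather than a function of E, since E need not come with a
-- decision procedure; it determines the matrix uniquely.
IsAdjacencyMatrix : ∀ {N e} → Rel (Fin N) e → Matrix N → Set e
IsAdjacencyMatrix E A =
  ∀ i j → (E i j → A i j ≡ 1ℤ) × (¬ E i j → A i j ≡ 0ℤ)

------------------------------------------------------------------------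
-- Finite subgroups and Cayley graphs

module _ {c ℓ} (G : Group c ℓ) where

  open Group G

  HasFiniteOrder : Pred Carrier ℓ
  HasFiniteOrder g = ∃[ k ] (suc k times g ≈ ε)
    where open MonoidDefinitions rawMonoid renaming (_×_ to _times_)

  data Generated {s} (S : Pred Carrier s) : Pred Carrier (c ⊔ ℓ ⊔ s) where
    gen    : ∀ {g} → g ∈ S → g ∈ Generated S
    ≈-mem  : ∀ {g h} → g ≈ h → g ∈ Generated S → h ∈ Generated S
    ε-mem  : ε ∈ Generated S
    ∙-mem  : ∀ {g h} → g ∈ Generated S → h ∈ Generated S → g ∙ h ∈ Generated S
    ⁻¹-mem : ∀ {g} → g ∈ Generated S → g ⁻¹ ∈ Generated S

  record FiniteSubgroup : Set (c ⊔ ℓ) where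
    field
      order          : ℕ
      elem           : Fin order → Carrier
      elem-injective : ∀ {i j} → elem i ≈ elem j → i ≡ j

    Member : Pred Carrier ℓ
    Member g = ∃[ i ] (elem i ≈ g)

    field
      ε-closed  : ε ∈ Member
      ∙-closed  : ∀ {g h} → g ∈ Member → h ∈ Member → g ∙ h ∈ Member
      ⁻¹-closed : ∀ {g} → g ∈ Member → g ⁻¹ ∈ Member

  -- Undirected, with the elements of H (through their indices) as vertices.
  CayleyGraph : ∀ {t} (H : FiniteSubgroup) → Pred Carrier t →
                Rel (Fin (FiniteSubgroup.order H)) (c ⊔ ℓ ⊔ t)
  CayleyGraph H T = SymClosure λ i j → ∃[ t ] (t ∈ T × elem j ≈ t ∙ elem i)
    where open FiniteSubgroup H

------------------------------------------------------------------------
-- Complex vector spaces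

module _ {m ℓ} (V : LeftModule ℂ-ring m ℓ) where

  open LeftModule V
  open LeftModuleMorphisms rawLeftModule rawLeftModule

  sumᴹ : ∀ {n} → (Fin n → Carrierᴹ) → Carrierᴹ
  sumᴹ = MonoidDefinitions.sum +ᴹ-rawMonoid

  record IsSubspace {s} (S : Pred Carrierᴹ s) : Set (m ⊔ ℓ ⊔ s) where
    field
      ≈ᴹ-closed : ∀ {u v} → u ≈ᴹ v → u ∈ S → v ∈ S
      0ᴹ-closed : 0ᴹ ∈ S
      +ᴹ-closed : ∀ {u v} → u ∈ S → v ∈ S → u +ᴹ v ∈ S
      *ₗ-closed : ∀ z {v} → v ∈ S → z *ₗ v ∈ S

  record IsBasis {s} (S : Pred Carrierᴹ s) {d} (b : Fin d → Carrierᴹ)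
                 : Set (m ⊔ ℓ ⊔ s) where
    field
      member      : ∀ i → b i ∈ S
      independent : ∀ (z : Fin d → ℂ) → sumᴹ (λ i → z i *ₗ b i) ≈ᴹ 0ᴹ →
                    ∀ i → z i ≈ᶜ 0ᶜ
      spanning    : ∀ {v} → v ∈ S →
                    Σ (Fin d → ℂ) λ z → v ≈ᴹ sumᴹ (λ i → z i *ₗ b i)

  HasDimension : ∀ {s} → Pred Carrierᴹ s → ℕ → Set (m ⊔ ℓ ⊔ s)
  HasDimension S d = Σ (Fin d → Carrierᴹ) λ b → IsBasis S b

  record HermitianInnerProduct : Set (m ⊔ ℓ) where
    field
      ⟨_,_⟩     : Carrierᴹ → Carrierᴹ → ℂ
      ⟨⟩-cong   : ∀ {u u′ v v′} → u ≈ᴹ u′ → v ≈ᴹ v′ → ⟨ u , v ⟩ ≈ᶜ ⟨ u′ , v′ ⟩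
      +ᴹ-linear : ∀ u v w → ⟨ u +ᴹ v , w ⟩ ≈ᶜ ⟨ u , w ⟩ +ᶜ ⟨ v , w ⟩
      *ₗ-linear : ∀ z u v → ⟨ z *ₗ u , v ⟩ ≈ᶜ z *ᶜ ⟨ u , v ⟩
      hermitian : ∀ u v → ⟨ u , v ⟩ ≈ᶜ conj ⟨ v , u ⟩
      nonNeg    : ∀ v → 0ʳ ≤ʳ re ⟨ v , v ⟩
      definite  : ∀ v → ⟨ v , v ⟩ ≈ᶜ 0ᶜ → v ≈ᴹ 0ᴹ

  record LinearAutomorphism : Set (m ⊔ ℓ) where
    field
      apply         : Carrierᴹ → Carrierᴹ
      isIsomorphism : IsLeftModuleIsomorphism apply

    open IsLeftModuleIsomorphism isIsomorphism public

  open LinearAutomorphism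

  private

    inv : LinearAutomorphism → Carrierᴹ → Carrierᴹ
    inv f y = proj₁ (surjective f y)

    apply-inv : ∀ f y → apply f (inv f y) ≈ᴹ y
    apply-inv f y = proj₂ (surjective f y) ≈ᴹ-refl

    inv-unique : ∀ f {x y} → apply f x ≈ᴹ y → inv f y ≈ᴹ x
    inv-unique f {y = y} p =
      injective f (≈ᴹ-trans (apply-inv f y) (≈ᴹ-sym p))

    inv-cong : ∀ f {x y} → x ≈ᴹ y → inv f x ≈ᴹ inv f y
    inv-cong f {x} {y} p =
      inv-unique f (≈ᴹ-trans (apply-inv f y) (≈ᴹ-sym p))

    inverse : LinearAutomorphism → LinearAutomorphism
    inverse f = record
      { apply = inv f
      ; isIsomorphism = record
        { isLeftModuleMonomorphism = record
          { isLeftModuleHomomorphism = record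
            { +ᴹ-isGroupHomomorphism = record
              { isMonoidHomomorphism = record
                { isMagmaHomomorphism = record
                  { isRelHomomorphism = record { cong = inv-cong f }
                  ; homo = λ x y → inv-unique f (≈ᴹ-trans
                      (+ᴹ-homo f (inv f x) (inv f y))
                      (+ᴹ-cong (apply-inv f x) (apply-inv f y)))
                  }
                ; ε-homo = inv-unique f (0ᴹ-homo f)
                }
              ; ⁻¹-homo = λ x → inv-unique f (≈ᴹ-trans
                  (-ᴹ-homo f (inv f x)) (-ᴹ‿cong (apply-inv f x)))
              }
            ; *ₗ-homo = λ z x → inv-unique f (≈ᴹ-trans
                (*ₗ-homo f z (inv f x))
                (*ₗ-cong (CommutativeRing.refl ℂ-commutativeRing {z})
                  (apply-inv f x)))
            }
          ; injective = λ {x} {y} p → ≈ᴹ-trans (≈ᴹ-sym (apply-inv f x))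
              (≈ᴹ-trans (⟦⟧-cong f p) (apply-inv f y))
          }
        ; surjective = λ x → apply f x , λ p → inv-unique f (≈ᴹ-sym p)
        }
      }

  GL : Group (m ⊔ ℓ) (m ⊔ ℓ)
  GL = record
    { Carrier = LinearAutomorphism
    ; _≈_ = λ f g → ∀ v → apply f v ≈ᴹ apply g v
    ; _∙_ = λ f g → record
        { apply = λ v → apply f (apply g v)
        ; isIsomorphism = Composition.isLeftModuleIsomorphism ≈ᴹ-trans
            (isIsomorphism g) (isIsomorphism f)
        }
    ; ε = record
        { apply = λ v → v
        ; isIsomorphism =
            Identity.isLeftModuleIsomorphism rawLeftModule ≈ᴹ-refl
        }
    ; _⁻¹ = inverse
    ; isGroup = record
      { isMonoid = record
        { isSemigroup = record
          { isMagma = record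
            { isEquivalence = record
              { refl = λ _ → ≈ᴹ-refl
              ; sym = λ p v → ≈ᴹ-sym (p v)
              ; trans = λ p q v → ≈ᴹ-trans (p v) (q v)
              }
            ; ∙-cong = λ {f} {_} {_} {k} p q v →
                ≈ᴹ-trans (⟦⟧-cong f (q v)) (p (apply k v))
            }
          ; assoc = λ _ _ _ _ → ≈ᴹ-refl
          }
        ; identity = (λ _ _ → ≈ᴹ-refl) , (λ _ _ → ≈ᴹ-refl)
        }
      ; inverse = (λ f v → inv-unique f ≈ᴹ-refl) , (λ f v → apply-inv f v)
      ; ⁻¹-cong = λ {f} {g} p v → inv-unique f
          (≈ᴹ-trans (p (inv g v)) (apply-inv g v))
      }
    }

  FixedSpace : LinearAutomorphism → Pred Carrierᴹ ℓ
  FixedSpace g v = apply g v ≈ᴹ v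

  -- The first argument is the dimension of V.
  IsReflection : ℕ → Pred LinearAutomorphism (m ⊔ ℓ)
  IsReflection n g =
    HasFiniteOrder GL g × ∃[ d ] (n ≡ suc d × HasDimension (FixedSpace g) d)

  record ComplexReflectionGroup : Set (m ⊔ ℓ) where
    field
      dim           : ℕ
      dim-V         : HasDimension U dim
      innerProduct  : HermitianInnerProduct
      group         : FiniteSubgroup GL

    open HermitianInnerProduct innerProduct public
    open FiniteSubgroup group public
    open Group GL using (_∙_; _⁻¹)

    Reflections : Pred LinearAutomorphism (m ⊔ ℓ)
    Reflections g = g ∈ Member × g ∈ IsReflection dim

    field
      invariant : ∀ i u v → ⟨ apply (elem i) u , apply (elem i) v ⟩ ≈ᶜ ⟨ u , v ⟩
      generated : ∀ i → elem i ∈ Generated GL Reflections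

    -- codim (V^g), taken as dim V - dim V^g.
    HasCodimension : LinearAutomorphism → ℕ → Set (m ⊔ ℓ)
    HasCodimension g c =
      ∃[ d ] (HasDimension (FixedSpace g) d × d ℕ.+ c ≡ dim)

    IsCodimensionMatrix : Matrix order → Set (m ⊔ ℓ)
    IsCodimensionMatrix C =
      ∀ i j → ∃[ c ] (HasCodimension (elem i ∙ elem j ⁻¹) c × C i j ≡ + c)

    FixedPoints : Pred Carrierᴹ ℓ
    FixedPoints v = ∀ i → v ∈ FixedSpace (elem i)

    FixedPoints⊥ : Pred Carrierᴹ (m ⊔ ℓ)
    FixedPoints⊥ v = ∀ u → u ∈ FixedPoints → ⟨ u , v ⟩ ≈ᶜ 0ᶜ

    -- "Has a nonzero vector" is expressed by positive norm: over the
    -- constructive complex numbers the negation of v ≈ᴹ 0ᴹ would not allow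
    -- division by a coordinate of v.
    IsNonzeroSubspace : ∀ {s} → Pred Carrierᴹ s → Set (m ⊔ s)
    IsNonzeroSubspace S = ∃[ v ] (v ∈ S × 0ʳ <ʳ re ⟨ v , v ⟩)

    record IsIrreducible : Set (lsuc (m ⊔ ℓ)) where
      field
        nonzero : IsNonzeroSubspace FixedPoints⊥
        simple  : ∀ (S : Pred Carrierᴹ (m ⊔ ℓ)) → IsSubspace S →
                  (∀ i {v} → v ∈ S → apply (elem i) v ∈ S) →
                  S ⊆ FixedPoints⊥ → IsNonzeroSubspace S → FixedPoints⊥ ⊆ S

{-# OPTIONS --safe #-}
module Submission where

-- Both matrices are A = (f(ij⁻¹)) for a class function f : W → ℤ such that
-- f(g) depends only on the fixed space of g.  Let P be a projector onto the
-- eigenspace of A for z, and φ(g) = tr(ρ(g)P) with ρ the left regular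
-- representation, so that z tr P = tr(AP) = ∑ f(g) φ(g).  If H is a subgroup,
-- then e = |H|⁻¹ ∑_{h ∈ H} ρ(h) commutes with A, so eP is idempotent and
-- ∑_{h ∈ H} φ(h) = |H| tr(eP) is rational.  Applied to the pointwise
-- stabilisers of the fixed spaces, by induction on these, this makes
-- ∑ f(g) φ(g) rational, hence also z, because tr P is a positive integer.
-- A rational eigenvalue of an integer matrix is an integer.
--
-- Equality of constructive complex numbers is undecidable, so the linear
-- algebra is carried out under double negation, which is removed at the end by
-- rounding z.

open import Defs
open import Algebra.Bundles using (CommutativeRing; Group; Ring)
open import Algebra.Core using (Op₁; Op₂)
open import Algebra.Module.Bundles using (LeftModule)
open import Algebra.Morphism.Structures using (module RingMorphisms)
import Algebra.Properties.CommutativeMonoid.Sum as CommutativeMonoidSum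
open import Algebra.Properties.CommutativeSemigroup using (x∙yz≈y∙xz)
import Algebra.Properties.Group as GroupProperties
import Algebra.Properties.Monoid.Mult as Mult
import Algebra.Properties.Ring as RingProperties
import Algebra.Properties.Semiring.Sum as SemiringSum
open import Algebra.Structures using (IsGroup)
open import Data.Fin.Base using (Fin; zero; suc; toℕ)
open import Data.Fin.Induction using (spo-wellFounded)
open import Data.Fin.Permutation using (permutation)
open import Data.Fin.Properties using (pigeonhole)
open import Data.Integer.Base as ℤ using (ℤ; +_; +[1+_]; -[1+_]; 0ℤ; 1ℤ)
import Data.Integer.Coprimality as ℤ
import Data.Integer.Divisibility.Signed as ℤS
import Data.Integer.DivMod as ℤ
import Data.Integer.Properties as ℤ
open import Data.List.Base using (List; []; _∷_; allFin)
open import Data.List.Membership.Propositional using () renaming (_∈_ to _∈ˡ_)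
open import Data.List.Membership.Propositional.Properties using (∈-allFin)
open import Data.List.Relation.Unary.Any using (here; there)
open import Data.Nat.Base as ℕ using (ℕ; zero; suc; s≤s; z≤n)
import Data.Nat.Coprimality as ℕ
import Data.Nat.Properties as ℕ
open import Data.Product.Base using (∃; ∃₂; ∃-syntax; _×_; _,_; proj₁; proj₂)
open import Data.Rational.Base as ℚ using (ℚ; mkℚ; 0ℚ; 1ℚ; ½; ↥_; ↧_; Positive; ∣_∣)
import Data.Rational.Properties as ℚ
open import Data.Rational.Solver using () renaming (module +-*-Solver to ℚ-Solver)
open import Data.Rational.Unnormalised.Base as ℚᵘ using (mkℚᵘ; *≡*; *≤*)
import Data.Rational.Unnormalised.Properties as ℚᵘ
open import Data.Sum.Base using (_⊎_; inj₁; inj₂)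
open import Function.Base using (_∘_; id)
open import Function.Bundles using (_⇔_; mk⇔; Equivalence)
open import Induction.WellFounded using (Acc; acc)
open import Level using (_⊔_; 0ℓ)
open import Relation.Binary.Construct.Closure.Symmetric using (fwd; bwd)
open import Relation.Binary.Core using (Rel)
open import Relation.Binary.Definitions using (Decidable; Reflexive; Transitive)
open import Relation.Binary.PropositionalEquality as ≡ using (_≡_; _≢_; cong; cong₂; subst; subst₂)
import Relation.Binary.Reasoning.Setoid as SetoidReasoning
open import Relation.Nullary.Decidable.Core using (Dec; yes; no; ¬¬-excluded-middle; decidable-stable)
open import Relation.Nullary.Negation using (¬_; contradiction)
open import Relation.Unary using (Pred; _∈_; _⊆_)

-- Classically, an eigenvalue of the class function f is ∑ f(g) χ(g) / χ(1) for an irreducible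
-- character χ. Galois conjugation turns χ(g) into χ(g^k) with k prime to the order of g, and g^k
-- has the same fixed space as g, so the eigenvalue is rational. Here z is a pair of Cauchy
-- sequences on which no Galois group acts. Ranks of idempotents, which are integers, take the place
-- of Galois invariance. The projector is P = 1 - X(A - z) for a pseudo-inverse X of A - z.
-- Constructing X takes only an elimination in which every scalar met is zero or invertible, a case
-- distinction that survives double negation. Such a P is not canonical and may fail to commute with
-- e. But e maps the eigenspace, which is the image of P, into itself; hence PeP = eP and (eP)² =
-- e²P = eP. Reflections and codimensions enter through the dimension of the fixed space of a group
-- element: it is the same for xy and yx, which makes f a class function.

_/1 : ℤ → ℚ
k /1 = k ℚ./ 1

-- `k ℚ./ 1` normalises by a gcd and is stuck on a variable `k`; the arithmetic is done on
-- unnormalised fractions instead.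
toℚᵘ-/1 : ∀ k → ℚ.toℚᵘ (k /1) ℚᵘ.≃ mkℚᵘ k 0
toℚᵘ-/1 k = ℚ.toℚᵘ-fromℚᵘ (mkℚᵘ k 0)

/1-+ : ∀ i j → (i ℤ.+ j) /1 ≡ i /1 ℚ.+ j /1
/1-+ i j = ℚ.toℚᵘ-injective (begin
  ℚ.toℚᵘ ((i ℤ.+ j) /1)                  ≈⟨ toℚᵘ-/1 (i ℤ.+ j) ⟩
  mkℚᵘ (i ℤ.+ j) 0                       ≈⟨ *≡* (cong (ℤ._* 1ℤ) (cong₂ ℤ._+_ (≡.sym (ℤ.*-identityʳ i)) (≡.sym (ℤ.*-identityʳ j)))) ⟩
  mkℚᵘ i 0 ℚᵘ.+ mkℚᵘ j 0                 ≈⟨ ℚᵘ.+-cong (toℚᵘ-/1 i) (toℚᵘ-/1 j) ⟨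
  ℚ.toℚᵘ (i /1) ℚᵘ.+ ℚ.toℚᵘ (j /1)       ≈⟨ ℚ.toℚᵘ-homo-+ (i /1) (j /1) ⟨
  ℚ.toℚᵘ (i /1 ℚ.+ j /1)                 ∎)
  where open SetoidReasoning ℚᵘ.≃-setoid

/1-* : ∀ i j → (i ℤ.* j) /1 ≡ i /1 ℚ.* j /1
/1-* i j = ℚ.toℚᵘ-injective (begin
  ℚ.toℚᵘ ((i ℤ.* j) /1)                  ≈⟨ toℚᵘ-/1 (i ℤ.* j) ⟩
  mkℚᵘ i 0 ℚᵘ.* mkℚᵘ j 0                 ≈⟨ ℚᵘ.*-cong (toℚᵘ-/1 i) (toℚᵘ-/1 j) ⟨
  ℚ.toℚᵘ (i /1) ℚᵘ.* ℚ.toℚᵘ (j /1)       ≈⟨ ℚ.toℚᵘ-homo-* (i /1) (j /1) ⟨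
  ℚ.toℚᵘ (i /1 ℚ.* j /1)                 ∎)
  where open SetoidReasoning ℚᵘ.≃-setoid

/1-injective : ∀ {i j} → i /1 ≡ j /1 → i ≡ j
/1-injective {i} {j} eq = ≡.trans (≡.sym (ℤ.*-identityʳ i)) (≡.trans (ℚᵘ.drop-*≡* (begin
  mkℚᵘ i 0         ≈⟨ toℚᵘ-/1 i ⟨
  ℚ.toℚᵘ (i /1)    ≡⟨ cong ℚ.toℚᵘ eq ⟩
  ℚ.toℚᵘ (j /1)    ≈⟨ toℚᵘ-/1 j ⟩
  mkℚᵘ j 0         ∎)) (ℤ.*-identityʳ j))
  where open SetoidReasoning ℚᵘ.≃-setoid

-- Double negation

infixl 1 _>>=_

_>>=_ : ∀ {a b} {A : Set a} {B : Set b} → ¬ ¬ A → (A → ¬ ¬ B) → ¬ ¬ B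
(m >>= f) k = m λ x → f x k

return : ∀ {a} {A : Set a} → A → ¬ ¬ A
return x k = k x

-- Finiteness of the index type is essential: over ℕ this would be the double-negation shift.
¬¬-∀Fin : ∀ {p n} {P : Fin n → Set p} → (∀ i → ¬ ¬ P i) → ¬ ¬ (∀ i → P i)
¬¬-∀Fin {n = zero}  f = return λ ()
¬¬-∀Fin {n = suc n} f = f zero >>= λ p → ¬¬-∀Fin (f ∘ suc) >>= λ ps →
  return λ { zero → p ; (suc i) → ps i }

all-or-any : ∀ {p q n} {P : Fin n → Set p} {Q : Fin n → Set q} →
             (∀ i → P i ⊎ Q i) → (∀ i → P i) ⊎ ∃ Q
all-or-any {n = zero}  f = inj₁ λ ()
all-or-any {n = suc n} f with f zero | all-or-any (f ∘ suc)
... | inj₂ q | _            = inj₂ (zero , q)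
... | inj₁ p | inj₂ (i , q) = inj₂ (suc i , q)
... | inj₁ p | inj₁ ps      = inj₁ λ { zero → p ; (suc i) → ps i }

-- Pseudo-inverses

module RankOneUpdate {c ℓ} (R : Ring c ℓ) where

  open Ring R
  open RingProperties R
  open SetoidReasoning setoid

  x-[y+z]≈x-y-z : ∀ x y z → x - (y + z) ≈ (x - y) - z
  x-[y+z]≈x-y-z x y z = trans (+-congˡ (sym (-‿+-comm y z))) (sym (+-assoc x (- y) (- z)))

  -- Replacing x by update replaces the residue r = b (1 - x b) by r - r f r,
  -- which vanishes in row k when f is the inverse of a pivot of r in that row.
  module _ {b x f : Carrier} (idem : (x * b) * (x * b) ≈ x * b)
           (frf : f * (b * (1# - x * b)) * f ≈ f) where

    private
      p r y u : Carrier
      p = 1# - x * b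
      r = b * p
      y = x * b
      u = p * f * r

    yp≈0 : y * p ≈ 0#
    yp≈0 = begin
      y * (1# - y)      ≈⟨ x[y-z]≈xy-xz y 1# y ⟩
      y * 1# - y * y    ≈⟨ +-cong (*-identityʳ y) (-‿cong idem) ⟩
      y - y             ≈⟨ -‿inverseʳ y ⟩
      0# ∎

    py≈0 : p * y ≈ 0#
    py≈0 = begin
      (1# - y) * y      ≈⟨ [y-z]x≈yx-zx y 1# y ⟩
      1# * y - y * y    ≈⟨ +-cong (*-identityˡ y) (-‿cong idem) ⟩
      y - y             ≈⟨ -‿inverseʳ y ⟩
      0# ∎

    pp≈p : p * p ≈ p
    pp≈p = begin
      p * (1# - y)    ≈⟨ x[y-z]≈xy-xz p 1# y ⟩
      p * 1# - p * y  ≈⟨ +-cong (*-identityʳ p) (trans (-‿cong py≈0) -0#≈0#) ⟩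
      p + 0#          ≈⟨ +-identityʳ p ⟩
      p ∎

    rp≈r : r * p ≈ r
    rp≈r = trans (*-assoc b p p) (*-congˡ pp≈p)

    -- Since (1 - b x) b = b (1 - x b) = r, the product `update * b` is y + u with u = p f r, an
    -- idempotent orthogonal to y on both sides.
    update : Carrier
    update = x + p * f * (1# - b * x)

    private

      up≈u : u * p ≈ u
      up≈u = trans (*-assoc (p * f) r p) (*-congˡ rp≈r)

      yu≈0 : y * u ≈ 0#
      yu≈0 = begin
        y * (p * f * r)    ≈⟨ *-congˡ (*-assoc p f r) ⟩
        y * (p * (f * r))  ≈⟨ *-assoc y p (f * r) ⟨
        y * p * (f * r)    ≈⟨ *-congʳ yp≈0 ⟩
        0# * (f * r)       ≈⟨ zeroˡ _ ⟩
        0# ∎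

      uy≈0 : u * y ≈ 0#
      uy≈0 = begin
        (p * f) * (b * p) * y    ≈⟨ *-assoc (p * f) r y ⟩
        (p * f) * (b * p * y)    ≈⟨ *-congˡ (*-assoc b p y) ⟩
        (p * f) * (b * (p * y))  ≈⟨ *-congˡ (trans (*-congˡ py≈0) (zeroʳ b)) ⟩
        (p * f) * 0#             ≈⟨ zeroʳ _ ⟩
        0# ∎

      uu≈u : u * u ≈ u
      uu≈u = begin
        u * (p * f * r)        ≈⟨ *-congˡ (*-assoc p f r) ⟩
        u * (p * (f * r))      ≈⟨ *-assoc u p (f * r) ⟨
        u * p * (f * r)        ≈⟨ *-congʳ up≈u ⟩
        p * f * r * (f * r)    ≈⟨ *-assoc (p * f * r) f r ⟨
        p * f * r * f * r      ≈⟨ *-congʳ (trans (*-congʳ (*-assoc p f r)) (*-assoc p (f * r) f)) ⟩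
        p * (f * r * f) * r    ≈⟨ *-congʳ (*-congˡ frf) ⟩
        p * f * r ∎

    update-* : update * b ≈ y + u
    update-* = begin
      (x + p * f * (1# - b * x)) * b    ≈⟨ distribʳ b x _ ⟩
      y + p * f * (1# - b * x) * b      ≈⟨ +-congˡ (*-assoc (p * f) (1# - b * x) b) ⟩
      y + p * f * ((1# - b * x) * b)    ≈⟨ +-congˡ (*-congˡ (begin
        (1# - b * x) * b                  ≈⟨ [y-z]x≈yx-zx b 1# (b * x) ⟩
        1# * b - b * x * b                ≈⟨ +-cong (trans (*-identityˡ b) (sym (*-identityʳ b)))
                                                    (-‿cong (*-assoc b x b)) ⟩
        b * 1# - b * y                    ≈⟨ x[y-z]≈xy-xz b 1# y ⟨
        b * p ∎)) ⟩
      y + u ∎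

    update-idem : (update * b) * (update * b) ≈ update * b
    update-idem = begin
      (update * b) * (update * b)  ≈⟨ *-cong update-* update-* ⟩
      (y + u) * (y + u)            ≈⟨ distribˡ (y + u) y u ⟩
      (y + u) * y + (y + u) * u    ≈⟨ +-cong (distribʳ y y u) (distribʳ u y u) ⟩
      (y * y + u * y) + (y * u + u * u)
        ≈⟨ +-cong (trans (+-cong idem uy≈0) (+-identityʳ y))
                  (trans (+-cong yu≈0 uu≈u) (+-identityˡ u)) ⟩
      y + u                        ≈⟨ update-* ⟨
      update * b ∎

    update-residue : b * (1# - update * b) ≈ r - r * f * r
    update-residue = begin
      b * (1# - update * b)    ≈⟨ *-congˡ (+-congˡ (-‿cong update-*)) ⟩
      b * (1# - (y + u))       ≈⟨ *-congˡ (x-[y+z]≈x-y-z 1# y u) ⟩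
      b * (p - u)              ≈⟨ x[y-z]≈xy-xz b p u ⟩
      r - b * u                ≈⟨ +-congˡ (-‿cong (begin
        b * (p * f * r)          ≈⟨ *-assoc b (p * f) r ⟨
        b * (p * f) * r          ≈⟨ *-congʳ (*-assoc b p f) ⟨
        r * f * r ∎)) ⟩
      r - r * f * r ∎

-- Matrices over a commutative ring

module Matrices {c ℓ} (K : CommutativeRing c ℓ) where

  open CommutativeRing K
  open RingProperties ring using (-‿+-comm; -0#≈0#; [y-z]x≈yx-zx)
  open SemiringSum semiring
  open Mult +-monoid using () renaming (_×_ to _·_)
  open SetoidReasoning setoid

  Mat : ℕ → ℕ → Set c
  Mat m n = Fin m → Fin n → Carrier

  infix 4 _≋_
  _≋_ : ∀ {m n} → Mat m n → Mat m n → Set ℓ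
  M ≋ N = ∀ i j → M i j ≈ N i j

  infixl 7 _⊛_
  _⊛_ : ∀ {l m n} → Mat l m → Mat m n → Mat l n
  _⊛_ {m = m} M N i k = ∑[ j < m ] (M i j * N j k)

  δ : ∀ {n} → Mat n n
  δ zero    zero    = 1#
  δ zero    (suc _) = 0#
  δ (suc _) zero    = 0#
  δ (suc i) (suc j) = δ i j

  ∑-cong : ∀ {n} {f g : Fin n → Carrier} → (∀ i → f i ≈ g i) → sum f ≈ sum g
  ∑-cong = sum-cong-≋

  ∑-zero : ∀ {n} {f : Fin n → Carrier} → (∀ i → f i ≈ 0#) → sum f ≈ 0#
  ∑-zero {n} p = trans (∑-cong p) (sum-replicate-zero n)

  δ-sym : ∀ {n} (i j : Fin n) → δ i j ≈ δ j i
  δ-sym zero    zero    = refl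
  δ-sym zero    (suc _) = refl
  δ-sym (suc _) zero    = refl
  δ-sym (suc i) (suc j) = δ-sym i j

  ∑-δˡ : ∀ {n} (i : Fin n) (x : Fin n → Carrier) → ∑[ j < n ] (δ i j * x j) ≈ x i
  ∑-δˡ zero    x = trans (+-cong (*-identityˡ _) (∑-zero λ j → zeroˡ (x (suc j)))) (+-identityʳ _)
  ∑-δˡ (suc i) x = trans (+-cong (zeroˡ _) (∑-δˡ i (x ∘ suc))) (+-identityˡ _)

  ∑-δʳ : ∀ {n} (i : Fin n) (x : Fin n → Carrier) → ∑[ j < n ] (x j * δ j i) ≈ x i
  ∑-δʳ i x = trans (∑-cong λ j → trans (*-comm _ _) (*-congʳ (δ-sym j i))) (∑-δˡ i x)

  ∑-neg : ∀ {n} (f : Fin n → Carrier) → ∑[ i < n ] (- f i) ≈ - sum f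
  ∑-neg {zero}  f = sym -0#≈0#
  ∑-neg {suc n} f = trans (+-congˡ (∑-neg (f ∘ suc))) (-‿+-comm _ _)

  ⊛-cong : ∀ {l m n} {M M′ : Mat l m} {N N′ : Mat m n} → M ≋ M′ → N ≋ N′ → M ⊛ N ≋ M′ ⊛ N′
  ⊛-cong p q i k = ∑-cong λ j → *-cong (p i j) (q j k)

  ⊛-assoc : ∀ {k l m n} (M : Mat k l) (N : Mat l m) (O : Mat m n) →
            (M ⊛ N) ⊛ O ≋ M ⊛ (N ⊛ O)
  ⊛-assoc {l = l} {m} M N O i o = begin
    ∑[ k < m ] (∑[ j < l ] (M i j * N j k) * O k o)
      ≈⟨ ∑-cong (λ k → *-distribʳ-sum (O k o) λ j → M i j * N j k) ⟩
    ∑[ k < m ] ∑[ j < l ] (M i j * N j k * O k o)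
      ≈⟨ ∑-comm (λ k j → M i j * N j k * O k o) ⟩
    ∑[ j < l ] ∑[ k < m ] (M i j * N j k * O k o)
      ≈⟨ ∑-cong (λ j → ∑-cong λ k → *-assoc (M i j) (N j k) (O k o)) ⟩
    ∑[ j < l ] ∑[ k < m ] (M i j * (N j k * O k o))
      ≈⟨ ∑-cong (λ j → *-distribˡ-sum (M i j) λ k → N j k * O k o) ⟨
    ∑[ j < l ] (M i j * ∑[ k < m ] (N j k * O k o)) ∎

  matrixRing : ℕ → Ring c ℓ
  matrixRing n = record
    { Carrier = Mat n n
    ; _≈_ = _≋_
    ; _+_ = λ M N i j → M i j + N i j
    ; _*_ = _⊛_
    ; -_ = λ M i j → - M i j
    ; 0# = λ _ _ → 0#
    ; 1# = δ
    ; isRing = record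
      { +-isAbelianGroup = record
        { isGroup = record
          { isMonoid = record
            { isSemigroup = record
              { isMagma = record
                { isEquivalence = record
                  { refl = λ _ _ → refl
                  ; sym = λ p i j → sym (p i j)
                  ; trans = λ p q i j → trans (p i j) (q i j)
                  }
                ; ∙-cong = λ p q i j → +-cong (p i j) (q i j)
                }
              ; assoc = λ _ _ _ _ _ → +-assoc _ _ _
              }
            ; identity = (λ _ _ _ → +-identityˡ _) , (λ _ _ _ → +-identityʳ _)
            }
          ; inverse = (λ _ _ _ → -‿inverseˡ _) , (λ _ _ _ → -‿inverseʳ _)
          ; ⁻¹-cong = λ p i j → -‿cong (p i j)
          }
        ; comm = λ _ _ _ _ → +-comm _ _
        }
      ; *-cong = ⊛-cong
      ; *-assoc = ⊛-assoc
      ; *-identity = (λ M i k → ∑-δˡ i λ j → M j k) , (λ M i k → ∑-δʳ k (M i))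
      ; distrib =
          (λ M N O i k → trans (∑-cong λ j → distribˡ (M i j) (N j k) (O j k))
                               (∑-distrib-+ (λ j → M i j * N j k) _))
        , (λ M N O i k → trans (∑-cong λ j → distribʳ (M j k) (N i j) (O i j))
                               (∑-distrib-+ (λ j → N i j * M j k) _))
      }
    }

  -- Row `i` of (A - q) x, by which an eigenvector equation becomes a kernel equation.
  ∑-shift : ∀ {n} q (a x : Fin n → Carrier) i →
            ∑[ j < n ] ((a j - q * δ i j) * x j) ≈ ∑[ j < n ] (a j * x j) - q * x i
  ∑-shift {n} q a x i = begin
    ∑[ j < n ] ((a j - q * δ i j) * x j)
      ≈⟨ ∑-cong (λ j → trans ([y-z]x≈yx-zx (x j) (a j) (q * δ i j))
           (+-congˡ (-‿cong (*-assoc q (δ i j) (x j))))) ⟩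
    ∑[ j < n ] (a j * x j - q * (δ i j * x j))
      ≈⟨ ∑-distrib-+ (λ j → a j * x j) _ ⟩
    ∑[ j < n ] (a j * x j) + ∑[ j < n ] (- (q * (δ i j * x j)))
      ≈⟨ +-congˡ (trans (∑-neg λ j → q * (δ i j * x j)) (-‿cong (begin
           ∑[ j < n ] (q * (δ i j * x j))  ≈⟨ *-distribˡ-sum q (λ j → δ i j * x j) ⟨
           q * ∑[ j < n ] (δ i j * x j)    ≈⟨ *-congˡ (∑-δˡ i x) ⟩
           q * x i                         ∎))) ⟩
    ∑[ j < n ] (a j * x j) - q * x i ∎

  tr : ∀ {n} → Mat n n → Carrier
  tr {n} M = ∑[ i < n ] M i i

  tr-cong : ∀ {n} {M N : Mat n n} → M ≋ N → tr M ≈ tr N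
  tr-cong p = ∑-cong λ i → p i i

  tr-comm : ∀ {m n} (M : Mat m n) (N : Mat n m) → tr (M ⊛ N) ≈ tr (N ⊛ M)
  tr-comm {m} {n} M N = begin
    ∑[ i < m ] ∑[ j < n ] (M i j * N j i)  ≈⟨ ∑-comm (λ i j → M i j * N j i) ⟩
    ∑[ j < n ] ∑[ i < m ] (M i j * N j i)  ≈⟨ ∑-cong (λ j → ∑-cong λ i → *-comm (M i j) (N j i)) ⟩
    ∑[ j < n ] ∑[ i < m ] (N j i * M i j)  ∎

  tr-δ : ∀ n → tr (δ {n}) ≈ n · 1#
  tr-δ zero    = refl
  tr-δ (suc n) = +-congˡ (tr-δ n)

  -- Elimination with undecidable zero test

  module Elimination (zero-or-unit : ∀ x → ¬ ¬ (x ≈ 0# ⊎ ∃ λ y → x * y ≈ 1#)) {n : ℕ} where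

    private
      module M = Ring (matrixRing n)
      open RankOneUpdate (matrixRing n)

    residue : Mat n n → Mat n n → Mat n n
    residue B X = B ⊛ (δ M.- X ⊛ B)

    -- Invariant of the elimination: B X B agrees with B in the rows treated so far, and the trace
    -- of the idempotent X B counts the pivots. `rank≡0` is what later turns a nonzero projector
    -- into a nonzero trace.
    record PartialInverse (B : Mat n n) (rows : List (Fin n)) : Set (c ⊔ ℓ) where
      field
        inv        : Mat n n
        idempotent : (inv ⊛ B) ⊛ (inv ⊛ B) ≋ inv ⊛ B
        residue≈0  : ∀ {i} → i ∈ˡ rows → ∀ j → residue B inv i j ≈ 0#
        rank       : ℕ
        trace      : tr (inv ⊛ B) ≈ rank · 1#
        rank≡0     : rank ≡ 0 → inv ⊛ B ≋ M.0#

    open PartialInverse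

    private

      module Pivot (B X : Mat n n) (k j : Fin n) (s : Carrier)
                   (pivot : residue B X k j * s ≈ 1#) where

        R F : Mat n n
        R = residue B X
        -- The only nonzero entry is the inverse `s` of the pivot, in row `j` and column `k`: the
        -- transposed position.
        F a d = (δ a j * s) * δ k d

        M⊛F : ∀ (M : Mat n n) a d → (M ⊛ F) a d ≈ M a j * s * δ k d
        M⊛F M a d = begin
          ∑[ e < n ] (M a e * (δ e j * s * δ k d))
            ≈⟨ ∑-cong (λ e → begin
                 M a e * (δ e j * s * δ k d)    ≈⟨ *-congˡ (*-assoc (δ e j) s (δ k d)) ⟩
                 M a e * (δ e j * (s * δ k d))  ≈⟨ *-assoc (M a e) (δ e j) (s * δ k d) ⟨
                 M a e * δ e j * (s * δ k d)    ∎) ⟩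
          ∑[ e < n ] (M a e * δ e j * (s * δ k d))
            ≈⟨ *-distribʳ-sum (s * δ k d) (λ e → M a e * δ e j) ⟨
          ∑[ e < n ] (M a e * δ e j) * (s * δ k d)
            ≈⟨ *-congʳ (∑-δʳ j (M a)) ⟩
          M a j * (s * δ k d)  ≈⟨ *-assoc (M a j) s (δ k d) ⟨
          M a j * s * δ k d ∎

        [MF]⊛N : ∀ (M N : Mat n n) a d → (M ⊛ F ⊛ N) a d ≈ M a j * s * N k d
        [MF]⊛N M N a d = begin
          ∑[ e < n ] ((M ⊛ F) a e * N e d)
            ≈⟨ ∑-cong (λ e → trans (*-congʳ (M⊛F M a e)) (*-assoc _ _ _)) ⟩
          ∑[ e < n ] (M a j * s * (δ k e * N e d))
            ≈⟨ *-distribˡ-sum (M a j * s) (λ e → δ k e * N e d) ⟨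
          M a j * s * ∑[ e < n ] (δ k e * N e d)
            ≈⟨ *-congˡ (∑-δˡ k λ e → N e d) ⟩
          M a j * s * N k d ∎

        F⊛N : ∀ (N : Mat n n) a d → (F ⊛ N) a d ≈ δ a j * s * N k d
        F⊛N N a d = begin
          ∑[ e < n ] (δ a j * s * δ k e * N e d)
            ≈⟨ ∑-cong (λ e → *-assoc (δ a j * s) (δ k e) (N e d)) ⟩
          ∑[ e < n ] (δ a j * s * (δ k e * N e d))
            ≈⟨ *-distribˡ-sum (δ a j * s) (λ e → δ k e * N e d) ⟨
          δ a j * s * ∑[ e < n ] (δ k e * N e d)
            ≈⟨ *-congˡ (∑-δˡ k λ e → N e d) ⟩
          δ a j * s * N k d ∎

        FRF : F ⊛ R ⊛ F ≋ F
        FRF a d = begin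
          (F ⊛ R ⊛ F) a d                 ≈⟨ M⊛F (F ⊛ R) a d ⟩
          (F ⊛ R) a j * s * δ k d         ≈⟨ *-congʳ (*-congʳ (F⊛N R a j)) ⟩
          δ a j * s * R k j * s * δ k d   ≈⟨ *-congʳ (*-assoc (δ a j * s) (R k j) s) ⟩
          δ a j * s * (R k j * s) * δ k d ≈⟨ *-congʳ (trans (*-congˡ pivot) (*-identityʳ (δ a j * s))) ⟩
          δ a j * s * δ k d ∎

        -- Each pivot adds an idempotent of this trace, so the trace of X B goes up by exactly one.
        tr-FR : tr (F ⊛ R) ≈ 1#
        tr-FR = begin
          tr (F ⊛ R)                ≈⟨ tr-comm F R ⟩
          tr (R ⊛ F)                ≈⟨ ∑-cong (λ a → M⊛F R a a) ⟩
          ∑[ a < n ] (R a j * s * δ k a)  ≈⟨ ∑-cong (λ a → *-comm (R a j * s) (δ k a)) ⟩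
          ∑[ a < n ] (δ k a * (R a j * s))  ≈⟨ ∑-δˡ k (λ a → R a j * s) ⟩
          R k j * s                 ≈⟨ pivot ⟩
          1# ∎

      pivot-step : ∀ {B k rows} (I : PartialInverse B rows) {j} →
                   (∃ λ s → residue B (inv I) k j * s ≈ 1#) → PartialInverse B (k ∷ rows)
      pivot-step {B} {k} {rows} I {j} (s , pivot) = record
        { inv = X′
        ; idempotent = update-idem {B} {X} {F} (idempotent I) FRF
        ; residue≈0 = clear
        ; rank = suc (rank I)
        ; trace = begin
            tr (X′ ⊛ B)                ≈⟨ tr-cong (update-* {B} {X} {F} (idempotent I) FRF) ⟩
            tr (X ⊛ B M.+ P ⊛ F ⊛ R)   ≈⟨ ∑-distrib-+ (λ i → (X ⊛ B) i i) _ ⟩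
            tr (X ⊛ B) + tr (P ⊛ F ⊛ R)
              ≈⟨ +-cong (trace I) (begin
                   tr (P ⊛ F ⊛ R)      ≈⟨ tr-cong (M.*-assoc P F R) ⟩
                   tr (P ⊛ (F ⊛ R))    ≈⟨ tr-comm P (F ⊛ R) ⟩
                   tr (F ⊛ R ⊛ P)      ≈⟨ tr-cong (M.trans (M.*-assoc F R P)
                                            (M.*-congˡ {F} (rp≈r {B} {X} {F} (idempotent I) FRF))) ⟩
                   tr (F ⊛ R)          ≈⟨ tr-FR ⟩
                   1# ∎) ⟩
            rank I · 1# + 1#           ≈⟨ +-comm _ _ ⟩
            suc (rank I) · 1# ∎
        ; rank≡0 = λ ()
        }
        where
        X P X′ : Mat n n
        X = inv I
        P = δ M.- X ⊛ B
        open Pivot B X k j s pivot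
        X′ = update {B} {X} {F} (idempotent I) FRF

        residue-entry : ∀ i l → residue B X′ i l ≈ R i l - R i j * s * R k l
        residue-entry i l = trans (update-residue {B} {X} {F} (idempotent I) FRF i l)
          (+-congˡ (-‿cong ([MF]⊛N R R i l)))

        clear : ∀ {i} → i ∈ˡ k ∷ rows → ∀ l → residue B X′ i l ≈ 0#
        clear (here ≡.refl) l = begin
          residue B X′ k l           ≈⟨ residue-entry k l ⟩
          R k l - R k j * s * R k l  ≈⟨ +-congˡ (-‿cong (trans (*-congʳ pivot) (*-identityˡ (R k l)))) ⟩
          R k l - R k l              ≈⟨ -‿inverseʳ (R k l) ⟩
          0# ∎
        -- An earlier row stays zero: what is subtracted is a multiple of its entry in the pivot
        -- column, itself zero.
        clear {i} (there i∈) l = begin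
          residue B X′ i l           ≈⟨ residue-entry i l ⟩
          R i l - R i j * s * R k l  ≈⟨ +-cong (residue≈0 I i∈ l) (-‿cong (begin
            R i j * s * R k l          ≈⟨ *-congʳ (trans (*-congʳ (residue≈0 I i∈ j)) (zeroˡ s)) ⟩
            0# * R k l                 ≈⟨ zeroˡ (R k l) ⟩
            0# ∎)) ⟩
          0# - 0#                    ≈⟨ -‿inverseʳ 0# ⟩
          0# ∎

      skip-step : ∀ {B k rows} (I : PartialInverse B rows) →
                  (∀ j → residue B (inv I) k j ≈ 0#) → PartialInverse B (k ∷ rows)
      skip-step I z = record
        { inv = inv I
        ; idempotent = idempotent I
        ; residue≈0 = λ { (here ≡.refl) → z ; (there i∈) → residue≈0 I i∈ }
        ; rank = rank I
        ; trace = trace I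
        ; rank≡0 = rank≡0 I
        }

      eliminate : ∀ B rows → ¬ ¬ PartialInverse B rows
      eliminate B [] = return record
        { inv = M.0#
        ; idempotent = M.trans (M.*-congʳ {M.0# ⊛ B} (M.zeroˡ B)) (M.trans (M.zeroˡ _) (M.sym (M.zeroˡ B)))
        ; residue≈0 = λ ()
        ; rank = 0
        ; trace = ∑-zero λ i → M.zeroˡ B i i
        ; rank≡0 = λ _ → M.zeroˡ B
        }
      eliminate B (k ∷ rows) = eliminate B rows >>= λ I →
        -- The whole row is classified under one double negation; after that, finding a pivot is an
        -- ordinary finite search.
        ¬¬-∀Fin (λ j → zero-or-unit (residue B (inv I) k j)) >>= λ dec →
        return (step I (all-or-any dec))
        where
        step : ∀ (I : PartialInverse B rows) →
               (∀ j → residue B (inv I) k j ≈ 0#) ⊎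
               (∃ λ j → ∃ λ s → residue B (inv I) k j * s ≈ 1#) →
               PartialInverse B (k ∷ rows)
        step I (inj₁ z)       = skip-step I z
        step I (inj₂ (_ , u)) = pivot-step I u

    record PseudoInverse (B : Mat n n) : Set (c ⊔ ℓ) where
      field
        inv    : Mat n n
        BXB≋B  : B ⊛ inv ⊛ B ≋ B
        rank   : ℕ
        trace  : tr (inv ⊛ B) ≈ rank · 1#
        rank≡0 : rank ≡ 0 → inv ⊛ B ≋ M.0#

    -- Once all rows are treated the residue B (1 - X B) vanishes, which is B X B = B.
    pseudoInverse : ∀ B → ¬ ¬ PseudoInverse B
    pseudoInverse B = eliminate B (allFin n) >>= λ I → return record
      { inv = inv I
      ; BXB≋B = λ i j → begin
          (B ⊛ inv I ⊛ B) i j    ≈⟨ M.*-assoc B (inv I) B i j ⟩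
          (B ⊛ (inv I ⊛ B)) i j  ≈⟨ x-y≈0⇒y≈x (trans (sym (trans
                                      (RingProperties.x[y-z]≈xy-xz (matrixRing n) B δ (inv I ⊛ B) i j)
                                      (+-congʳ (M.*-identityʳ B i j))))
                                      (residue≈0 I (∈-allFin i) j)) ⟩
          B i j ∎
      ; rank = rank I
      ; trace = trace I
      ; rank≡0 = rank≡0 I
      }
      where
      x-y≈0⇒y≈x : ∀ {x y} → x - y ≈ 0# → y ≈ x
      x-y≈0⇒y≈x {x} {y} p = sym (RingProperties.x∙y⁻¹≈ε⇒x≈y ring x y p)

    -- From Q = Q X Q, cyclicity of the trace and Q² = Q give tr Q = tr (X Q), the number of pivots.
    -- The rationality of the traces used below comes from this integer.
    idempotent-trace : ∀ Q → Q ⊛ Q ≋ Q →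
                       ¬ ¬ ∃ λ r → tr Q ≈ r · 1# × (r ≡ 0 → Q ≋ M.0#)
    idempotent-trace Q QQ≋Q = pseudoInverse Q >>= λ I →
      let open PseudoInverse I renaming (inv to X; rank to r; trace to tr-XQ; rank≡0 to r≡0⇒XQ≋0) in
      return (r , (begin
        tr Q              ≈⟨ tr-cong BXB≋B ⟨
        tr (Q ⊛ X ⊛ Q)    ≈⟨ tr-comm (Q ⊛ X) Q ⟩
        tr (Q ⊛ (Q ⊛ X))  ≈⟨ tr-cong (M.*-assoc Q Q X) ⟨
        tr (Q ⊛ Q ⊛ X)    ≈⟨ tr-cong (M.*-congʳ {X} QQ≋Q) ⟩
        tr (Q ⊛ X)        ≈⟨ tr-comm Q X ⟩
        tr (X ⊛ Q)        ≈⟨ tr-XQ ⟩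
        r · 1# ∎) , λ r≡0 i j → begin
        Q i j             ≈⟨ BXB≋B i j ⟨
        (Q ⊛ X ⊛ Q) i j   ≈⟨ M.*-assoc Q X Q i j ⟩
        (Q ⊛ (X ⊛ Q)) i j ≈⟨ M.*-congˡ {Q} (r≡0⇒XQ≋0 r≡0) i j ⟩
        (Q ⊛ M.0#) i j    ≈⟨ M.zeroʳ Q i j ⟩
        0# ∎)

-- Projectors onto kernels

module KernelProjector {c ℓ} (R : Ring c ℓ) where

  open Ring R
  open RingProperties R
  open SetoidReasoning setoid

  module _ {b x : Carrier} (bxb : b * x * b ≈ b) where

    private
      p : Carrier
      p = 1# - x * b

    b*p≈0 : b * p ≈ 0#
    b*p≈0 = begin
      b * (1# - x * b)      ≈⟨ x[y-z]≈xy-xz b 1# (x * b) ⟩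
      b * 1# - b * (x * b)  ≈⟨ +-cong (*-identityʳ b) (-‿cong (trans (sym (*-assoc b x b)) bxb)) ⟩
      b - b                 ≈⟨ -‿inverseʳ b ⟩
      0# ∎

    b*v≈0⇒p*v≈v : ∀ {v} → b * v ≈ 0# → p * v ≈ v
    b*v≈0⇒p*v≈v {v} bv = begin
      (1# - x * b) * v      ≈⟨ [y-z]x≈yx-zx v 1# (x * b) ⟩
      1# * v - x * b * v    ≈⟨ +-cong (*-identityˡ v) (-‿cong (trans (*-assoc x b v)
                                 (trans (*-congˡ bv) (zeroʳ x)))) ⟩
      v - 0#                ≈⟨ +-congˡ -0#≈0# ⟩
      v + 0#                ≈⟨ +-identityʳ v ⟩
      v ∎

    p-idempotent : p * p ≈ p
    p-idempotent = b*v≈0⇒p*v≈v b*p≈0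

    -- As `m` commutes with `b`, it preserves the kernel of `b`; `p` is the identity there, so p m p
    -- = m p.
    m*p-idempotent : ∀ {m} → b * m ≈ m * b → m * m ≈ m → (m * p) * (m * p) ≈ m * p
    m*p-idempotent {m} bm mm = begin
      m * p * (m * p)    ≈⟨ *-assoc m p (m * p) ⟩
      m * (p * (m * p))  ≈⟨ *-congˡ (b*v≈0⇒p*v≈v (begin
        b * (m * p)        ≈⟨ *-assoc b m p ⟨
        b * m * p          ≈⟨ *-congʳ bm ⟩
        m * b * p          ≈⟨ *-assoc m b p ⟩
        m * (b * p)        ≈⟨ *-congˡ b*p≈0 ⟩
        m * 0#             ≈⟨ zeroʳ m ⟩
        0# ∎)) ⟩
      m * (m * p)        ≈⟨ *-assoc m m p ⟨
      m * m * p          ≈⟨ *-congʳ mm ⟩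
      m * p ∎

  commute-- : ∀ {a s m} → a * m ≈ m * a → s * m ≈ m * s → (a - s) * m ≈ m * (a - s)
  commute-- {a} {s} {m} am sm = begin
    (a - s) * m    ≈⟨ [y-z]x≈yx-zx m a s ⟩
    a * m - s * m  ≈⟨ +-cong am (-‿cong sm) ⟩
    m * a - m * s  ≈⟨ x[y-z]≈xy-xz m a s ⟨
    m * (a - s) ∎

-- Convolution matrices of a finite group

module GroupMatrices {c ℓ} (K : CommutativeRing c ℓ) {n : ℕ}
  (_∙_ : Op₂ (Fin n)) (ε : Fin n) (_⁻¹ : Op₁ (Fin n)) (isGroup : IsGroup _≡_ _∙_ ε _⁻¹) where

  open CommutativeRing K
  open SemiringSum semiring
  open Matrices K
  open SetoidReasoning setoid

  private
    G : Group 0ℓ 0ℓ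
    G = record { isGroup = isGroup }
    module G = Group G
    module GP = GroupProperties G

  ∑-reindex : ∀ (σ τ : Fin n → Fin n) → (∀ i → σ (τ i) ≡ i) → (∀ i → τ (σ i) ≡ i) →
              ∀ f → sum f ≈ ∑[ i < n ] f (σ i)
  ∑-reindex σ τ στ τσ f = ∑-permute f (permutation σ τ στ τσ)

  -- Left multiplication by ∑ u(a) a on the group algebra, in the basis of group elements.
  Λ : (Fin n → Carrier) → Mat n n
  Λ u i j = u (i ∙ (j ⁻¹))

  ∑-∙ʳ : ∀ j f → sum f ≈ ∑[ i < n ] f (i ∙ j)
  ∑-∙ʳ j = ∑-reindex (_∙ j) (_∙ (j ⁻¹)) (GP.//-rightDividesˡ j) (GP.//-rightDividesʳ j)

  -- The substitution a = i j⁻¹, with inverse j = a⁻¹ i.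
  ∑-∙⁻¹ : ∀ i f → sum f ≈ ∑[ a < n ] f ((a ⁻¹) ∙ i)
  ∑-∙⁻¹ i = ∑-reindex (λ a → (a ⁻¹) ∙ i) (λ j → i ∙ (j ⁻¹))
    (λ j → ≡.trans (cong (_∙ i) (GP.⁻¹-anti-homo-// i j)) (GP.//-rightDividesˡ i j))
    (λ a → ≡.trans (cong (i ∙_) (GP.⁻¹-anti-homo-\\ a i)) (GP.\\-leftDividesˡ i a))

  convolution : ∀ u v i k → (Λ u ⊛ Λ v) i k ≈ ∑[ a < n ] (u a * v (((a ⁻¹) ∙ i) ∙ (k ⁻¹)))
  convolution u v i k = begin
    ∑[ j < n ] (u (i ∙ (j ⁻¹)) * v (j ∙ (k ⁻¹)))
      ≈⟨ ∑-∙⁻¹ i (λ j → u (i ∙ (j ⁻¹)) * v (j ∙ (k ⁻¹))) ⟩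
    ∑[ a < n ] (u (i ∙ (((a ⁻¹) ∙ i) ⁻¹)) * v (((a ⁻¹) ∙ i) ∙ (k ⁻¹)))
      ≈⟨ ∑-cong (λ a → *-congʳ (reflexive (cong u
           (≡.trans (cong (i ∙_) (GP.⁻¹-anti-homo-\\ a i)) (GP.\\-leftDividesˡ i a))))) ⟩
    ∑[ a < n ] (u a * v (((a ⁻¹) ∙ i) ∙ (k ⁻¹))) ∎

  -- After the substitution j = a k, the class property turns f (i k⁻¹ a⁻¹) into f (a⁻¹ i k⁻¹), the
  -- factor of the opposite convolution.
  Λ-central : ∀ {f} → (∀ x y → f (x ∙ y) ≈ f (y ∙ x)) → ∀ u → Λ f ⊛ Λ u ≋ Λ u ⊛ Λ f
  Λ-central {f} class u i k = begin
    ∑[ j < n ] (f (i ∙ (j ⁻¹)) * u (j ∙ (k ⁻¹)))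
      ≈⟨ ∑-∙ʳ k (λ j → f (i ∙ (j ⁻¹)) * u (j ∙ (k ⁻¹))) ⟩
    ∑[ a < n ] (f (i ∙ ((a ∙ k) ⁻¹)) * u ((a ∙ k) ∙ (k ⁻¹)))
      ≈⟨ ∑-cong (λ a → begin
           f (i ∙ ((a ∙ k) ⁻¹)) * u ((a ∙ k) ∙ (k ⁻¹))
             ≈⟨ *-cong (trans (reflexive (cong f (≡.trans (cong (i ∙_) (GP.⁻¹-anti-homo-∙ a k))
                         (≡.sym (G.assoc i (k ⁻¹) (a ⁻¹)))))) (trans (class _ _)
                         (reflexive (cong f (≡.sym (G.assoc (a ⁻¹) i (k ⁻¹)))))))
                       (reflexive (cong u (GP.//-rightDividesʳ k a))) ⟩
           f (((a ⁻¹) ∙ i) ∙ (k ⁻¹)) * u a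
             ≈⟨ *-comm _ _ ⟩
           u a * f (((a ⁻¹) ∙ i) ∙ (k ⁻¹)) ∎) ⟩
    ∑[ a < n ] (u a * f (((a ⁻¹) ∙ i) ∙ (k ⁻¹)))
      ≈⟨ convolution u f i k ⟨
    (Λ u ⊛ Λ f) i k ∎

  -- The first condition says that translation by the support of `u` preserves `u`. The factor `u a`
  -- replaces a case distinction on membership in the support.
  Λ-idempotent : ∀ {u} → (∀ a x → u a * u ((a ⁻¹) ∙ x) ≈ u a * u x) → sum u ≈ 1# → Λ u ⊛ Λ u ≋ Λ u
  Λ-idempotent {u} inv ∑u≈1 i k = begin
    (Λ u ⊛ Λ u) i k                                 ≈⟨ convolution u u i k ⟩
    ∑[ a < n ] (u a * u (((a ⁻¹) ∙ i) ∙ (k ⁻¹)))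
      ≈⟨ ∑-cong (λ a → trans (*-congˡ (reflexive (cong u (G.assoc (a ⁻¹) i (k ⁻¹))))) (inv a (i ∙ (k ⁻¹)))) ⟩
    ∑[ a < n ] (u a * u (i ∙ (k ⁻¹)))               ≈⟨ *-distribʳ-sum _ u ⟨
    sum u * u (i ∙ (k ⁻¹))                          ≈⟨ trans (*-congʳ ∑u≈1) (*-identityˡ _) ⟩
    u (i ∙ (k ⁻¹)) ∎

  -- tr (ρ(g) P) for the left regular representation ρ.
  twistedTrace : Mat n n → Fin n → Carrier
  twistedTrace P g = ∑[ j < n ] P j (g ∙ j)

  -- Linearity of the trace in `u`, visible after the substitution i = g j.
  tr-Λ : ∀ u P → tr (Λ u ⊛ P) ≈ ∑[ g < n ] (u g * twistedTrace P g)
  tr-Λ u P = begin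
    ∑[ i < n ] ∑[ j < n ] (u (i ∙ (j ⁻¹)) * P j i)
      ≈⟨ ∑-comm (λ i j → u (i ∙ (j ⁻¹)) * P j i) ⟩
    ∑[ j < n ] ∑[ i < n ] (u (i ∙ (j ⁻¹)) * P j i)
      ≈⟨ ∑-cong (λ j → ∑-∙ʳ j λ i → u (i ∙ (j ⁻¹)) * P j i) ⟩
    ∑[ j < n ] ∑[ g < n ] (u ((g ∙ j) ∙ (j ⁻¹)) * P j (g ∙ j))
      ≈⟨ ∑-cong (λ j → ∑-cong λ g → *-congʳ (reflexive (cong u (GP.//-rightDividesʳ j g)))) ⟩
    ∑[ j < n ] ∑[ g < n ] (u g * P j (g ∙ j))
      ≈⟨ ∑-comm (λ j g → u g * P j (g ∙ j)) ⟩
    ∑[ g < n ] ∑[ j < n ] (u g * P j (g ∙ j))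
      ≈⟨ ∑-cong (λ g → *-distribˡ-sum (u g) λ j → P j (g ∙ j)) ⟨
    ∑[ g < n ] (u g * twistedTrace P g) ∎

-- Nonnegative sums and indicator functions over ℚ

module ℚΣ = SemiringSum (CommutativeRing.semiring ℚ.+-*-commutativeRing)

∑-nonNeg : ∀ {n} (f : Fin n → ℚ) → (∀ i → 0ℚ ℚ.≤ f i) → 0ℚ ℚ.≤ ℚΣ.sum f
∑-nonNeg {zero}  f p = ℚ.≤-refl
∑-nonNeg {suc n} f p = ℚ.+-mono-≤ (p zero) (∑-nonNeg (f ∘ suc) (p ∘ suc))

f≤∑f : ∀ {n} (f : Fin n → ℚ) → (∀ i → 0ℚ ℚ.≤ f i) → ∀ i → f i ℚ.≤ ℚΣ.sum f
f≤∑f {suc n} f p zero    = subst (ℚ._≤ ℚΣ.sum f) (ℚ.+-identityʳ (f zero))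
  (ℚ.+-monoʳ-≤ (f zero) (∑-nonNeg (f ∘ suc) (p ∘ suc)))
f≤∑f {suc n} f p (suc i) = subst (ℚ._≤ ℚΣ.sum f) (ℚ.+-identityˡ (f (suc i)))
  (ℚ.+-mono-≤ (p zero) (f≤∑f (f ∘ suc) (p ∘ suc) i))

0≤1 : 0ℚ ℚ.≤ 1ℚ
0≤1 = ℚ.nonNegative⁻¹ 1ℚ

-- Orders of subgroups and sizes of classes are sums of this kind, so division by them is possible.
∑≢0 : ∀ {n} (f : Fin n → ℚ) → (∀ i → 0ℚ ℚ.≤ f i) → ∀ i → f i ≡ 1ℚ → ℚΣ.sum f ≢ 0ℚ
∑≢0 f p i fi≡1 ∑≡0 = ℚ.<-irrefl ≡.refl (ℚ.<-≤-trans (ℚ.positive⁻¹ 1ℚ)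
  (subst (1ℚ ℚ.≤_) ∑≡0 (subst (ℚ._≤ ℚΣ.sum f) fi≡1 (f≤∑f f p i))))

inverse : ∀ q → q ≢ 0ℚ → ∃ λ p → p ℚ.* q ≡ 1ℚ
inverse q q≢0 = (ℚ.1/ q) {{ℚ.≢-nonZero q≢0}} , ℚ.*-inverseˡ q {{ℚ.≢-nonZero q≢0}}

inverse-unique : ∀ {p q r s} → p ℚ.* q ≡ 1ℚ → r ℚ.* s ≡ 1ℚ → q ≡ s → p ≡ r
inverse-unique {p} {q} {r} pq≡1 rq≡1 ≡.refl = begin
  p               ≡⟨ ℚ.*-identityʳ p ⟨
  p ℚ.* 1ℚ        ≡⟨ cong (p ℚ.*_) rq≡1 ⟨
  p ℚ.* (r ℚ.* q) ≡⟨ cong (p ℚ.*_) (ℚ.*-comm r q) ⟩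
  p ℚ.* (q ℚ.* r) ≡⟨ ℚ.*-assoc p q r ⟨
  p ℚ.* q ℚ.* r   ≡⟨ cong (ℚ._* r) pq≡1 ⟩
  1ℚ ℚ.* r        ≡⟨ ℚ.*-identityˡ r ⟩
  r               ∎
  where open ≡.≡-Reasoning

indicator : ∀ {a} {A : Set a} → Dec A → ℚ
indicator (yes _) = 1ℚ
indicator (no  _) = 0ℚ

indicator-cong : ∀ {a b} {A : Set a} {B : Set b} (A? : Dec A) (B? : Dec B) →
                 (A → B) → (B → A) → indicator A? ≡ indicator B?
indicator-cong (yes a) (yes b) f g = ≡.refl
indicator-cong (yes a) (no ¬b) f g = contradiction (f a) ¬b
indicator-cong (no ¬a) (yes b) f g = contradiction (g b) ¬a
indicator-cong (no ¬a) (no ¬b) f g = ≡.refl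

indicator-yes : ∀ {a} {A : Set a} (A? : Dec A) → A → indicator A? ≡ 1ℚ
indicator-yes (yes _) _ = ≡.refl
indicator-yes (no ¬a) a = contradiction a ¬a

indicator-nonNeg : ∀ {a} {A : Set a} (A? : Dec A) → 0ℚ ℚ.≤ indicator A?
indicator-nonNeg (yes _) = 0≤1
indicator-nonNeg (no  _) = ℚ.≤-refl

-- Rational elements of a ring

module RationalElements {c ℓ} (K : CommutativeRing c ℓ)
  (ι : ℚ → CommutativeRing.Carrier K)
  (ι-hom : RingMorphisms.IsRingHomomorphism ℚ.+-*-rawRing (CommutativeRing.rawRing K) ι) where

  open CommutativeRing K hiding (zero)
  open RingMorphisms.IsRingHomomorphism ι-hom public
    renaming ( +-homo to ι-+; *-homo to ι-*; 1#-homo to ι-1; 0#-homo to ι-0; -‿homo to ι-neg)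
    using (⟦⟧-cong)
  open SemiringSum semiring
  open Matrices K using (∑-cong)
  open Mult +-monoid using () renaming (_×_ to _·_)
  open SetoidReasoning setoid

  IsRational : Carrier → Set ℓ
  IsRational x = ∃ λ q → x ≈ ι q

  ι-∑ : ∀ {n} (f : Fin n → ℚ) → ι (ℚΣ.sum f) ≈ ∑[ i < n ] ι (f i)
  ι-∑ {zero}  f = ι-0
  ι-∑ {suc n} f = trans (ι-+ _ _) (+-congˡ (ι-∑ (f ∘ suc)))

  ι-· : ∀ m → m · 1# ≈ ι ((+ m) /1)
  ι-· zero    = sym ι-0
  ι-· (suc m) = begin
    1# + m · 1#                ≈⟨ +-cong (sym ι-1) (ι-· m) ⟩
    ι 1ℚ + ι ((+ m) /1)        ≈⟨ ι-+ 1ℚ ((+ m) /1) ⟨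
    ι (1ℚ ℚ.+ (+ m) /1)        ≈⟨ ⟦⟧-cong (/1-+ (+ 1) (+ m)) ⟨
    ι ((+ suc m) /1)           ∎

  rational-≈ : ∀ {x y} → x ≈ y → IsRational y → IsRational x
  rational-≈ x≈y (q , y≈q) = q , trans x≈y y≈q

  rational-+ : ∀ {x y} → IsRational x → IsRational y → IsRational (x + y)
  rational-+ (p , x≈p) (q , y≈q) = p ℚ.+ q , trans (+-cong x≈p y≈q) (sym (ι-+ p q))

  rational-* : ∀ {x y} → IsRational x → IsRational y → IsRational (x * y)
  rational-* (p , x≈p) (q , y≈q) = p ℚ.* q , trans (*-cong x≈p y≈q) (sym (ι-* p q))

  rational-neg : ∀ {x} → IsRational x → IsRational (- x)
  rational-neg (p , x≈p) = ℚ.- p , trans (-‿cong x≈p) (sym (ι-neg p))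

  rational-∑ : ∀ {n} {f : Fin n → Carrier} → (∀ i → IsRational (f i)) → IsRational (sum f)
  rational-∑ {zero}  r = 0ℚ , sym ι-0
  rational-∑ {suc n} r = rational-+ (r zero) (rational-∑ (r ∘ suc))

  ι-cancel : ∀ {p q} → p ℚ.* q ≡ 1ℚ → ∀ x → ι p * (ι q * x) ≈ x
  ι-cancel {p} {q} pq≡1 x = begin
    ι p * (ι q * x)  ≈⟨ *-assoc _ _ _ ⟨
    ι p * ι q * x    ≈⟨ *-congʳ (trans (sym (ι-* p q)) (trans (⟦⟧-cong pq≡1) ι-1)) ⟩
    1# * x           ≈⟨ *-identityˡ x ⟩
    x ∎

  -- Weighted sums along a finite preorder

  module Weighted {n p} (_≼_ : Rel (Fin n) p) (_≼?_ : Decidable _≼_)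
    (≼-refl : Reflexive _≼_) (≼-trans : Transitive _≼_) (φ : Fin n → Carrier) where

    ∑φ : (Fin n → ℚ) → Carrier
    ∑φ w = ∑[ h < n ] (ι (w h) * φ h)

    down : Fin n → Fin n → ℚ
    down g h = indicator (h ≼? g)

    Invariant : (Fin n → ℚ) → Set p
    Invariant w = ∀ {g h} → g ≼ h → h ≼ g → w g ≡ w h

    private

      class : Fin n → Fin n → ℚ
      class g h = indicator (h ≼? g) ℚ.* indicator (g ≼? h)

      strict : Fin n → Fin n → ℚ
      strict g h = indicator (h ≼? g) ℚ.* (1ℚ ℚ.- indicator (g ≼? h))

      size : Fin n → ℚ
      size g = ℚΣ.sum (class g)

      class-self : ∀ g → class g g ≡ 1ℚ
      class-self g with g ≼? g
      ... | yes _   = ≡.refl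
      ... | no  g⋠g = contradiction ≼-refl g⋠g

      class-nonNeg : ∀ g h → 0ℚ ℚ.≤ class g h
      class-nonNeg g h with h ≼? g | g ≼? h
      ... | yes _ | yes _ = 0≤1
      ... | yes _ | no  _ = ℚ.≤-refl
      ... | no  _ | yes _ = ℚ.≤-refl
      ... | no  _ | no  _ = ℚ.≤-refl

      share : ∀ g → ∃ λ s → s ℚ.* size g ≡ 1ℚ
      share g = inverse (size g) (∑≢0 (class g) (class-nonNeg g) g (class-self g))

      d : Fin n → ℚ
      d g = proj₁ (share g)

      down-cong : ∀ g → Invariant (down g)
      down-cong g {h} {k} h≼k k≼h =
        indicator-cong (h ≼? g) (k ≼? g) (≼-trans k≼h) (≼-trans h≼k)

      up-cong : ∀ g {h k} → h ≼ k → k ≼ h → indicator (g ≼? h) ≡ indicator (g ≼? k)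
      up-cong g {h} {k} h≼k k≼h =
        indicator-cong (g ≼? h) (g ≼? k) (λ q → ≼-trans q h≼k) (λ q → ≼-trans q k≼h)

      strict-cong : ∀ g → Invariant (strict g)
      strict-cong g p q = cong₂ ℚ._*_ (down-cong g p q) (cong (λ t → 1ℚ ℚ.- t) (up-cong g p q))

      size-cong : ∀ {g h} → g ≼ h → h ≼ g → size g ≡ size h
      size-cong p q = ℚΣ.sum-cong-≗ λ k → cong₂ ℚ._*_ (up-cong k p q) (down-cong k p q)

      d-cong : ∀ {g h} → g ≼ h → h ≼ g → d g ≡ d h
      d-cong {g} {h} p q = inverse-unique (proj₂ (share g)) (proj₂ (share h)) (size-cong p q)

      -- Both sides vanish unless `h` and `k` are equivalent. Moving the weight to `k` leaves a sum
      -- over `h` that just counts the class of `k`.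
      class-transport : ∀ {w} → Invariant w → ∀ k h → w h ℚ.* class h k ≡ w k ℚ.* class k h
      class-transport {w} inv k h with k ≼? h | h ≼? k
      ... | yes p | yes q = cong (ℚ._* 1ℚ) (inv q p)
      ... | yes _ | no  _ = ≡.trans (ℚ.*-zeroʳ (w h)) (≡.sym (ℚ.*-zeroʳ (w k)))
      ... | no  _ | yes _ = ≡.trans (ℚ.*-zeroʳ (w h)) (≡.sym (ℚ.*-zeroʳ (w k)))
      ... | no  _ | no  _ = ≡.trans (ℚ.*-zeroʳ (w h)) (≡.sym (ℚ.*-zeroʳ (w k)))

      -- Every class occurs once for each of its elements, and `d h`, the inverse of the class size,
      -- compensates. This avoids choosing representatives.
      ∑φ-class : ∀ {w} → Invariant w →
                 ∑φ w ≈ ∑[ h < n ] (ι (w h ℚ.* d h) * ∑φ (class h))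
      ∑φ-class {w} inv = sym (begin
        ∑[ h < n ] (ι (w h ℚ.* d h) * ∑φ (class h))
          ≈⟨ ∑-cong (λ h → *-distribˡ-sum (ι (w h ℚ.* d h)) λ k → ι (class h k) * φ k) ⟩
        ∑[ h < n ] ∑[ k < n ] (ι (w h ℚ.* d h) * (ι (class h k) * φ k))
          ≈⟨ ∑-comm (λ h k → ι (w h ℚ.* d h) * (ι (class h k) * φ k)) ⟩
        ∑[ k < n ] ∑[ h < n ] (ι (w h ℚ.* d h) * (ι (class h k) * φ k))
          ≈⟨ ∑-cong (λ k → ∑-cong λ h → trans (sym (*-assoc _ _ _))
               (*-congʳ (trans (sym (ι-* _ _)) (⟦⟧-cong
                 (class-transport (λ p q → cong₂ ℚ._*_ (inv p q) (d-cong p q)) k h))))) ⟩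
        ∑[ k < n ] ∑[ h < n ] (ι (w k ℚ.* d k ℚ.* class k h) * φ k)
          ≈⟨ ∑-cong (λ k → *-distribʳ-sum (φ k) λ h → ι (w k ℚ.* d k ℚ.* class k h)) ⟨
        ∑[ k < n ] (∑[ h < n ] ι (w k ℚ.* d k ℚ.* class k h) * φ k)
          ≈⟨ ∑-cong (λ k → *-congʳ (trans (sym (ι-∑ λ h → w k ℚ.* d k ℚ.* class k h)) (⟦⟧-cong (collect k)))) ⟩
        ∑[ k < n ] (ι (w k) * φ k) ∎)
        where
        collect : ∀ k → ℚΣ.sum (λ h → w k ℚ.* d k ℚ.* class k h) ≡ w k
        collect k = ≡.trans (≡.sym (ℚΣ.*-distribˡ-sum (w k ℚ.* d k) (class k)))
          (≡.trans (ℚ.*-assoc (w k) (d k) (size k))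
            (≡.trans (cong (w k ℚ.*_) (proj₂ (share k))) (ℚ.*-identityʳ (w k))))

      _⊏_ : Rel (Fin n) p
      h ⊏ g = h ≼ g × ¬ g ≼ h

      ⊏-acc : ∀ g → Acc _⊏_ g
      ⊏-acc = spo-wellFounded {_≈_ = _≡_} record
        { isEquivalence = ≡.isEquivalence
        ; irrefl = λ { ≡.refl (p , ¬p) → ¬p p }
        ; trans = λ { (p , ¬p) (q , ¬q) → ≼-trans p q , λ r → ¬p (≼-trans q r) }
        ; <-resp-≈ = (λ { ≡.refl p → p }) , (λ { ≡.refl p → p })
        }

      down-split : ∀ g h → down g h ≡ class g h ℚ.+ strict g h
      down-split g h with h ≼? g | g ≼? h
      ... | yes _ | yes _ = ≡.refl
      ... | yes _ | no  _ = ≡.refl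
      ... | no  _ | yes _ = ≡.refl
      ... | no  _ | no  _ = ≡.refl

      strict⇒⊏ : ∀ g h → strict g h ≡ 0ℚ ⊎ h ⊏ g
      strict⇒⊏ g h with h ≼? g | g ≼? h
      ... | yes p | yes _  = inj₁ ≡.refl
      ... | yes p | no  ¬q = inj₂ (p , ¬q)
      ... | no  _ | yes _  = inj₁ ≡.refl
      ... | no  _ | no  _  = inj₁ ≡.refl

      ∑φ-down : ∀ g → ∑φ (down g) ≈ ∑φ (class g) + ∑φ (strict g)
      ∑φ-down g = trans
        (∑-cong λ h → trans (*-congʳ (trans (⟦⟧-cong (down-split g h)) (ι-+ _ _))) (distribʳ _ _ _))
        (∑-distrib-+ (λ h → ι (class g h) * φ h) _)

    module _ (down-rational : ∀ g → IsRational (∑φ (down g))) where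

      private

        -- Remove the strictly smaller classes from the down-set of g.
        class-rational : ∀ {g} → Acc _⊏_ g → IsRational (∑φ (class g))
        class-rational {g} (acc rec) = rational-≈ difference
          (rational-+ (down-rational g) (rational-neg
            (rational-≈ (∑φ-class (strict-cong g)) (rational-∑ term))))
          where
          difference : ∑φ (class g) ≈ ∑φ (down g) - ∑φ (strict g)
          difference = begin
            ∑φ (class g)                                      ≈⟨ +-identityʳ _ ⟨
            ∑φ (class g) + 0#                                 ≈⟨ +-congˡ (-‿inverseʳ _) ⟨
            ∑φ (class g) + (∑φ (strict g) - ∑φ (strict g))    ≈⟨ +-assoc _ _ _ ⟨
            ∑φ (class g) + ∑φ (strict g) - ∑φ (strict g)      ≈⟨ +-congʳ (∑φ-down g) ⟨
            ∑φ (down g) - ∑φ (strict g) ∎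

          term : ∀ h → IsRational (ι (strict g h ℚ.* d h) * ∑φ (class h))
          -- Recursion is available for `h ⊏ g` alone; for every other `h` the weight is zero.
          term h with strict⇒⊏ g h
          ... | inj₂ h⊏g = rational-* (_ , refl) (class-rational (rec h⊏g))
          ... | inj₁ s≡0 = 0ℚ , (begin
            ι (strict g h ℚ.* d h) * ∑φ (class h)
              ≈⟨ *-congʳ (⟦⟧-cong (≡.trans (cong (ℚ._* d h) s≡0) (ℚ.*-zeroˡ (d h)))) ⟩
            ι 0ℚ * ∑φ (class h)  ≈⟨ trans (*-congʳ ι-0) (zeroˡ _) ⟩
            0#                   ≈⟨ ι-0 ⟨
            ι 0ℚ ∎)

      invariant-rational : ∀ {w} → Invariant w → IsRational (∑φ w)
      invariant-rational inv = rational-≈ (∑φ-class inv)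
        (rational-∑ λ h → rational-* (_ , refl) (class-rational (⊏-acc h)))

-- Rationality of eigenvalues

module Rationality {c ℓ} (K : CommutativeRing c ℓ)
  (zero-or-unit : ∀ x → ¬ ¬ (CommutativeRing._≈_ K x (CommutativeRing.0# K) ⊎
    ∃ λ y → CommutativeRing._≈_ K (CommutativeRing._*_ K x y) (CommutativeRing.1# K)))
  (ι : ℚ → CommutativeRing.Carrier K)
  (ι-hom : RingMorphisms.IsRingHomomorphism ℚ.+-*-rawRing (CommutativeRing.rawRing K) ι)
  where

  open CommutativeRing K hiding (zero)
  open RingProperties ring using ([y-z]x≈yx-zx; x∙y⁻¹≈ε⇒x≈y)
  open SemiringSum semiring
  open Matrices K
  open RationalElements K ι ι-hom
  open Mult +-monoid using () renaming (_×_ to _·_)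
  open SetoidReasoning setoid

  -- `∙-≼` and `⁻¹-≼`, with reflexivity, make the elements below any `g` a subgroup; averaging over
  -- it yields an idempotent.
  module _ {n : ℕ} (_∙_ : Op₂ (Fin n)) (ε : Fin n) (_⁻¹ : Op₁ (Fin n))
    (isGroup : IsGroup _≡_ _∙_ ε _⁻¹)
    {p} (_≼_ : Rel (Fin n) p) (_≼?_ : Decidable _≼_)
    (≼-refl : Reflexive _≼_) (≼-trans : Transitive _≼_)
    (∙-≼ : ∀ {g h k} → h ≼ g → k ≼ g → (h ∙ k) ≼ g)
    (⁻¹-≼ : ∀ {g h} → h ≼ g → (h ⁻¹) ≼ g)
    (f : Fin n → ℚ) (f-class : ∀ x y → f (x ∙ y) ≡ f (y ∙ x))
    (f-invariant : ∀ {g h} → g ≼ h → h ≼ g → f g ≡ f h)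
    (z : Carrier) (x : Fin n → Carrier) (x≉0 : ¬ (∀ i → x i ≈ 0#))
    (Ax≈zx : ∀ i → ∑[ j < n ] (ι (f (i ∙ (j ⁻¹))) * x j) ≈ z * x i)
    where

    private
      G : Group 0ℓ 0ℓ
      G = record { isGroup = isGroup }
      module GP = GroupProperties G
      module M = Ring (matrixRing n)
      module MP = RingProperties (matrixRing n)
      open GroupMatrices K _∙_ ε _⁻¹ isGroup
      open Elimination zero-or-unit {n}
      open KernelProjector (matrixRing n)

      A S B V : Mat n n
      A = Λ (ι ∘ f)
      S i j = z * δ i j
      B = A M.- S
      -- The eigenvector repeated in every column, so that identities in the ring of square matrices
      -- apply to it.
      V i j = x i

      S⊛ : ∀ (M : Mat n n) i j → (S ⊛ M) i j ≈ z * M i j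
      S⊛ M i j = begin
        ∑[ k < n ] (z * δ i k * M k j)    ≈⟨ ∑-cong (λ k → *-assoc z (δ i k) (M k j)) ⟩
        ∑[ k < n ] (z * (δ i k * M k j))  ≈⟨ *-distribˡ-sum z (λ k → δ i k * M k j) ⟨
        z * ∑[ k < n ] (δ i k * M k j)    ≈⟨ *-congˡ (∑-δˡ i λ k → M k j) ⟩
        z * M i j ∎

      S-central : ∀ M → S ⊛ M ≋ M ⊛ S
      S-central M i j = begin
        (S ⊛ M) i j                       ≈⟨ S⊛ M i j ⟩
        z * M i j                         ≈⟨ *-comm z (M i j) ⟩
        M i j * z                         ≈⟨ *-congʳ (∑-δʳ j (M i)) ⟨
        ∑[ k < n ] (M i k * δ k j) * z    ≈⟨ *-distribʳ-sum z (λ k → M i k * δ k j) ⟩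
        ∑[ k < n ] (M i k * δ k j * z)
          ≈⟨ ∑-cong (λ k → trans (*-assoc (M i k) (δ k j) z) (*-congˡ (*-comm (δ k j) z))) ⟩
        (M ⊛ S) i j ∎

      BV≈0 : B ⊛ V ≋ M.0#
      BV≈0 i j = begin
        (B ⊛ V) i j                ≈⟨ MP.[y-z]x≈yx-zx V A S i j ⟩
        (A ⊛ V) i j - (S ⊛ V) i j  ≈⟨ +-cong (Ax≈zx i) (-‿cong (S⊛ V i j)) ⟩
        z * x i - z * x i          ≈⟨ -‿inverseʳ _ ⟩
        0# ∎

      module _ (I : PseudoInverse B) where

        open PseudoInverse I renaming (inv to X)

        P : Mat n n
        P = δ M.- X ⊛ B

        φ : Fin n → Carrier
        φ = twistedTrace P

        open Weighted _≼_ _≼?_ ≼-refl ≼-trans φ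

        -- `P` fixes the kernel of `B`, and the eigenvector lies in it.
        P≉0 : ¬ P ≋ M.0#
        P≉0 P≋0 = x≉0 λ i → begin
          V i i            ≈⟨ b*v≈0⇒p*v≈v {B} {X} BXB≋B {V} BV≈0 i i ⟨
          (P ⊛ V) i i      ≈⟨ M.*-congʳ {V} P≋0 i i ⟩
          (M.0# ⊛ V) i i   ≈⟨ M.zeroˡ V i i ⟩
          0# ∎

        module _ (g : Fin n) where

          size≢0 : ℚΣ.sum (down g) ≢ 0ℚ
          size≢0 = ∑≢0 (down g) (λ h → indicator-nonNeg (h ≼? g)) g (indicator-yes (g ≼? g) ≼-refl)

          s : ℚ
          s = proj₁ (inverse _ size≢0)

          -- The uniform distribution on the subgroup below `g`; `Λ u` is the averaging idempotent
          -- of that subgroup.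
          u : Fin n → Carrier
          u h = ι (s ℚ.* down g h)

          ∑u≈1 : sum u ≈ 1#
          ∑u≈1 = begin
            sum u                                ≈⟨ ι-∑ (λ h → s ℚ.* down g h) ⟨
            ι (ℚΣ.sum λ h → s ℚ.* down g h)      ≈⟨ ⟦⟧-cong (≡.sym (ℚΣ.*-distribˡ-sum s (down g))) ⟩
            ι (s ℚ.* ℚΣ.sum (down g))            ≈⟨ ⟦⟧-cong (proj₂ (inverse _ size≢0)) ⟩
            ι 1ℚ                                 ≈⟨ ι-1 ⟩
            1# ∎

          -- For `a` in the subgroup, a⁻¹ y lies in it exactly when y does; for any other `a` both
          -- sides are zero.
          u-subgroup : ∀ a y → u a * u ((a ⁻¹) ∙ y) ≈ u a * u y
          u-subgroup a y with a ≼? g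
          ... | yes a≼g = *-congˡ (⟦⟧-cong (cong (s ℚ.*_) (indicator-cong (((a ⁻¹) ∙ y) ≼? g) (y ≼? g)
                  (λ q → subst (_≼ g) (GP.\\-leftDividesˡ a y) (∙-≼ a≼g q))
                  (∙-≼ (⁻¹-≼ a≼g)))))
          ... | no  _   = trans (*-congʳ s0≈0) (trans (zeroˡ _) (sym (trans (*-congʳ s0≈0) (zeroˡ _))))
            where
            s0≈0 : ι (s ℚ.* 0ℚ) ≈ 0#
            s0≈0 = trans (⟦⟧-cong (ℚ.*-zeroʳ s)) ι-0

          Λu-commutes : B ⊛ Λ u ≋ Λ u ⊛ B
          Λu-commutes = commute-- {A} {S} {Λ u}
            (Λ-central {ι ∘ f} (λ a b → ⟦⟧-cong (f-class a b)) u) (S-central (Λ u))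

          down-rational : ¬ ¬ IsRational (∑φ (down g))
          down-rational =
            idempotent-trace (Λ u ⊛ P) (m*p-idempotent {B} {X} BXB≋B {Λ u} Λu-commutes
              (Λ-idempotent u-subgroup ∑u≈1)) >>= λ (r , tr≈r , _) →
            return (rational-≈ (begin
              ∑φ (down g)
                ≈⟨ ι-cancel (≡.trans (ℚ.*-comm _ s) (proj₂ (inverse _ size≢0))) _ ⟨
              ι (ℚΣ.sum (down g)) * (ι s * ∑φ (down g))
                ≈⟨ *-congˡ (*-distribˡ-sum (ι s) λ h → ι (down g h) * φ h) ⟩
              ι (ℚΣ.sum (down g)) * ∑[ h < n ] (ι s * (ι (down g h) * φ h))
                ≈⟨ *-congˡ (∑-cong λ h → trans (sym (*-assoc _ _ _)) (*-congʳ (sym (ι-* s (down g h))))) ⟩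
              ι (ℚΣ.sum (down g)) * ∑[ h < n ] (u h * φ h)
                ≈⟨ *-congˡ (trans (sym (tr-Λ u P)) tr≈r) ⟩
              ι (ℚΣ.sum (down g)) * (r · 1#) ∎)
              (rational-* (_ , refl) (_ , ι-· r)))

        z-rational : ¬ ¬ IsRational z
        z-rational =
          ¬¬-∀Fin down-rational >>= λ dr →
          idempotent-trace P (p-idempotent {B} {X} BXB≋B) >>= λ (r , trP≈r , r≡0⇒) →
          return (conclude dr r trP≈r (P≉0 ∘ r≡0⇒))
          where
          AP≋SP : A ⊛ P ≋ S ⊛ P
          AP≋SP i j = x∙y⁻¹≈ε⇒x≈y _ _
            (trans (sym (MP.[y-z]x≈yx-zx P A S i j)) (b*p≈0 {B} {X} BXB≋B i j))

          z*trP : ∑φ f ≈ z * tr P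
          z*trP = begin
            ∑φ f                     ≈⟨ tr-Λ (ι ∘ f) P ⟨
            tr (A ⊛ P)               ≈⟨ tr-cong AP≋SP ⟩
            tr (S ⊛ P)               ≈⟨ ∑-cong (λ i → S⊛ P i i) ⟩
            ∑[ i < n ] (z * P i i)   ≈⟨ *-distribˡ-sum z (λ i → P i i) ⟨
            z * tr P ∎

          conclude : (∀ g → IsRational (∑φ (down g))) → ∀ r → tr P ≈ r · 1# → r ≢ 0 → IsRational z
          conclude dr r trP≈r r≢0 = rational-≈ (begin
            z                              ≈⟨ ι-cancel (proj₂ 1/r) z ⟨
            ι (proj₁ 1/r) * (ι ((+ r) /1) * z)
              ≈⟨ *-congˡ (*-congʳ (trans trP≈r (ι-· r))) ⟨
            ι (proj₁ 1/r) * (tr P * z)     ≈⟨ *-congˡ (trans (*-comm _ _) (sym z*trP)) ⟩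
            ι (proj₁ 1/r) * ∑φ f           ∎)
            (rational-* (_ , refl) (invariant-rational dr f-invariant))
            where
            1/r : ∃ λ p → p ℚ.* (+ r) /1 ≡ 1ℚ
            1/r = inverse ((+ r) /1) (r≢0 ∘ ℤ.+-injective ∘ /1-injective)

    eigenvalue-rational : ¬ ¬ IsRational z
    eigenvalue-rational = pseudoInverse B >>= z-rational

  -- Descending kernel vectors to ℚ

  module _ {n : ℕ} where

    private
      module Mℚ = Matrices ℚ.+-*-commutativeRing
      module MℚR = Ring (Mℚ.matrixRing n)

    ι-⊛ : ∀ (M N : Mℚ.Mat n n) i k →
          ι ((M Mℚ.⊛ N) i k) ≈ ∑[ j < n ] (ι (M i j) * ι (N j k))
    ι-⊛ M N i k = trans (ι-∑ λ j → M i j ℚ.* N j k) (∑-cong λ j → ι-* (M i j) (N j k))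

    ι-δ : ∀ {m} (i j : Fin m) → ι (Mℚ.δ i j) ≈ δ i j
    ι-δ zero    zero    = ι-1
    ι-δ zero    (suc _) = ι-0
    ι-δ (suc _) zero    = ι-0
    ι-δ (suc i) (suc j) = ι-δ i j

    zero-or-unitℚ : ∀ q → ¬ ¬ (q ≡ 0ℚ ⊎ ∃ λ p → q ℚ.* p ≡ 1ℚ)
    zero-or-unitℚ q with q ℚ.≟ 0ℚ
    ... | yes q≡0 = return (inj₁ q≡0)
    ... | no  q≢0 = return (inj₂ (proj₁ (inverse q q≢0) , ≡.trans (ℚ.*-comm q _) (proj₂ (inverse q q≢0))))

    -- If 1 - XB were 0 over ℚ, then x = XBx = 0 over K; otherwise a nonzero
    -- column of 1 - XB is the required vector.
    rational-kernel : ∀ (B : Mℚ.Mat n n) (x : Fin n → Carrier) → ¬ (∀ i → x i ≈ 0#) →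
                      (∀ i → ∑[ j < n ] (ι (B i j) * x j) ≈ 0#) →
                      ¬ ¬ ∃ λ (v : Fin n → ℚ) → (∃ λ i → v i ≢ 0ℚ) ×
                        (∀ i → ℚΣ.sum (λ j → B i j ℚ.* v j) ≡ 0ℚ)
    rational-kernel B x x≉0 Bx≈0 = pseudoInverse B >>= λ I →
      let open PseudoInverse I renaming (inv to X)
          P : Mℚ.Mat n n
          P = Mℚ.δ MℚR.- X Mℚ.⊛ B
      in return (column X (KernelProjector.b*p≈0 (Mℚ.matrixRing n) {B} {X} BXB≋B)
           (all-or-any λ j → all-or-any λ i → decide (P i j)))
      where
      open Mℚ.Elimination zero-or-unitℚ {n}

      decide : ∀ q → q ≡ 0ℚ ⊎ q ≢ 0ℚ
      decide q with q ℚ.≟ 0ℚ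
      ... | yes p = inj₁ p
      ... | no ¬p = inj₂ ¬p

      XB≢δ : ∀ X → ¬ (∀ j i → (Mℚ.δ MℚR.- X Mℚ.⊛ B) i j ≡ 0ℚ)
      XB≢δ X P≡0 = x≉0 λ i → begin
        x i                                       ≈⟨ ∑-δˡ i x ⟨
        ∑[ k < n ] (δ i k * x k)
          ≈⟨ ∑-cong (λ k → *-congʳ (trans (sym (ι-δ i k)) (trans
               (⟦⟧-cong (RingProperties.x∙y⁻¹≈ε⇒x≈y ℚ.+-*-ring _ _ (P≡0 k i))) (ι-⊛ X B i k)))) ⟩
        ∑[ k < n ] (∑[ j < n ] (ι (X i j) * ι (B j k)) * x k)
          -- The vector `x` is read as a matrix with one column.
          ≈⟨ ⊛-assoc (λ i j → ι (X i j)) (λ j k → ι (B j k)) (λ k (_ : Fin 1) → x k) i zero ⟩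
        ∑[ j < n ] (ι (X i j) * ∑[ k < n ] (ι (B j k) * x k))
          ≈⟨ ∑-zero (λ j → trans (*-congˡ (Bx≈0 j)) (zeroʳ _)) ⟩
        0# ∎

      column : ∀ X → B Mℚ.⊛ (Mℚ.δ MℚR.- X Mℚ.⊛ B) Mℚ.≋ MℚR.0# →
               (∀ j i → (Mℚ.δ MℚR.- X Mℚ.⊛ B) i j ≡ 0ℚ) ⊎ (∃ λ j → ∃ λ i → (Mℚ.δ MℚR.- X Mℚ.⊛ B) i j ≢ 0ℚ) →
               ∃ λ (v : Fin n → ℚ) → (∃ λ i → v i ≢ 0ℚ) × (∀ i → ℚΣ.sum (λ j → B i j ℚ.* v j) ≡ 0ℚ)
      column X BP≡0 (inj₁ P≡0)         = contradiction P≡0 (XB≢δ X)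
      column X BP≡0 (inj₂ (j , i , p)) = (λ i → (Mℚ.δ MℚR.- X Mℚ.⊛ B) i j) , (i , p) , λ i → BP≡0 i j

-- Rational eigenvalues of integer matrices

module ℤΣ = SemiringSum (CommutativeRing.semiring ℤ.+-*-commutativeRing)

/1-∑ : ∀ {n} (f : Fin n → ℤ) → ℤΣ.sum f /1 ≡ ℚΣ.sum (λ i → f i /1)
/1-∑ {zero}  f = ≡.refl
/1-∑ {suc n} f = ≡.trans (/1-+ (f zero) _) (cong (f zero /1 ℚ.+_) (/1-∑ (f ∘ suc)))

↧q*q≡↥q : ∀ q → (↧ q) /1 ℚ.* q ≡ (↥ q) /1
-- Matching on the record lets `ℚ.toℚᵘ q` unfold to numerator over denominator.
↧q*q≡↥q q@record{} = ℚ.toℚᵘ-injective (begin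
  ℚ.toℚᵘ ((↧ q) /1 ℚ.* q)                ≈⟨ ℚ.toℚᵘ-homo-* ((↧ q) /1) q ⟩
  ℚ.toℚᵘ ((↧ q) /1) ℚᵘ.* ℚ.toℚᵘ q        ≈⟨ ℚᵘ.*-congʳ (toℚᵘ-/1 (↧ q)) ⟩
  mkℚᵘ (↧ q) 0 ℚᵘ.* ℚ.toℚᵘ q             ≈⟨ *≡* (lemma (↧ q) (↥ q)) ⟩
  mkℚᵘ (↥ q) 0                           ≈⟨ toℚᵘ-/1 (↥ q) ⟨
  ℚ.toℚᵘ ((↥ q) /1)                      ∎)
  where
  open SetoidReasoning ℚᵘ.≃-setoid
  lemma : ∀ d n → d ℤ.* n ℤ.* 1ℤ ≡ n ℤ.* (1ℤ ℤ.* d)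
  lemma d n = ≡.trans (ℤ.*-identityʳ _) (≡.trans (ℤ.*-comm d n) (cong (n ℤ.*_) (≡.sym (ℤ.*-identityˡ d))))

clear-denominators : ∀ {n} (v : Fin n → ℚ) →
  ∃₂ λ D (y : Fin n → ℤ) → D ≢ 0ℤ × (∀ i → D /1 ℚ.* v i ≡ y i /1)
clear-denominators {zero}  v = 1ℤ , (λ ()) , (λ ()) , λ ()
clear-denominators {suc n} v with clear-denominators (v ∘ suc)
... | D , y , D≢0 , eq = D′ , y′ , D′≢0 , eq′
  where
  d = ↧ (v zero)
  D′ = d ℤ.* D

  y′ : Fin (suc n) → ℤ
  y′ zero    = D ℤ.* ↥ (v zero)
  y′ (suc i) = d ℤ.* y i

  D′≢0 : D′ ≢ 0ℤ
  D′≢0 D′≡0 with ℤ.i*j≡0⇒i≡0∨j≡0 d D′≡0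
  ... | inj₁ ()
  ... | inj₂ D≡0 = D≢0 D≡0

  open ≡.≡-Reasoning

  eq′ : ∀ i → D′ /1 ℚ.* v i ≡ y′ i /1
  eq′ zero    = begin
    (d ℤ.* D) /1 ℚ.* v zero        ≡⟨ cong (λ t → t /1 ℚ.* v zero) (ℤ.*-comm d D) ⟩
    (D ℤ.* d) /1 ℚ.* v zero        ≡⟨ cong (ℚ._* v zero) (/1-* D d) ⟩
    D /1 ℚ.* d /1 ℚ.* v zero       ≡⟨ ℚ.*-assoc (D /1) (d /1) (v zero) ⟩
    D /1 ℚ.* (d /1 ℚ.* v zero)     ≡⟨ cong (D /1 ℚ.*_) (↧q*q≡↥q (v zero)) ⟩
    D /1 ℚ.* (↥ v zero) /1         ≡⟨ /1-* D (↥ v zero) ⟨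
    (D ℤ.* ↥ v zero) /1            ∎
  eq′ (suc i) = begin
    (d ℤ.* D) /1 ℚ.* v (suc i)     ≡⟨ cong (ℚ._* v (suc i)) (/1-* d D) ⟩
    d /1 ℚ.* D /1 ℚ.* v (suc i)    ≡⟨ ℚ.*-assoc (d /1) (D /1) (v (suc i)) ⟩
    d /1 ℚ.* (D /1 ℚ.* v (suc i))  ≡⟨ cong (d /1 ℚ.*_) (eq i) ⟩
    d /1 ℚ.* y i /1                ≡⟨ /1-* d (y i) ⟨
    (d ℤ.* y i) /1                 ∎

-- If a/b in lowest terms with b ≥ 2 were an eigenvalue of an integer matrix,
-- an integer eigenvector could be divided by b indefinitely.
module Descent {n} (A : Fin n → Fin n → ℤ) (a b : ℤ) (1<∣b∣ : 1 ℕ.< ℤ.∣ b ∣)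
  (coprime : ℤ.Coprime b a) where

  Eigenvector : (Fin n → ℤ) → Set
  Eigenvector y = ∀ i → b ℤ.* ℤΣ.sum (λ j → A i j ℤ.* y j) ≡ a ℤ.* y i

  -- The equation shows that b divides a y(i), hence y(i) by coprimality; being linear, it is
  -- inherited by the quotient.
  divide : ∀ y → Eigenvector y → ∃ λ y′ → Eigenvector y′ × (∀ i → y i ≡ b ℤ.* y′ i)
  divide y eig = y′ , eig′ , y≡by′
    where
    b∣y : ∀ i → b ℤS.∣ y i
    b∣y i = ℤS.∣ᵤ⇒∣ (ℤ.coprime-divisor b a (y i) coprime
      (ℤS.∣⇒∣ᵤ {b} {a ℤ.* y i} (ℤS.divides (ℤΣ.sum λ j → A i j ℤ.* y j)
        (≡.trans (≡.sym (eig i)) (ℤ.*-comm b (ℤΣ.sum λ j → A i j ℤ.* y j))))))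

    y′ : Fin n → ℤ
    y′ i = ℤS._∣_.quotient (b∣y i)

    y≡by′ : ∀ i → y i ≡ b ℤ.* y′ i
    y≡by′ i = ≡.trans (ℤS._∣_.equality (b∣y i)) (ℤ.*-comm (y′ i) b)

    open ≡.≡-Reasoning

    swap : ∀ i j k → i ℤ.* (j ℤ.* k) ≡ j ℤ.* (i ℤ.* k)
    swap = x∙yz≈y∙xz ℤ.*-commutativeSemigroup

    eig′ : Eigenvector y′
    eig′ i = ℤ.*-cancelˡ-≡ b _ _ {{ℕ.>-nonZero (ℕ.<-trans ℕ.z<s 1<∣b∣)}} (begin
      b ℤ.* (b ℤ.* ℤΣ.sum (λ j → A i j ℤ.* y′ j))
        ≡⟨ cong (b ℤ.*_) (ℤΣ.*-distribˡ-sum b (λ j → A i j ℤ.* y′ j)) ⟩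
      b ℤ.* ℤΣ.sum (λ j → b ℤ.* (A i j ℤ.* y′ j))
        ≡⟨ cong (b ℤ.*_) (ℤΣ.sum-cong-≗ λ j → ≡.trans (swap b (A i j) (y′ j))
             (cong (A i j ℤ.*_) (≡.sym (y≡by′ j)))) ⟩
      b ℤ.* ℤΣ.sum (λ j → A i j ℤ.* y j)   ≡⟨ eig i ⟩
      a ℤ.* y i                            ≡⟨ cong (a ℤ.*_) (y≡by′ i) ⟩
      a ℤ.* (b ℤ.* y′ i)                   ≡⟨ swap a b (y′ i) ⟩
      b ℤ.* (a ℤ.* y′ i)                   ∎)

  private

    -- As ∣b∣ is at least 2, dividing by b strictly lowers a nonzero absolute value, so the bound of
    -- the induction drops by one.
    halve : ∀ {m N} → ℤ.∣ b ∣ ℕ.* m ℕ.≤ suc N → m ℕ.≤ N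
    halve {zero}  _ = z≤n
    halve {suc m} p = ℕ.s≤s⁻¹ (ℕ.≤-trans (subst (suc m ℕ.<_) (ℕ.*-comm (suc m) ℤ.∣ b ∣) (ℕ.m<m*n (suc m) ℤ.∣ b ∣ 1<∣b∣)) p)

    bounded⇒0 : ∀ N y → Eigenvector y → ∀ i → ℤ.∣ y i ∣ ℕ.≤ N → y i ≡ 0ℤ
    bounded⇒0 zero    y eig i p = ℤ.∣i∣≡0⇒i≡0 (ℕ.n≤0⇒n≡0 p)
    bounded⇒0 (suc N) y eig i p with divide y eig
    ... | y′ , eig′ , y≡by′ = ≡.trans (y≡by′ i) (≡.trans (cong (b ℤ.*_)
      (bounded⇒0 N y′ eig′ i (halve (subst (ℕ._≤ suc N)
        (≡.trans (cong ℤ.∣_∣ (y≡by′ i)) (ℤ.abs-* b (y′ i))) p)))) (ℤ.*-zeroʳ b))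

  eigenvector≡0 : ∀ y → Eigenvector y → ∀ i → y i ≡ 0ℤ
  eigenvector≡0 y eig i = bounded⇒0 ℤ.∣ y i ∣ y eig i ℕ.≤-refl

rational-eigenvalue⇒integer : ∀ {n} (A : Fin n → Fin n → ℤ) q (v : Fin n → ℚ) → (∃ λ i → v i ≢ 0ℚ) →
  (∀ i → ℚΣ.sum (λ j → A i j /1 ℚ.* v j) ≡ q ℚ.* v i) → ∃ λ k → q ≡ k /1
-- `mkℚ` stores the denominator minus one: `zero` stands for denominator 1, and `suc b-2` for one of
-- at least 2, where descent applies.
rational-eigenvalue⇒integer A q@(mkℚ a zero c) v _ _ = a , ≡.sym (ℚ.↥p/↧p≡p q)
rational-eigenvalue⇒integer A q@(mkℚ a (suc b-2) c) v (i , vi≢0) Av≡qv with clear-denominators v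
... | D , y , D≢0 , Dv≡y = contradiction vi≡0 vi≢0
  where
  open ≡.≡-Reasoning
  -- The coprimality proof inside `mkℚ` is irrelevant, so it is recomputed by the decision
  -- procedure.
  open Descent A a (+ suc (suc b-2)) (ℕ.s<s ℕ.z<s) (ℕ.recompute (ℕ.sym c))

  b : ℤ
  b = ↧ q

  Av : ∀ i → ℚΣ.sum (λ j → A i j /1 ℚ.* y j /1) ≡ q ℚ.* y i /1
  Av i = begin
    ℚΣ.sum (λ j → A i j /1 ℚ.* y j /1)
      ≡⟨ ℚΣ.sum-cong-≗ (λ j → ≡.trans (cong (A i j /1 ℚ.*_) (≡.sym (Dv≡y j))) (swap (A i j /1) (D /1) (v j))) ⟩
    ℚΣ.sum (λ j → D /1 ℚ.* (A i j /1 ℚ.* v j))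
      ≡⟨ ℚΣ.*-distribˡ-sum (D /1) (λ j → A i j /1 ℚ.* v j) ⟨
    D /1 ℚ.* ℚΣ.sum (λ j → A i j /1 ℚ.* v j)
      ≡⟨ cong (D /1 ℚ.*_) (Av≡qv i) ⟩
    D /1 ℚ.* (q ℚ.* v i)    ≡⟨ swap (D /1) q (v i) ⟩
    q ℚ.* (D /1 ℚ.* v i)    ≡⟨ cong (q ℚ.*_) (Dv≡y i) ⟩
    q ℚ.* y i /1 ∎
    where
    swap : ∀ p q r → p ℚ.* (q ℚ.* r) ≡ q ℚ.* (p ℚ.* r)
    swap = x∙yz≈y∙xz (CommutativeRing.*-commutativeSemigroup ℚ.+-*-commutativeRing)

  eig : Eigenvector y
  eig i = /1-injective (begin
    (b ℤ.* ℤΣ.sum (λ j → A i j ℤ.* y j)) /1           ≡⟨ /1-* b (ℤΣ.sum λ j → A i j ℤ.* y j) ⟩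
    b /1 ℚ.* ℤΣ.sum (λ j → A i j ℤ.* y j) /1
      ≡⟨ cong (b /1 ℚ.*_) (≡.trans (/1-∑ λ j → A i j ℤ.* y j)
           (≡.trans (ℚΣ.sum-cong-≗ λ j → /1-* (A i j) (y j)) (Av i))) ⟩
    b /1 ℚ.* (q ℚ.* y i /1)                           ≡⟨ ℚ.*-assoc (b /1) q (y i /1) ⟨
    b /1 ℚ.* q ℚ.* y i /1                             ≡⟨ cong (ℚ._* y i /1) (↧q*q≡↥q q) ⟩
    a /1 ℚ.* y i /1                                   ≡⟨ /1-* a (y i) ⟨
    (a ℤ.* y i) /1                                    ∎)

  D/1≢0 : D /1 ≢ 0ℚ
  D/1≢0 p = D≢0 (/1-injective p)

  vi≡0 : v i ≡ 0ℚ
  vi≡0 = begin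
    v i                          ≡⟨ ℚ.*-identityˡ (v i) ⟨
    1ℚ ℚ.* v i                   ≡⟨ cong (ℚ._* v i) (proj₂ (inverse (D /1) D/1≢0)) ⟨
    1/D ℚ.* D /1 ℚ.* v i         ≡⟨ ℚ.*-assoc 1/D (D /1) (v i) ⟩
    1/D ℚ.* (D /1 ℚ.* v i)       ≡⟨ cong (1/D ℚ.*_) (≡.trans (Dv≡y i) (cong _/1 (eigenvector≡0 y eig i))) ⟩
    1/D ℚ.* 0ℚ                   ≡⟨ ℚ.*-zeroʳ 1/D ⟩
    0ℚ                           ∎
    where
    1/D : ℚ
    1/D = proj₁ (inverse (D /1) D/1≢0)

-- Integrality over an abstract field

module Integrality {c ℓ} (K : CommutativeRing c ℓ)
  (zero-or-unit : ∀ x → ¬ ¬ (CommutativeRing._≈_ K x (CommutativeRing.0# K) ⊎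
    ∃ λ y → CommutativeRing._≈_ K (CommutativeRing._*_ K x y) (CommutativeRing.1# K)))
  (ι : ℚ → CommutativeRing.Carrier K)
  (ι-hom : RingMorphisms.IsRingHomomorphism ℚ.+-*-rawRing (CommutativeRing.rawRing K) ι)
  where

  open CommutativeRing K hiding (zero)
  open RingProperties ring using (x≈y⇒x∙y⁻¹≈ε)
  open SemiringSum semiring
  open Matrices K
  open RationalElements K ι ι-hom
  open Rationality K zero-or-unit ι ι-hom
  open SetoidReasoning setoid

  private
    module Mℚ = Matrices ℚ.+-*-commutativeRing

  -- The eigenvector lives over `K`, whereas descent wants rational entries; the kernel of A - q
  -- over ℚ provides such a vector.
  rational⇒integer : ∀ {n} (A : Fin n → Fin n → ℤ) z (x : Fin n → Carrier) → ¬ (∀ i → x i ≈ 0#) →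
    (∀ i → ∑[ j < n ] (ι (A i j /1) * x j) ≈ z * x i) →
    IsRational z → ¬ ¬ ∃ λ k → z ≈ ι (k /1)
  rational⇒integer {n} A z x x≉0 Ax≈zx (q , z≈q) =
    rational-kernel B x x≉0 Bx≈0 >>= λ (v , v≢0 , Bv≡0) →
    let (k , q≡k) = rational-eigenvalue⇒integer A q v v≢0 (λ i →
          RingProperties.x∙y⁻¹≈ε⇒x≈y ℚ.+-*-ring _ _
            (≡.trans (≡.sym (Mℚ.∑-shift q (λ j → A i j /1) v i)) (Bv≡0 i)))
    in return (k , trans z≈q (⟦⟧-cong q≡k))
    where
    B : Mℚ.Mat n n
    B i j = A i j /1 ℚ.- q ℚ.* Mℚ.δ i j

    Bx≈0 : ∀ i → ∑[ j < n ] (ι (B i j) * x j) ≈ 0#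
    Bx≈0 i = begin
      ∑[ j < n ] (ι (B i j) * x j)
        ≈⟨ ∑-cong (λ j → *-congʳ (trans (ι-+ _ _) (+-congˡ (trans (ι-neg _)
             (-‿cong (trans (ι-* q _) (*-cong (sym z≈q) (ι-δ {n} i j)))))))) ⟩
      ∑[ j < n ] ((ι (A i j /1) - z * δ i j) * x j)    ≈⟨ ∑-shift z (λ j → ι (A i j /1)) x i ⟩
      ∑[ j < n ] (ι (A i j /1) * x j) - z * x i        ≈⟨ x≈y⇒x∙y⁻¹≈ε (Ax≈zx i) ⟩
      0# ∎

  module _ {n : ℕ} (_∙_ : Op₂ (Fin n)) (ε : Fin n) (_⁻¹ : Op₁ (Fin n))
    (isGroup : IsGroup _≡_ _∙_ ε _⁻¹)
    {p} (_≼_ : Rel (Fin n) p) (_≼?_ : Decidable _≼_)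
    (≼-refl : Reflexive _≼_) (≼-trans : Transitive _≼_)
    (∙-≼ : ∀ {g h k} → h ≼ g → k ≼ g → (h ∙ k) ≼ g)
    (⁻¹-≼ : ∀ {g h} → h ≼ g → (h ⁻¹) ≼ g)
    (f : Fin n → ℤ) (f-class : ∀ x y → f (x ∙ y) ≡ f (y ∙ x))
    (f-invariant : ∀ {g h} → g ≼ h → h ≼ g → f g ≡ f h)
    (A : Fin n → Fin n → ℤ) (A≡f : ∀ i j → A i j ≡ f (i ∙ (j ⁻¹)))
    (κ : ℤ → Carrier) (κ≈ι : ∀ k → κ k ≈ ι (k /1))
    (z : Carrier) (x : Fin n → Carrier) (x≉0 : ¬ (∀ i → x i ≈ 0#))
    (Ax≈zx : ∀ i → ∑[ j < n ] (κ (A i j) * x j) ≈ z * x i)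
    where

    private
      fx≈zx : ∀ i → ∑[ j < n ] (ι (f (i ∙ (j ⁻¹)) /1) * x j) ≈ z * x i
      fx≈zx i = trans (∑-cong λ j → *-congʳ
        (trans (reflexive (cong (λ k → ι (k /1)) (≡.sym (A≡f i j)))) (sym (κ≈ι (A i j))))) (Ax≈zx i)

    eigenvalue-integer : ¬ ¬ ∃ λ k → z ≈ κ k
    eigenvalue-integer =
      eigenvalue-rational _∙_ ε _⁻¹ isGroup _≼_ _≼?_ ≼-refl ≼-trans ∙-≼ ⁻¹-≼ (_/1 ∘ f)
        (λ a b → cong _/1 (f-class a b)) (λ p q → cong _/1 (f-invariant p q)) z x x≉0 fx≈zx >>= λ z-rational →
      rational⇒integer (λ i j → f (i ∙ (j ⁻¹))) z x x≉0 fx≈zx z-rational >>= λ (k , z≈k) →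
      return (k , trans z≈k (sym (κ≈ι k)))

open ℚ-Solver using (solve; _:=_; _:+_; _:*_; _:-_; :-_; con)

-- Complex numbers

-- The positive form of being nonzero: a uniform lower bound, as inversion requires.
IsApart : (ℕ → ℚ) → Set
IsApart s = ∃[ ε ] (Positive ε × ∃[ N ] (∀ n → N ℕ.≤ n → ε ℚ.≤ ∣ s n ∣))

p≤∣p∣ : ∀ p → p ℚ.≤ ∣ p ∣
p≤∣p∣ p with ℚ.∣p∣≡p∨∣p∣≡-p p
... | inj₁ eq = ℚ.≤-reflexive (≡.sym eq)
... | inj₂ eq = ℚ.≤-trans (subst (ℚ._≤ 0ℚ) (neg-neg p) (ℚ.neg-antimono-≤ (subst (0ℚ ℚ.≤_) eq (ℚ.0≤∣p∣ p))))
                          (ℚ.0≤∣p∣ p)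
  where
  neg-neg : ∀ p → ℚ.- (ℚ.- p) ≡ p
  neg-neg = solve 1 (λ p → :- (:- p) := p) ≡.refl

∣p∣≤ : ∀ {p c} → p ℚ.≤ c → ℚ.- p ℚ.≤ c → ∣ p ∣ ℚ.≤ c
∣p∣≤ {p} {c} p≤c -p≤c with ℚ.∣p∣≡p∨∣p∣≡-p p
... | inj₁ eq = subst (ℚ._≤ c) (≡.sym eq) p≤c
... | inj₂ eq = subst (ℚ._≤ c) (≡.sym eq) -p≤c

∣p-r∣≤ : ∀ {p q r a b} → ∣ p ℚ.- q ∣ ℚ.≤ a → ∣ q ℚ.- r ∣ ℚ.≤ b → ∣ p ℚ.- r ∣ ℚ.≤ a ℚ.+ b
∣p-r∣≤ {p} {q} {r} {a} {b} pq qr = subst (λ t → ∣ t ∣ ℚ.≤ a ℚ.+ b) (eq p q r)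
  (ℚ.≤-trans (ℚ.∣p+q∣≤∣p∣+∣q∣ (p ℚ.- q) (q ℚ.- r)) (ℚ.+-mono-≤ pq qr))
  where
  eq : ∀ p q r → (p ℚ.- q) ℚ.+ (q ℚ.- r) ≡ p ℚ.- r
  eq = solve 3 (λ p q r → (p :- q) :+ (q :- r) := p :- r) ≡.refl

∣p∣≤∣q∣+ : ∀ {p q a} → ∣ p ℚ.- q ∣ ℚ.≤ a → ∣ p ∣ ℚ.≤ ∣ q ∣ ℚ.+ a
∣p∣≤∣q∣+ {p} {q} {a} pq = subst (λ t → ∣ t ∣ ℚ.≤ ∣ q ∣ ℚ.+ a) (eq p q)
  (ℚ.≤-trans (ℚ.∣p+q∣≤∣p∣+∣q∣ q (p ℚ.- q)) (ℚ.+-monoʳ-≤ ∣ q ∣ pq))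
  where
  eq : ∀ p q → q ℚ.+ (p ℚ.- q) ≡ p
  eq = solve 2 (λ p q → q :+ (p :- q) := p) ≡.refl

quarter : ℚ → ℚ
quarter ε = ε ℚ.* (½ ℚ.* ½)

quarter-pos : ∀ ε .{{_ : Positive ε}} → Positive (quarter ε)
quarter-pos ε = ℚ.pos*pos⇒pos ε (½ ℚ.* ½)

4*quarter : ∀ ε → (quarter ε ℚ.+ quarter ε ℚ.+ quarter ε) ℚ.+ quarter ε ≡ ε
4*quarter = solve 1 (λ ε → (ε :* con (½ ℚ.* ½) :+ ε :* con (½ ℚ.* ½) :+ ε :* con (½ ℚ.* ½))
  :+ ε :* con (½ ℚ.* ½) := ε) ≡.refl

≤-+pos : ∀ p q .{{_ : Positive q}} → p ℚ.≤ p ℚ.+ q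
≤-+pos p q = subst (ℚ._≤ p ℚ.+ q) (ℚ.+-identityʳ p) (ℚ.+-monoʳ-≤ p (ℚ.<⇒≤ (ℚ.positive⁻¹ q)))

-- One rational comparison decides, with terms past `N` within ε/4 of each other. If ∣s(N)∣ exceeds
-- ε/2, later terms stay above ε/4 and the sequence is apart; otherwise they stay below 3ε/4.
¬apart⇒null : ∀ {s} → IsCauchy s → ¬ IsApart s → IsNull s
¬apart⇒null {s} cs ¬apart ε with cs (quarter ε) {{quarter-pos ε}}
... | N , close with ∣ s N ∣ ℚ.≤? quarter ε ℚ.+ quarter ε
...   | no  ≰ = contradiction (quarter ε , quarter-pos ε , N , λ n N≤n →
          ℚ.≮⇒≥ λ sn< → ≰ (ℚ.≤-trans (∣p∣≤∣q∣+ (close N n ℕ.≤-refl N≤n))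
            (ℚ.+-monoˡ-≤ (quarter ε) (ℚ.<⇒≤ sn<)))) ¬apart
...   | yes ≤ = N , λ n N≤n → ℚ.≤-trans (∣p∣≤∣q∣+ (close n N N≤n ℕ.≤-refl))
          (ℚ.≤-trans (ℚ.+-monoˡ-≤ (quarter ε) ≤)
            (subst (quarter ε ℚ.+ quarter ε ℚ.+ quarter ε ℚ.≤_) (4*quarter ε)
              (≤-+pos _ (quarter ε) {{quarter-pos ε}})))

apart⇒¬null : ∀ {s} → IsApart s → ¬ IsNull s
apart⇒¬null {s} (ε , ε-pos , N , ε≤) null = contradict (null (quarter ε) {{quarter-pos ε {{ε-pos}}}})
  where
  instance
    _ : Positive ε
    _ = ε-pos
    _ : Positive (quarter ε)
    _ = quarter-pos ε

  contradict : ¬ (∃[ M ] (∀ n → M ℕ.≤ n → ∣ s n ∣ ℚ.≤ quarter ε))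
  contradict (M , small) = ℚ.<-irrefl ≡.refl (ℚ.<-≤-trans quarter<ε
    (ℚ.≤-trans (ε≤ (M ℕ.⊔ N) (ℕ.m≤n⊔m M N)) (small (M ℕ.⊔ N) (ℕ.m≤m⊔n M N))))
    where
    quarter<ε : quarter ε ℚ.< ε
    quarter<ε = subst₂ ℚ._<_ (ℚ.+-identityˡ (quarter ε)) (4*quarter ε)
      (ℚ.+-monoˡ-< (quarter ε) (ℚ.positive⁻¹ (quarter ε ℚ.+ quarter ε ℚ.+ quarter ε)
        {{ℚ.pos+pos⇒pos (quarter ε ℚ.+ quarter ε) {{ℚ.pos+pos⇒pos (quarter ε) (quarter ε)}} (quarter ε)}}))

-- For a Cauchy sequence, being null amounts to not being apart, a negative statement.
null-stable : ∀ {s} → IsCauchy s → ¬ ¬ IsNull s → IsNull s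
null-stable cs ¬¬null = ¬apart⇒null cs λ apart → ¬¬null (apart⇒¬null apart)

≈ʳ-stable : ∀ x y → ¬ ¬ (x ≈ʳ y) → x ≈ʳ y
≈ʳ-stable x y = null-stable (cauchy (x +ʳ -ʳ y))

≈ᶜ-stable : ∀ z w → ¬ ¬ (z ≈ᶜ w) → z ≈ᶜ w
≈ᶜ-stable z w p =
  ≈ʳ-stable (re z) (re w) (λ k → p (k ∘ proj₁)) , ≈ʳ-stable (im z) (im w) (λ k → p (k ∘ proj₂))

≗⇒≈ʳ : ∀ {x y} → (∀ n → seq x n ≡ seq y n) → x ≈ʳ y
≗⇒≈ʳ {x} {y} eq ε = 0 , λ n _ → subst (λ t → ∣ t ∣ ℚ.≤ ε)
  (≡.trans (≡.sym (ℚ.+-inverseʳ (seq y n))) (cong (ℚ._- seq y n) (≡.sym (eq n)))) (ℚ.<⇒≤ (ℚ.positive⁻¹ ε))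

-- Reciprocals and the field property of ℂ

module Reciprocal (x : ℝ) (apart : IsApart (seq x)) where

  private
    ε : ℚ
    ε = proj₁ apart

    instance
      ε-pos : Positive ε
      ε-pos = proj₁ (proj₂ apart)

    N : ℕ
    N = proj₁ (proj₂ (proj₂ apart))

    ε≤ : ∀ n → N ℕ.≤ n → ε ℚ.≤ ∣ seq x n ∣
    ε≤ = proj₂ (proj₂ (proj₂ apart))

    E : ℚ
    E = (ℚ.1/ ε) {{ℚ.pos⇒nonZero ε}}

    instance
      E-pos : Positive E
      E-pos = ℚ.1/pos⇒pos ε

    εE : ε ℚ.* E ≡ 1ℚ
    εE = ℚ.*-inverseʳ ε {{ℚ.pos⇒nonZero ε}}

    inv : ℚ → ℚ
    inv q with q ℚ.≟ 0ℚ
    -- A default value: only terms before `N` can be zero, and they do not affect the limit.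
    ... | yes _   = 0ℚ
    ... | no  q≢0 = proj₁ (inverse q q≢0)

    inv-* : ∀ q → ε ℚ.≤ ∣ q ∣ → inv q ℚ.* q ≡ 1ℚ
    inv-* q ε≤q with q ℚ.≟ 0ℚ
    ... | no  q≢0    = proj₂ (inverse q q≢0)
    ... | yes ≡.refl = contradiction (ℚ.<-≤-trans (ℚ.positive⁻¹ ε) ε≤q) (ℚ.<-irrefl ≡.refl)

    ∣inv∣≤E : ∀ q → ε ℚ.≤ ∣ q ∣ → ∣ inv q ∣ ℚ.≤ E
    ∣inv∣≤E q ε≤q = subst₂ ℚ._≤_ lhs rhs
      (ℚ.*-monoʳ-≤-nonNeg E {{ℚ.pos⇒nonNeg E}} (ℚ.*-monoˡ-≤-nonNeg ∣ inv q ∣ {{ℚ.∣-∣-nonNeg (inv q)}} ε≤q))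
      where
      lhs : ∣ inv q ∣ ℚ.* ε ℚ.* E ≡ ∣ inv q ∣
      lhs = ≡.trans (ℚ.*-assoc ∣ inv q ∣ ε E) (≡.trans (cong (∣ inv q ∣ ℚ.*_) εE) (ℚ.*-identityʳ ∣ inv q ∣))

      rhs : ∣ inv q ∣ ℚ.* ∣ q ∣ ℚ.* E ≡ E
      rhs = ≡.trans (cong (ℚ._* E) (≡.trans (≡.sym (ℚ.∣p*q∣≡∣p∣*∣q∣ (inv q) q)) (cong ∣_∣ (inv-* q ε≤q))))
                    (ℚ.*-identityˡ E)

    inv-- : ∀ p q → ε ℚ.≤ ∣ p ∣ → ε ℚ.≤ ∣ q ∣ → inv p ℚ.- inv q ≡ inv p ℚ.* inv q ℚ.* (q ℚ.- p)
    inv-- p q ε≤p ε≤q = begin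
      inv p ℚ.- inv q    ≡⟨ cong₂ ℚ._-_ (ℚ.*-identityʳ (inv p)) (ℚ.*-identityʳ (inv q)) ⟨
      inv p ℚ.* 1ℚ ℚ.- inv q ℚ.* 1ℚ
        ≡⟨ cong₂ (λ s t → inv p ℚ.* s ℚ.- inv q ℚ.* t) (inv-* q ε≤q) (inv-* p ε≤p) ⟨
      inv p ℚ.* (inv q ℚ.* q) ℚ.- inv q ℚ.* (inv p ℚ.* p)
        ≡⟨ solve 4 (λ i j p q → i :* (j :* q) :- j :* (i :* p) := i :* j :* (q :- p)) ≡.refl (inv p) (inv q) p q ⟩
      inv p ℚ.* inv q ℚ.* (q ℚ.- p) ∎
      where open ≡.≡-Reasoning

    inv-cauchy : IsCauchy (λ n → inv (seq x n))
    -- 1/p - 1/q = (q - p)/(p q), and both reciprocals are at most E = 1/ε in absolute value, so ∣p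
    -- - q∣ up to η ε² is allowed.
    inv-cauchy η = bound (cauchy x (η ℚ.* (ε ℚ.* ε)) {{δ-pos}})
      where
      δ-pos : Positive (η ℚ.* (ε ℚ.* ε))
      δ-pos = ℚ.pos*pos⇒pos η (ε ℚ.* ε) {{ℚ.pos*pos⇒pos ε ε}}

      bound : ∃[ M ] (∀ m n → M ℕ.≤ m → M ℕ.≤ n → ∣ seq x m ℚ.- seq x n ∣ ℚ.≤ η ℚ.* (ε ℚ.* ε)) →
              ∃[ M ] (∀ m n → M ℕ.≤ m → M ℕ.≤ n → ∣ inv (seq x m) ℚ.- inv (seq x n) ∣ ℚ.≤ η)
      bound (M , close) = M ℕ.⊔ N , λ m n p q →
        let εm = ε≤ m (ℕ.m⊔n≤o⇒n≤o M N p)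
            εn = ε≤ n (ℕ.m⊔n≤o⇒n≤o M N q)
            i = inv (seq x m)
            j = inv (seq x n)
            d = seq x n ℚ.- seq x m
        in begin
          ∣ i ℚ.- j ∣                          ≡⟨ cong ∣_∣ (inv-- (seq x m) (seq x n) εm εn) ⟩
          ∣ i ℚ.* j ℚ.* d ∣                    ≡⟨ ℚ.∣p*q∣≡∣p∣*∣q∣ (i ℚ.* j) d ⟩
          ∣ i ℚ.* j ∣ ℚ.* ∣ d ∣                ≡⟨ cong (ℚ._* ∣ d ∣) (ℚ.∣p*q∣≡∣p∣*∣q∣ i j) ⟩
          ∣ i ∣ ℚ.* ∣ j ∣ ℚ.* ∣ d ∣            ≤⟨ ℚ.*-monoʳ-≤-nonNeg ∣ d ∣ {{ℚ.∣-∣-nonNeg d}}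
                                                   (ℚ.*-monoʳ-≤-nonNeg ∣ j ∣ {{ℚ.∣-∣-nonNeg j}} (∣inv∣≤E (seq x m) εm)) ⟩
          E ℚ.* ∣ j ∣ ℚ.* ∣ d ∣                ≤⟨ ℚ.*-monoʳ-≤-nonNeg ∣ d ∣ {{ℚ.∣-∣-nonNeg d}}
                                                   (ℚ.*-monoˡ-≤-nonNeg E {{ℚ.pos⇒nonNeg E}} (∣inv∣≤E (seq x n) εn)) ⟩
          E ℚ.* E ℚ.* ∣ d ∣                    ≤⟨ ℚ.*-monoˡ-≤-nonNeg (E ℚ.* E) {{ℚ.pos⇒nonNeg (E ℚ.* E) {{ℚ.pos*pos⇒pos E E}}}}
                                                   (close n m (ℕ.m⊔n≤o⇒m≤o M N q) (ℕ.m⊔n≤o⇒m≤o M N p)) ⟩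
          E ℚ.* E ℚ.* (η ℚ.* (ε ℚ.* ε))        ≡⟨ solve 3 (λ E η ε → E :* E :* (η :* (ε :* ε)) := η :* (ε :* E) :* (ε :* E)) ≡.refl E η ε ⟩
          η ℚ.* (ε ℚ.* E) ℚ.* (ε ℚ.* E)        ≡⟨ cong (λ t → η ℚ.* t ℚ.* t) εE ⟩
          η ℚ.* 1ℚ ℚ.* 1ℚ                      ≡⟨ ≡.trans (ℚ.*-identityʳ (η ℚ.* 1ℚ)) (ℚ.*-identityʳ η) ⟩
          η ∎
        where open ℚ.≤-Reasoning

  reciprocal : ℝ
  reciprocal = mkℝ (λ n → inv (seq x n)) inv-cauchy

  reciprocal-* : reciprocal *ʳ x ≈ʳ 1ʳ
  reciprocal-* δ = N , λ n N≤n → subst (λ t → ∣ t ∣ ℚ.≤ δ)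
    (≡.trans (≡.sym (ℚ.+-inverseʳ 1ℚ)) (cong (ℚ._- 1ℚ) (≡.sym (inv-* (seq x n) (ε≤ n N≤n)))))
    (ℚ.<⇒≤ (ℚ.positive⁻¹ δ))

module ℝR = CommutativeRing ℝ-commutativeRing
module ℂR = CommutativeRing ℂ-commutativeRing

square-nonNeg : ∀ q → 0ℚ ℚ.≤ q ℚ.* q
square-nonNeg q = subst (0ℚ ℚ.≤_) eq (ℚ.nonNegative⁻¹ (∣ q ∣ ℚ.* ∣ q ∣)
  {{ℚ.nonNeg*nonNeg⇒nonNeg (∣ q ∣) {{ℚ.∣-∣-nonNeg q}} (∣ q ∣) {{ℚ.∣-∣-nonNeg q}}}})
  where
  eq : ∣ q ∣ ℚ.* ∣ q ∣ ≡ q ℚ.* q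
  eq with ℚ.∣p∣≡p∨∣p∣≡-p q
  ... | inj₁ p = cong₂ ℚ._*_ p p
  ... | inj₂ p = ≡.trans (cong₂ ℚ._*_ p p) (solve 1 (λ q → (:- q) :* (:- q) := q :* q) ≡.refl q)

square≥ : ∀ ε q .{{_ : Positive ε}} → ε ℚ.≤ ∣ q ∣ → ε ℚ.* ε ℚ.≤ q ℚ.* q
square≥ ε q ε≤ = ℚ.≤-trans (ℚ.*-monoʳ-≤-nonNeg ε {{ℚ.pos⇒nonNeg ε}} ε≤)
  (subst (∣ q ∣ ℚ.* ε ℚ.≤_) eq (ℚ.*-monoˡ-≤-nonNeg ∣ q ∣ {{ℚ.∣-∣-nonNeg q}} ε≤))
  where
  eq : ∣ q ∣ ℚ.* ∣ q ∣ ≡ q ℚ.* q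
  eq = ≡.trans (≡.sym (ℚ.∣p*q∣≡∣p∣*∣q∣ q q)) (ℚ.0≤p⇒∣p∣≡p (square-nonNeg q))

norm² : ℂ → ℝ
norm² z = (re z *ʳ re z) +ʳ (im z *ʳ im z)

norm²-apart : ∀ z → IsApart (seq (re z)) ⊎ IsApart (seq (im z)) → IsApart (seq (norm² z))
norm²-apart z (inj₁ (ε , ε-pos , N , ε≤)) = ε ℚ.* ε , ℚ.pos*pos⇒pos ε {{ε-pos}} ε {{ε-pos}} , N , λ n N≤n →
  ℚ.≤-trans (subst (ℚ._≤ _) (ℚ.+-identityʳ (ε ℚ.* ε))
    (ℚ.+-mono-≤ (square≥ ε (seq (re z) n) {{ε-pos}} (ε≤ n N≤n)) (square-nonNeg (seq (im z) n)))) (p≤∣p∣ _)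
norm²-apart z (inj₂ (ε , ε-pos , N , ε≤)) = ε ℚ.* ε , ℚ.pos*pos⇒pos ε {{ε-pos}} ε {{ε-pos}} , N , λ n N≤n →
  ℚ.≤-trans (subst (ℚ._≤ _) (ℚ.+-identityˡ (ε ℚ.* ε))
    (ℚ.+-mono-≤ (square-nonNeg (seq (re z) n)) (square≥ ε (seq (im z) n) {{ε-pos}} (ε≤ n N≤n)))) (p≤∣p∣ _)

apart⇒unit : ∀ z → IsApart (seq (norm² z)) → ∃ λ w → z *ᶜ w ≈ᶜ 1ᶜ
apart⇒unit z@(a +i b) apart = w , real , imaginary
  where
  open Reciprocal (norm² z) apart

  w : ℂ
  -- The conjugate of `z` divided by the squared norm.
  w = (reciprocal *ʳ a) +i (-ʳ (reciprocal *ʳ b))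

  real : (a *ʳ (reciprocal *ʳ a)) +ʳ (-ʳ (b *ʳ (-ʳ (reciprocal *ʳ b)))) ≈ʳ 1ʳ
  real = ℝR.trans {(a *ʳ (reciprocal *ʳ a)) +ʳ (-ʳ (b *ʳ (-ʳ (reciprocal *ʳ b))))} {reciprocal *ʳ norm² z} {1ʳ}
    (≗⇒≈ʳ {(a *ʳ (reciprocal *ʳ a)) +ʳ (-ʳ (b *ʳ (-ʳ (reciprocal *ʳ b))))} {reciprocal *ʳ norm² z} λ n →
      solve 3 (λ a b r → (a :* (r :* a)) :+ (:- (b :* (:- (r :* b)))) := r :* (a :* a :+ b :* b))
        ≡.refl (seq a n) (seq b n) (seq reciprocal n))
    reciprocal-*

  imaginary : (a *ʳ (-ʳ (reciprocal *ʳ b))) +ʳ (b *ʳ (reciprocal *ʳ a)) ≈ʳ 0ʳ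
  imaginary = ≗⇒≈ʳ {(a *ʳ (-ʳ (reciprocal *ʳ b))) +ʳ (b *ʳ (reciprocal *ʳ a))} {0ʳ} λ n →
    solve 3 (λ a b r → (a :* (:- (r :* b))) :+ (b :* (r :* a)) := con 0ℚ)
      ≡.refl (seq a n) (seq b n) (seq reciprocal n)

null⇒≈0 : ∀ x → IsNull (seq x) → x ≈ʳ 0ʳ
null⇒≈0 x null ε with null ε
... | N , small = N , λ n N≤n → subst (λ t → ∣ t ∣ ℚ.≤ ε) (≡.sym (ℚ.+-identityʳ (seq x n))) (small n N≤n)

-- Excluded middle is applied to the apartness of both parts: one apart part makes the norm
-- invertible, and a part that is not apart is null.
zero-or-unitᶜ : ∀ z → ¬ ¬ (z ≈ᶜ 0ᶜ ⊎ ∃ λ w → z *ᶜ w ≈ᶜ 1ᶜ)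
zero-or-unitᶜ z@(a +i b) = ¬¬-excluded-middle >>= λ a? → ¬¬-excluded-middle >>= λ b? → return (decide a? b?)
  where
  decide : Dec (IsApart (seq a)) → Dec (IsApart (seq b)) → z ≈ᶜ 0ᶜ ⊎ ∃ λ w → z *ᶜ w ≈ᶜ 1ᶜ
  decide (yes p) _       = inj₂ (apart⇒unit z (norm²-apart z (inj₁ p)))
  decide (no _)  (yes q) = inj₂ (apart⇒unit z (norm²-apart z (inj₂ q)))
  decide (no ¬p) (no ¬q) = inj₁ (null⇒≈0 a (¬apart⇒null (cauchy a) ¬p) , null⇒≈0 b (¬apart⇒null (cauchy b) ¬q))

fromℚᶜ : ℚ → ℂ
fromℚᶜ q = fromℚ q +i 0ʳ

fromℚᶜ-isRingHomomorphism : RingMorphisms.IsRingHomomorphism ℚ.+-*-rawRing ℂR.rawRing fromℚᶜ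
fromℚᶜ-isRingHomomorphism = record
  { isSemiringHomomorphism = record
    { isNearSemiringHomomorphism = record
      { +-isMonoidHomomorphism = record
        { isMagmaHomomorphism = record
          { isRelHomomorphism = record { cong = λ { {p} ≡.refl → ℂR.refl {fromℚᶜ p} } }
          ; homo = λ p q → ℝR.refl {fromℚ (p ℚ.+ q)} , ≗⇒≈ʳ {0ʳ} {0ʳ +ʳ 0ʳ} λ _ → ≡.refl
          }
        ; ε-homo = ℂR.refl {0ᶜ}
        }
      ; *-homo = λ p q →
          ≗⇒≈ʳ {fromℚ (p ℚ.* q)} {(fromℚ p *ʳ fromℚ q) +ʳ (-ʳ (0ʳ *ʳ 0ʳ))} (λ _ → ≡.sym (ℚ.+-identityʳ (p ℚ.* q)))
        , ≗⇒≈ʳ {0ʳ} {(fromℚ p *ʳ 0ʳ) +ʳ (0ʳ *ʳ fromℚ q)} (λ _ →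
            solve 2 (λ p q → con 0ℚ := p :* con 0ℚ :+ con 0ℚ :* q) ≡.refl p q)
      }
    ; 1#-homo = ℂR.refl {1ᶜ}
    }
  ; -‿homo = λ p → ℝR.refl {fromℚ (ℚ.- p)} , ≗⇒≈ʳ {0ʳ} { -ʳ 0ʳ} λ _ → ≡.refl
  }

fromℚᶜ-injective : ∀ {p q} → fromℚᶜ p ≈ᶜ fromℚᶜ q → p ≡ q
fromℚᶜ-injective {p} {q} (eq , _) with p ℚ.≟ q
... | yes p≡q = p≡q
... | no  p≢q = contradiction eq (apart⇒¬null {λ _ → p ℚ.- q} (∣ p ℚ.- q ∣ , pos , 0 , λ _ _ → ℚ.≤-refl))
  where
  p-q≢0 : ∣ p ℚ.- q ∣ ≢ 0ℚ
  p-q≢0 eq′ = p≢q (x∙y⁻¹≈ε⇒x≈y p q (ℚ.∣p∣≡0⇒p≡0 (p ℚ.- q) eq′))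
    where open import Algebra.Properties.Ring ℚ.+-*-ring using (x∙y⁻¹≈ε⇒x≈y)

  pos : Positive ∣ p ℚ.- q ∣
  pos = ℚ.nonNeg∧nonZero⇒pos (∣ p ℚ.- q ∣) {{ℚ.∣-∣-nonNeg (p ℚ.- q)}} {{ℚ.≢-nonZero p-q≢0}}

-- Rounding to integers

/1-cancel-< : ∀ {i j} → i /1 ℚ.< j /1 → i ℤ.< j
/1-cancel-< {i} {j} i<j = subst₂ ℤ._<_ (ℤ.*-identityʳ i) (ℤ.*-identityʳ j) (ℚᵘ.drop-*<*
  (ℚᵘ.<-respˡ-≃ (toℚᵘ-/1 i) (ℚᵘ.<-respʳ-≃ (toℚᵘ-/1 j) (ℚ.toℚᵘ-mono-< i<j))))

/1-neg : ∀ i → (ℤ.- i) /1 ≡ ℚ.- (i /1)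
/1-neg i = +-inverseʳ-unique (i /1) ((ℤ.- i) /1)
  (≡.trans (≡.sym (/1-+ i (ℤ.- i))) (cong _/1 (ℤ.+-inverseʳ i)))
  where open import Algebra.Properties.Ring ℚ.+-*-ring using (+-inverseʳ-unique)

∣i∣<1⇒i≡0 : ∀ i → ∣ i /1 ∣ ℚ.< 1ℚ → i ≡ 0ℤ
∣i∣<1⇒i≡0 i ∣i∣<1 = squeeze i
  (/1-cancel-< {i} {1ℤ} (ℚ.≤-<-trans (p≤∣p∣ (i /1)) ∣i∣<1))
  (/1-cancel-< {ℤ.- i} {1ℤ} (subst (ℚ._< 1ℚ) (≡.sym (/1-neg i)) (ℚ.≤-<-trans (p≤∣p∣ (ℚ.- (i /1)))
    (subst (ℚ._< 1ℚ) (≡.sym (ℚ.∣-p∣≡∣p∣ (i /1))) ∣i∣<1))))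
  where
  squeeze : ∀ i → i ℤ.< 1ℤ → ℤ.- i ℤ.< 1ℤ → i ≡ 0ℤ
  squeeze (+ zero)   _ _ = ≡.refl
  squeeze +[1+ n ] (ℤ.+<+ (s≤s ())) _
  squeeze -[1+ n ] _ (ℤ.+<+ (s≤s ()))

floor-≤ : ∀ q → ℚ.floor q /1 ℚ.≤ q
floor-≤ q@record{} = ℚ.toℚᵘ-cancel-≤ (ℚᵘ.≤-respˡ-≃ (ℚᵘ.≃-sym (toℚᵘ-/1 (ℚ.floor q)))
  (*≤* (subst (ℚ.floor q ℤ.* ↧ q ℤ.≤_) (≡.sym (ℤ.*-identityʳ (↥ q))) (ℤ.[n/d]*d≤n (↥ q) (↧ q)))))

≤-floor+1 : ∀ q → q ℚ.≤ ℚ.floor q /1 ℚ.+ 1ℚ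
≤-floor+1 q@record{} = subst (q ℚ.≤_) (/1-+ (ℚ.floor q) 1ℤ) (ℚ.toℚᵘ-cancel-≤
  (ℚᵘ.≤-respʳ-≃ (ℚᵘ.≃-sym (toℚᵘ-/1 (ℚ.floor q ℤ.+ 1ℤ))) (*≤* (begin
    ↥ q ℤ.* 1ℤ                          ≡⟨ ℤ.*-identityʳ (↥ q) ⟩
    ↥ q                                 ≤⟨ ℤ.<⇒≤ (ℤ.n<s[n/ℕd]*d (↥ q) (suc (ℚ.denominator-1 q))) ⟩
    ℤ.suc (↥ q ℤ./ℕ suc (ℚ.denominator-1 q)) ℤ.* ↧ q
      ≡⟨ cong (λ t → ℤ.suc t ℤ.* ↧ q) (ℤ.div-pos-is-/ℕ (↥ q) (suc (ℚ.denominator-1 q))) ⟨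
    ℤ.suc (ℚ.floor q) ℤ.* ↧ q           ≡⟨ cong (ℤ._* ↧ q) (ℤ.+-comm 1ℤ (ℚ.floor q)) ⟩
    (ℚ.floor q ℤ.+ 1ℤ) ℤ.* ↧ q          ∎))))
  where open ℤ.≤-Reasoning

nearest : ∀ q → ∃ λ k → ∣ q ℚ.- k /1 ∣ ℚ.≤ ½
nearest q = k , ∣p∣≤
  (subst₂ ℚ._≤_ (eq₁ q (k /1)) (eq₂ (k /1)) (ℚ.+-monoˡ-≤ (ℚ.- (k /1) ℚ.- ½) (≤-floor+1 (q ℚ.+ ½))))
  (subst₂ ℚ._≤_ (eq₃ q (k /1)) (eq₄ q) (ℚ.+-monoˡ-≤ (ℚ.- q) (floor-≤ (q ℚ.+ ½))))
  where
  k : ℤ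
  k = ℚ.floor (q ℚ.+ ½)

  eq₁ : ∀ q k → (q ℚ.+ ½) ℚ.+ (ℚ.- k ℚ.- ½) ≡ q ℚ.- k
  eq₁ = solve 2 (λ q k → (q :+ con ½) :+ (:- k :- con ½) := q :- k) ≡.refl

  eq₂ : ∀ k → (k ℚ.+ 1ℚ) ℚ.+ (ℚ.- k ℚ.- ½) ≡ ½
  eq₂ = solve 1 (λ k → (k :+ con 1ℚ) :+ (:- k :- con ½) := con ½) ≡.refl

  eq₃ : ∀ q k → k ℚ.+ (ℚ.- q) ≡ ℚ.- (q ℚ.- k)
  eq₃ = solve 2 (λ q k → k :+ (:- q) := :- (q :- k)) ≡.refl

  eq₄ : ∀ q → (q ℚ.+ ½) ℚ.+ (ℚ.- q) ≡ ½
  eq₄ = solve 1 (λ q → (q :+ con ½) :+ (:- q) := con ½) ≡.refl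

-- k is a rational approximation of z rounded, and z ≈ᶜ fromℤ k is ¬¬-stable.
¬¬-integer⇒integer : ∀ z → ¬ ¬ (∃ λ k → z ≈ᶜ fromℤ k) → ∃ λ k → z ≈ᶜ fromℤ k
¬¬-integer⇒integer z ¬¬k = k , ≈ᶜ-stable z (fromℤ k) (¬¬k >>= λ (k′ , z≈k′) →
  return (subst (λ t → z ≈ᶜ fromℤ t) (≡.sym (k≡ {k′} z≈k′)) z≈k′))
  where
  -- Rounding costs ½, and the two approximations cost ⅛ each. The sum is ¾, below the distance 1
  -- between distinct integers.
  ⅛ : ℚ
  ⅛ = ½ ℚ.* ½ ℚ.* ½

  N : ℕ
  N = proj₁ (cauchy (re z) ⅛)

  q : ℚ
  q = seq (re z) N

  k : ℤ
  k = proj₁ (nearest q)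

  k≡ : ∀ {k′} → z ≈ᶜ fromℤ k′ → k ≡ k′
  k≡ {k′} (eq , _) = x∙y⁻¹≈ε⇒x≈y k k′ (∣i∣<1⇒i≡0 (k ℤ.- k′) (ℚ.≤-<-trans
    (subst (λ t → ∣ t ∣ ℚ.≤ ½ ℚ.+ (⅛ ℚ.+ ⅛)) difference
      (∣p-r∣≤ {k /1} {q} {k′ /1} (subst (ℚ._≤ ½) (∣-∣-sym q (k /1)) (proj₂ (nearest q)))
        (∣p-r∣≤ {q} {seq (re z) n} {k′ /1}
          (proj₂ (cauchy (re z) ⅛) N n ℕ.≤-refl (ℕ.m≤m⊔n N M))
          (proj₂ (eq ⅛) n (ℕ.m≤n⊔m N M)))))
    (ℚ.*<* (ℤ.+<+ (ℕ.m≤m+n 4 _)))))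
    where
    open import Algebra.Properties.Ring ℤ.+-*-ring using (x∙y⁻¹≈ε⇒x≈y)

    M n : ℕ
    M = proj₁ (eq ⅛)
    n = N ℕ.⊔ M

    difference : k /1 ℚ.- k′ /1 ≡ (k ℤ.- k′) /1
    difference = ≡.sym (≡.trans (/1-+ k (ℤ.- k′)) (cong (k /1 ℚ.+_) (/1-neg k′)))

    ∣-∣-sym : ∀ p q → ∣ p ℚ.- q ∣ ≡ ∣ q ℚ.- p ∣
    ∣-∣-sym p q = ≡.trans (≡.sym (ℚ.∣-p∣≡∣p∣ (p ℚ.- q)))
      (cong ∣_∣ (solve 2 (λ p q → :- (p :- q) := q :- p) ≡.refl p q))

-- Finite linear groups

module FiniteSubgroups {c ℓ} (G : Group c ℓ) (H : FiniteSubgroup G) where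

  open Group G
  open GroupProperties G
  open FiniteSubgroup H
  open Mult monoid using (×-homo-+) renaming (_×_ to _times_)
  open SetoidReasoning setoid

  infixl 7 _·_
  -- The group is moved to indices, where equality is propositional and elements can index matrices.
  _·_ : Fin order → Fin order → Fin order
  i · j = proj₁ (∙-closed (i , refl) (j , refl))

  elem-· : ∀ i j → elem (i · j) ≈ elem i ∙ elem j
  elem-· i j = proj₂ (∙-closed (i , refl) (j , refl))

  e : Fin order
  e = proj₁ ε-closed

  inv : Fin order → Fin order
  inv i = proj₁ (⁻¹-closed (i , refl))

  elem-inv : ∀ i → elem (inv i) ≈ elem i ⁻¹
  elem-inv i = proj₂ (⁻¹-closed (i , refl))

  elem-/ : ∀ i j → elem (i · inv j) ≈ elem i ∙ elem j ⁻¹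
  elem-/ i j = trans (elem-· i (inv j)) (∙-congˡ (elem-inv j))

  isGroup-· : IsGroup _≡_ _·_ e inv
  isGroup-· = record
    { isMonoid = record
      { isSemigroup = record
        { isMagma = record { isEquivalence = ≡.isEquivalence ; ∙-cong = cong₂ _·_ }
        ; assoc = λ i j k → elem-injective (begin
            elem (i · j · k)             ≈⟨ trans (elem-· (i · j) k) (∙-congʳ (elem-· i j)) ⟩
            elem i ∙ elem j ∙ elem k     ≈⟨ assoc (elem i) (elem j) (elem k) ⟩
            elem i ∙ (elem j ∙ elem k)   ≈⟨ trans (elem-· i (j · k)) (∙-congˡ (elem-· j k)) ⟨
            elem (i · (j · k))           ∎)
        }
      ; identity =
          (λ i → elem-injective (trans (elem-· e i) (trans (∙-congʳ (proj₂ ε-closed)) (identityˡ (elem i)))))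
        , (λ i → elem-injective (trans (elem-· i e) (trans (∙-congˡ (proj₂ ε-closed)) (identityʳ (elem i)))))
      }
    ; inverse =
        (λ i → elem-injective (trans (elem-· (inv i) i) (trans (∙-congʳ (elem-inv i))
          (trans (inverseˡ (elem i)) (sym (proj₂ ε-closed))))))
      , (λ i → elem-injective (trans (elem-/ i i) (trans (inverseʳ (elem i)) (sym (proj₂ ε-closed)))))
    ; ⁻¹-cong = cong inv
    }

  indexGroup : Group 0ℓ 0ℓ
  indexGroup = record { isGroup = isGroup-· }

  power-member : ∀ i k → Member (k times elem i)
  power-member i zero    = ε-closed
  power-member i (suc k) = ∙-closed (i , refl) (power-member i k)

  finite-order : ∀ i → HasFiniteOrder G (elem i)
  finite-order i with pigeonhole (ℕ.n<1+n order) (λ k → proj₁ (power-member i (toℕ k)))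
  -- Two of the powers x^0, ..., x^`order` coincide, and cancelling x^k leaves x^(l - k) = 1. Here l
  -- - k is `suc d`, because `HasFiniteOrder` takes the predecessor of the exponent.
  ... | k , l , k<l , eq = toℕ l ℕ.∸ suc (toℕ k) , identityʳ-unique (toℕ k times x) (suc d times x) (begin
    toℕ k times x ∙ suc d times x     ≈⟨ ×-homo-+ x (toℕ k) (suc d) ⟨
    (toℕ k ℕ.+ suc d) times x
      ≡⟨ cong (_times x) (≡.trans (ℕ.+-suc (toℕ k) d) (ℕ.m+[n∸m]≡n k<l)) ⟩
    toℕ l times x                     ≈⟨ proj₂ (power-member i (toℕ l)) ⟨
    elem (proj₁ (power-member i (toℕ l)))      ≡⟨ cong elem eq ⟨
    elem (proj₁ (power-member i (toℕ k)))      ≈⟨ proj₂ (power-member i (toℕ k)) ⟩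
    toℕ k times x                     ∎)
    where
    x : Carrier
    x = elem i

    d : ℕ
    d = toℕ l ℕ.∸ suc (toℕ k)

-- Linear combinations and dimension

module _ {c ℓ} (K : CommutativeRing c ℓ) (ι : ℚ → CommutativeRing.Carrier K)
  (ι-hom : RingMorphisms.IsRingHomomorphism ℚ.+-*-rawRing (CommutativeRing.rawRing K) ι) where

  open CommutativeRing K hiding (zero)
  open Matrices K
  open RationalElements K ι ι-hom using (ι-·)
  open SetoidReasoning setoid

  -- The trace of MN = 1 is m and that of NM = 1 is n.
  invertible⇒square : ∀ {m n} (M : Mat m n) (N : Mat n m) → M ⊛ N ≋ δ → N ⊛ M ≋ δ →
                      ι ((+ m) /1) ≈ ι ((+ n) /1)
  invertible⇒square {m} {n} M N MN NM = begin
    ι ((+ m) /1)   ≈⟨ trans (tr-δ m) (ι-· m) ⟨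
    tr (δ {m})     ≈⟨ tr-cong MN ⟨
    tr (M ⊛ N)     ≈⟨ tr-comm M N ⟩
    tr (N ⊛ M)     ≈⟨ tr-cong NM ⟩
    tr (δ {n})     ≈⟨ trans (tr-δ n) (ι-· n) ⟩
    ι ((+ n) /1)   ∎

module Combinations {c ℓ} (K : CommutativeRing c ℓ) {m ℓm}
  (V : LeftModule (CommutativeRing.ring K) m ℓm) where

  open CommutativeRing K using (Carrier; _≈_; _+_; _*_; -_; 0#; -‿inverseʳ)
  open LeftModule V
  open CommutativeMonoidSum +ᴹ-commutativeMonoid
  open Matrices K using (Mat; δ; _⊛_; _≋_)
  open SemiringSum (CommutativeRing.semiring K) using () renaming (sum to sumᴷ)
  open SetoidReasoning ≈ᴹ-setoid

  combination : ∀ {n} → (Fin n → Carrier) → (Fin n → Carrierᴹ) → Carrierᴹ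
  combination z v = sum (λ i → z i *ₗ v i)

  combination-+ : ∀ {n} (z w : Fin n → Carrier) v →
                  combination (λ i → z i + w i) v ≈ᴹ combination z v +ᴹ combination w v
  combination-+ z w v = ≈ᴹ-trans (sum-cong-≋ λ i → *ₗ-distribʳ (v i) (z i) (w i))
    (∑-distrib-+ (λ i → z i *ₗ v i) _)

  combination-zero : ∀ {n} {z : Fin n → Carrier} v → (∀ i → z i ≈ 0#) → combination z v ≈ᴹ 0ᴹ
  combination-zero {n} v z≈0 =
    ≈ᴹ-trans (sum-cong-≋ λ i → ≈ᴹ-trans (*ₗ-congʳ (z≈0 i)) (*ₗ-zeroˡ (v i))) (sum-replicate-zero n)

  combination-δ : ∀ {n} i (v : Fin n → Carrierᴹ) → combination (δ i) v ≈ᴹ v i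
  combination-δ zero    v = ≈ᴹ-trans
    (+ᴹ-cong (*ₗ-identityˡ (v zero)) (combination-zero (v ∘ suc) λ _ → CommutativeRing.refl K)) (+ᴹ-identityʳ _)
  combination-δ (suc i) v = ≈ᴹ-trans
    (+ᴹ-cong (*ₗ-zeroˡ (v zero)) (combination-δ i (v ∘ suc))) (+ᴹ-identityˡ _)

  *ₗ-∑ : ∀ {n} z (v : Fin n → Carrierᴹ) → z *ₗ sum v ≈ᴹ sum (λ i → z *ₗ v i)
  *ₗ-∑ {zero}  z v = *ₗ-zeroʳ z
  *ₗ-∑ {suc n} z v = ≈ᴹ-trans (*ₗ-distribˡ z (v zero) _) (+ᴹ-congˡ (*ₗ-∑ z (v ∘ suc)))

  ∑-*ₗ : ∀ {n} (z : Fin n → Carrier) v → sumᴷ z *ₗ v ≈ᴹ sum (λ i → z i *ₗ v)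
  ∑-*ₗ {zero}  z v = *ₗ-zeroˡ v
  ∑-*ₗ {suc n} z v = ≈ᴹ-trans (*ₗ-distribʳ v (z zero) _) (+ᴹ-congˡ (∑-*ₗ (z ∘ suc) v))

  combination-⊛ : ∀ {l m n} (M : Mat l m) (N : Mat m n) v i →
                  combination (M i) (λ j → combination (N j) v) ≈ᴹ combination ((M ⊛ N) i) v
  combination-⊛ {l} {m} {n} M N v i = begin
    sum (λ j → M i j *ₗ sum (λ k → N j k *ₗ v k))
      ≈⟨ sum-cong-≋ (λ j → ≈ᴹ-trans (*ₗ-∑ (M i j) (λ k → N j k *ₗ v k))
           (sum-cong-≋ λ k → ≈ᴹ-sym (*ₗ-assoc (M i j) (N j k) (v k)))) ⟩
    sum (λ j → sum (λ k → (M i j * N j k) *ₗ v k))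
      ≈⟨ ∑-comm (λ j k → (M i j * N j k) *ₗ v k) ⟩
    sum (λ k → sum (λ j → (M i j * N j k) *ₗ v k))
      ≈⟨ sum-cong-≋ (λ k → ≈ᴹ-sym (∑-*ₗ (λ j → M i j * N j k) (v k))) ⟩
    combination ((M ⊛ N) i) v ∎

  module _ {n} (b : Fin n → Carrierᴹ)
    (independent : ∀ z → combination z b ≈ᴹ 0ᴹ → ∀ i → z i ≈ 0#) where

    coefficients-unique : ∀ z w → combination z b ≈ᴹ combination w b → ∀ i → z i ≈ w i
    coefficients-unique z w eq i = RingProperties.x∙y⁻¹≈ε⇒x≈y (CommutativeRing.ring K) (z i) (w i)
      (independent (λ i → z i + - w i) (begin
        combination (λ i → z i + - w i) b                 ≈⟨ combination-+ z (λ i → - w i) b ⟩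
        combination z b +ᴹ combination (λ i → - w i) b    ≈⟨ +ᴹ-congʳ eq ⟩
        combination w b +ᴹ combination (λ i → - w i) b    ≈⟨ combination-+ w (λ i → - w i) b ⟨
        combination (λ i → w i + - w i) b                 ≈⟨ combination-zero b (λ i → -‿inverseʳ (w i)) ⟩
        0ᴹ ∎) i)

    -- Rewriting `b` in terms of `b′` and back has coefficient matrix M N, and independence of `b`
    -- admits only the identity.
    coordinates-inverse : ∀ {n′} (b′ : Fin n′ → Carrierᴹ) (M : Mat n n′) (N : Mat n′ n) →
      (∀ i → b i ≈ᴹ combination (M i) b′) → (∀ j → b′ j ≈ᴹ combination (N j) b) → M ⊛ N ≋ δ
    coordinates-inverse b′ M N b≈ b′≈ i = coefficients-unique ((M ⊛ N) i) (δ i) (begin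
      combination ((M ⊛ N) i) b                       ≈⟨ combination-⊛ M N b i ⟨
      combination (M i) (λ j → combination (N j) b)   ≈⟨ sum-cong-≋ (λ j → *ₗ-congˡ (b′≈ j)) ⟨
      combination (M i) b′                            ≈⟨ b≈ i ⟨
      b i                                             ≈⟨ combination-δ i b ⟨
      combination (δ i) b                             ∎)

module Dimension {m ℓ} (V : LeftModule ℂ-ring m ℓ) where

  open LeftModule V
  open Combinations ℂ-commutativeRing V
  open SetoidReasoning ≈ᴹ-setoid
  open LinearAutomorphism

  -- The change-of-basis matrices are mutually inverse, so a comparison of traces gives the equality
  -- directly, without elimination.
  dimension-unique : ∀ {s} {S : Pred Carrierᴹ s} {d d′} → HasDimension V S d → HasDimension V S d′ → d ≡ d′
  dimension-unique {d = d} {d′} (b , B) (b′ , B′) = ℤ.+-injective (/1-injective (fromℚᶜ-injective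
    (invertible⇒square ℂ-commutativeRing fromℚᶜ fromℚᶜ-isRingHomomorphism {d} {d′}
      (λ i → proj₁ (b∈ i)) (λ j → proj₁ (b′∈ j))
      (coordinates-inverse b B.independent b′ (λ i → proj₁ (b∈ i)) (λ j → proj₁ (b′∈ j))
        (λ i → proj₂ (b∈ i)) (λ j → proj₂ (b′∈ j)))
      (coordinates-inverse b′ B′.independent b (λ j → proj₁ (b′∈ j)) (λ i → proj₁ (b∈ i))
        (λ j → proj₂ (b′∈ j)) (λ i → proj₂ (b∈ i))))))
    where
    module B = IsBasis B
    module B′ = IsBasis B′
    b∈ : ∀ i → _
    b∈ i = B′.spanning (B.member i)
    b′∈ : ∀ i → _
    b′∈ j = B.spanning (B′.member j)

  dimension-transport : ∀ {s s′} {S : Pred Carrierᴹ s} {S′ : Pred Carrierᴹ s′} (k : LinearAutomorphism V) →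
    (∀ {v} → v ∈ S → apply k v ∈ S′) → (∀ {w} → w ∈ S′ → ∃ λ v → v ∈ S × w ≈ᴹ apply k v) →
    ∀ {d} → HasDimension V S d → HasDimension V S′ d
  dimension-transport k into onto (b , B) = apply k ∘ b , record
    { member = λ i → into (B.member i)
    ; independent = λ z eq → B.independent z (injective k (begin
        apply k (combination z b)      ≈⟨ apply-combination z b ⟩
        combination z (apply k ∘ b)    ≈⟨ eq ⟩
        0ᴹ                             ≈⟨ 0ᴹ-homo k ⟨
        apply k 0ᴹ ∎))
    ; spanning = λ {w} w∈S′ → let (v , v∈S , w≈kv) = onto w∈S′; (z , v≈) = B.spanning v∈S in
        z , (begin
          w                            ≈⟨ w≈kv ⟩
          apply k v                    ≈⟨ ⟦⟧-cong k v≈ ⟩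
          apply k (combination z b)    ≈⟨ apply-combination z b ⟩
          combination z (apply k ∘ b)  ∎)
    }
    where
    module B = IsBasis B

    apply-combination : ∀ {n} (z : Fin n → ℂ) v →
                        apply k (combination z v) ≈ᴹ combination z (apply k ∘ v)
    apply-combination {zero}  z v = 0ᴹ-homo k
    apply-combination {suc n} z v = ≈ᴹ-trans (+ᴹ-homo k _ _)
      (+ᴹ-cong (*ₗ-homo k (z zero) (v zero)) (apply-combination (z ∘ suc) (v ∘ suc)))

-- Reflection groups and their two matrices

module ReflectionGroups {m ℓ} (V : LeftModule ℂ-ring m ℓ) (W : ComplexReflectionGroup V) where

  open LeftModule V
  open ComplexReflectionGroup W
  open LinearAutomorphism
  open Group (GL V) using (_≈_; _∙_; _⁻¹; ε; inverseˡ; ∙-congʳ)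
    renaming (refl to ≈-refl; sym to ≈-sym; trans to ≈-trans)
  open GroupProperties (GL V) using (//-rightDividesʳ)
  open FiniteSubgroups (GL V) group
  open Dimension V

  private
    module W = Group indexGroup
    module WP = GroupProperties indexGroup

  Fix : Fin order → Pred Carrierᴹ ℓ
  Fix i = FixedSpace V (elem i)

  fixed-≈ : ∀ {g h} → g ≈ h → FixedSpace V g ⊆ FixedSpace V h
  fixed-≈ g≈h {v} gv≈v = ≈ᴹ-trans (≈ᴹ-sym (g≈h v)) gv≈v

  fixed-⁻¹ : ∀ g → FixedSpace V g ⊆ FixedSpace V (g ⁻¹)
  fixed-⁻¹ g {v} gv≈v = ≈ᴹ-trans (⟦⟧-cong (g ⁻¹) (≈ᴹ-sym gv≈v)) (inverseˡ g v)

  dimension-⊆ : ∀ {s s′} {S : Pred Carrierᴹ s} {S′ : Pred Carrierᴹ s′} → S ⊆ S′ → S′ ⊆ S →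
                ∀ {d} → HasDimension V S d → HasDimension V S′ d
  dimension-⊆ S⊆S′ S′⊆S = dimension-transport ε S⊆S′ λ {w} w∈S′ → w , S′⊆S w∈S′ , ≈ᴹ-refl

  dimension-≈ : ∀ {g h} → g ≈ h → ∀ {d} → HasDimension V (FixedSpace V g) d → HasDimension V (FixedSpace V h) d
  dimension-≈ {g} {h} g≈h = dimension-⊆ (fixed-≈ {g} {h} g≈h) (fixed-≈ {h} {g} (≈-sym {g} {h} g≈h))

  infix 4 _≼_
  -- Inclusion of fixed spaces is reversed so that the elements below `g` form the pointwise
  -- stabiliser of the fixed space of `g`.
  _≼_ : Fin order → Fin order → Set (m ⊔ ℓ)
  h ≼ g = Fix g ⊆ Fix h

  ∙-≼ : ∀ {g h k} → h ≼ g → k ≼ g → (h · k) ≼ g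
  ∙-≼ {g} {h} {k} h≼g k≼g {v} gv≈v = fixed-≈ {elem h ∙ elem k} {elem (h · k)}
    (≈-sym {elem (h · k)} {elem h ∙ elem k} (elem-· h k))
    (≈ᴹ-trans (⟦⟧-cong (elem h) (k≼g gv≈v)) (h≼g gv≈v))

  ⁻¹-≼ : ∀ {g h} → h ≼ g → inv h ≼ g
  ⁻¹-≼ {g} {h} h≼g {v} gv≈v = fixed-≈ {elem h ⁻¹} {elem (inv h)}
    (≈-sym {elem (inv h)} {elem h ⁻¹} (elem-inv h)) (fixed-⁻¹ (elem h) (h≼g gv≈v))

  -- y carries the fixed space of xy to that of yx.
  dimension-comm : ∀ x y {d} → HasDimension V (Fix (x · y)) d → HasDimension V (Fix (y · x)) d
  dimension-comm x y = dimension-transport (elem y)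
    (λ {v} p → ≈ᴹ-trans (elem-· y x (apply (elem y) v)) (⟦⟧-cong (elem y) (≈ᴹ-trans (≈ᴹ-sym (elem-· x y v)) p)))
    (λ {w} p → apply (elem x) w
      , ≈ᴹ-trans (elem-· x y (apply (elem x) w)) (⟦⟧-cong (elem x) (≈ᴹ-trans (≈ᴹ-sym (elem-· y x w)) p))
      , ≈ᴹ-trans (≈ᴹ-sym p) (elem-· y x w))

  -- A dimension comes with a basis, which constructively a fixed space need not have; this compares
  -- two fixed spaces without one.
  SameDimension : Fin order → Fin order → Set (m ⊔ ℓ)
  SameDimension g h = ∀ {d} → HasDimension V (Fix g) d ⇔ HasDimension V (Fix h) d

  -- Covers both matrices. Dependence on dimension alone gives the class property by
  -- `dimension-comm`, and equal fixed spaces have equal dimension.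
  integral-spectrum : ∀ (A : Matrix order) →
    (∀ {i j i′ j′} → SameDimension (i · inv j) (i′ · inv j′) → A i j ≡ A i′ j′) →
    HasIntegralSpectrum A
  integral-spectrum A A-dim z (x , x≉0 , Ax≈zx) = ¬¬-integer⇒integer z
    -- Inclusion of fixed spaces is undecidable, but only finitely many pairs are compared, so a
    -- decision exists under double negation.
    (¬¬-∀Fin (λ h → ¬¬-∀Fin λ g → ¬¬-excluded-middle) >>= λ _≼?_ →
      eigenvalue-integer _·_ e inv isGroup-· _≼_ _≼?_ id (λ p q → p ∘ q)
        (λ {g} {h} {k} → ∙-≼ {g} {h} {k}) (λ {g} {h} → ⁻¹-≼ {g} {h})
        f f-class f-invariant A A≡f fromℤ fromℤ≈ z x x≉0 Ax≈zx)
    where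
    open Integrality ℂ-commutativeRing zero-or-unitᶜ fromℚᶜ fromℚᶜ-isRingHomomorphism

    fromℤ≈ : ∀ k → fromℤ k ≈ᶜ fromℚᶜ (k /1)
    fromℤ≈ k = ℂR.refl {fromℤ k}

    f : Fin order → ℤ
    f g = A g e

    /e : ∀ g → g · inv e ≡ g
    /e g = ≡.trans (cong (g ·_) WP.ε⁻¹≈ε) (W.identityʳ g)

    A-dim-e : ∀ {g h} → SameDimension g h → A g e ≡ A h e
    A-dim-e {g} {h} p = A-dim (subst₂ SameDimension (≡.sym (/e g)) (≡.sym (/e h)) p)

    A≡f : ∀ i j → A i j ≡ f (i · inv j)
    A≡f i j = A-dim (subst (SameDimension (i · inv j)) (≡.sym (/e (i · inv j))) (mk⇔ id id))

    f-class : ∀ x y → f (x · y) ≡ f (y · x)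
    f-class x y = A-dim-e (mk⇔ (dimension-comm x y) (dimension-comm y x))

    f-invariant : ∀ {g h} → g ≼ h → h ≼ g → f g ≡ f h
    f-invariant {g} {h} p q = A-dim-e (mk⇔ (dimension-⊆ {S = Fix g} {Fix h} q p) (dimension-⊆ {S = Fix h} {Fix g} p q))

  IsReflecting : Fin order → Set (m ⊔ ℓ)
  IsReflecting g = ∃[ d ] (dim ≡ suc d × HasDimension V (Fix g) d)

  private
    E : Fin order → Fin order → Set (m ⊔ ℓ)
    E = CayleyGraph (GL V) group Reflections

  private
    quotient-≈ : ∀ {i j t} → elem i ≈ t ∙ elem j → t ≈ elem (i · inv j)
    quotient-≈ {i} {j} {t} i≈tj = ≈-sym {elem (i · inv j)} {t}
      (≈-trans {elem (i · inv j)} {elem i ∙ elem j ⁻¹} {t} (elem-/ i j)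
        (≈-trans {elem i ∙ elem j ⁻¹} {t ∙ elem j ∙ elem j ⁻¹} {t}
          (∙-congʳ {elem j ⁻¹} {elem i} {t ∙ elem j} i≈tj) (//-rightDividesʳ (elem j) t)))

  -- An element and its inverse fix the same vectors. This handles the edges added by the symmetric
  -- closure, as j i⁻¹ is the inverse of i j⁻¹.
  reflecting-inv : ∀ {g} → IsReflecting g → IsReflecting (inv g)
  reflecting-inv {g} (d , dim≡ , D) = d , dim≡ , dimension-⊆ (⁻¹-≼ {g} {g} id)
    (λ {v} p → subst (λ k → v ∈ Fix k) (WP.⁻¹-involutive g) (⁻¹-≼ {inv g} {inv g} id p)) D

  edge⇒reflecting : ∀ {i j} → E i j → IsReflecting (i · inv j)
  edge⇒reflecting {i} {j} (bwd (t , (_ , _ , d , dim≡ , D) , i≈tj)) =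
    d , dim≡ , dimension-≈ {t} {elem (i · inv j)} (quotient-≈ {i} {j} {t} i≈tj) D
  edge⇒reflecting {i} {j} (fwd (t , (_ , _ , d , dim≡ , D) , j≈ti)) =
    subst IsReflecting (WP.⁻¹-anti-homo-// j i) (reflecting-inv
      (d , dim≡ , dimension-≈ {t} {elem (j · inv i)} (quotient-≈ {j} {i} {t} j≈ti) D))

  -- The quotient i j⁻¹ itself is the reflection joining the vertices; `finite-order` supplies what
  -- the fixed space does not tell.
  reflecting⇒edge : ∀ {i j} → IsReflecting (i · inv j) → E i j
  reflecting⇒edge {i} {j} (d , dim≡ , D) = bwd (elem (i · inv j)
    , ((i · inv j , ≈-refl {elem (i · inv j)}) , finite-order (i · inv j) , d , dim≡ , D)
    , subst (λ k → elem k ≈ elem (i · inv j) ∙ elem j) (WP.//-rightDividesˡ j i) (elem-· (i · inv j) j))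

  adjacency-integral : ∀ A → IsAdjacencyMatrix E A → HasIntegralSpectrum A
  adjacency-integral A adj = integral-spectrum A λ {i} {j} {i′} {j′} same →
    -- Adjacency may be undecidable, but equality of integers is stable, so excluded middle for the
    -- edge is admissible.
    decidable-stable (A i j ℤ.≟ A i′ j′) (¬¬-excluded-middle >>= λ e? → return (entries same e?))
    where
    transfer : ∀ {g h} → SameDimension g h → IsReflecting g → IsReflecting h
    transfer same (d , dim≡ , D) = d , dim≡ , Equivalence.to same D

    flip : ∀ {g h} → SameDimension g h → SameDimension h g
    flip same = mk⇔ (Equivalence.from same) (Equivalence.to same)

    entries : ∀ {i j i′ j′} → SameDimension (i · inv j) (i′ · inv j′) → Dec (E i j) → A i j ≡ A i′ j′
    entries {i} {j} {i′} {j′} same (yes p) = ≡.trans (proj₁ (adj i j) p)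
      (≡.sym (proj₁ (adj i′ j′) (reflecting⇒edge (transfer same (edge⇒reflecting p)))))
    entries {i} {j} {i′} {j′} same (no ¬p) = ≡.trans (proj₂ (adj i j) ¬p)
      (≡.sym (proj₂ (adj i′ j′) (λ p → ¬p (reflecting⇒edge (transfer (flip same) (edge⇒reflecting p))))))

  -- Each entry comes with its own basis of a fixed space; uniqueness of dimension makes the
  -- resulting codimensions comparable.
  codimension-integral : ∀ C → IsCodimensionMatrix C → HasIntegralSpectrum C
  codimension-integral C codim = integral-spectrum C λ {i} {j} {i′} {j′} → entries i j i′ j′
    where
    entries : ∀ i j i′ j′ → SameDimension (i · inv j) (i′ · inv j′) → C i j ≡ C i′ j′
    entries i j i′ j′ same with codim i j | codim i′ j′
    ... | c , (d , D , d+c≡n) , C≡c | c′ , (d′ , D′ , d′+c′≡n) , C≡c′ =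
      ≡.trans C≡c (≡.trans (cong +_ c≡c′) (≡.sym C≡c′))
      where
      d≡d′ : d ≡ d′
      d≡d′ = dimension-unique
        (Equivalence.to same (dimension-≈ {elem i ∙ elem j ⁻¹} {elem (i · inv j)}
          (≈-sym {elem (i · inv j)} {elem i ∙ elem j ⁻¹} (elem-/ i j)) D))
        (dimension-≈ {elem i′ ∙ elem j′ ⁻¹} {elem (i′ · inv j′)}
          (≈-sym {elem (i′ · inv j′)} {elem i′ ∙ elem j′ ⁻¹} (elem-/ i′ j′)) D′)

      c≡c′ : c ≡ c′
      c≡c′ = ℕ.+-cancelˡ-≡ d′ c c′ (≡.trans (subst (λ k → k ℕ.+ c ≡ dim) d≡d′ d+c≡n) (≡.sym d′+c′≡n))

corollary4p11 : ∀ {m ℓ} (V : LeftModule ℂ-ring m ℓ) (W : ComplexReflectionGroup V) →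
    let open ComplexReflectionGroup W in
    IsIrreducible →
    (∀ A → IsAdjacencyMatrix (CayleyGraph (GL V) group Reflections) A →
    HasIntegralSpectrum A) ×
    (∀ C → IsCodimensionMatrix C → HasIntegralSpectrum C)
corollary4p11 V W _ = adjacency-integral , codimension-integral
  where open ReflectionGroups V W
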